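{- Let $n\ge 0$ and $g\ge 0$. The mapping $\Psi=\Lambda\circ\Delta$, which associates to a covered map $(M,S)$ the pair $(\Psi_1(M,S),\Psi_2(M,S))$, is a bijection between covered maps with $n$ edges and genus $g$ and pairs made of a rooted plane tree $\Psi_1(M,S)$ with $n$ edges and a rooted bipartite unicellular map $\Psi_2(M,S)$ with $n+1$ edges and genus $g$ (all maps considered up to isomorphism). Moreover, if the vertices of $\Psi_2(M,S)$ are colored white and black so that every edge joins a white and a black vertex and the root-vertex is white, then $\Psi_2(M,S)$ has $v(M)$ white vertices and $f(M)$ black vertices, where $v(M)$ and $f(M)$ are the numbers of vertices and faces of $M$.
   Context: Permutations are composed right to left: $(\sigma\alpha)(h)=\sigma(\alpha(h))$. A (rooted) map is a triple $M=(H,\sigma,\alpha)$ where $H$ is a finite set (half-edges), $\alpha$ is a fixed-point-free involution of $H$, $\sigma$ is a permutation of $H$, the group generated by $\sigma,\alpha$ acts transitively on $H$, together with a distinguished root $r\in H$. Maps are considered up to isomorphism: a bijection $\lambda:H\to H'$ with $\sigma'=\lambda\sigma\lambda^{ -1}$, $\alpha'=\lambda\alpha\lambda^{ -1}$, $\lambda(r)=r'$. The cycles of $\sigma$, $\alpha$, $\phi=\sigma\alpha$ are the vertices, edges and faces; with $v,e,f$ their numbers, the genus $g$ is defined by $v-e+f=2-2g$. The case $H=\emptyset$ is allowed and counts as a unicellular map of genus 0 with one vertex and no edge. A map is unicellular if it has one face; a plane tree is a unicellular map of genus $0$; a map is bipartite if its vertices can be 2-colored so that each edge joins vertices of different colors.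 For a permutation $\pi$ of $H$ and $S\subseteq H$, the restriction $\pi_{|S}$ is the permutation of $S$ whose cycles are obtained from those of $\pi$ by erasing the elements not in $S$ (it may be regarded as a permutation of $H$ fixing $H\setminus S$). A spanned map is a pair $(M,S)$ with $S\subseteq H$ stable under $\alpha$; its submap is $M_{|S}=(S,\sigma_{|S},\alpha_{|S})$. $(M,S)$ is a covered map if $M_{|S}$ is a connecting unicellular map: $\sigma_{|S},\alpha_{|S}$ act transitively on $S$, $S$ meets every cycle of $\sigma$ (except that $S=\emptyset$ is allowed when $M$ has a single vertex), and $\sigma_{|S}\alpha_{|S}$ has one cycle. The motion function is $\theta(h)=\sigma\alpha(h)$ if $h\in S$ and $\theta(h)=\sigma(h)$ otherwise; for a covered map it is a cyclic permutation of $H$, and the appearance order $\prec_S$ is the total order $r\prec_S\theta(r)\prec_S\theta^2(r)\prec_S\cdots\prec_S\theta^{|H|-1}(r)$. An orientation of $M$ is a partition $H=I\uplus O$ with $\alpha(I)=O$ ($I$ = ingoing half-edges). Step $\Delta$: $\Delta(M,S)=(M,(I,O))$ where $I=\{h\in S:\alpha(h)\prec_S h\}\cup\{h\notin S: h\prec_S\alpha(h)\}$ and $O=H\setminus I$. Step $\Lambda$ (unfolding) applied to $(M,(I,O))$ with $M=(H,\sigma,\alpha)$, root $r$, $\phi=\sigma\alpha$: take two new elements $i,o\notin H$, $H'=H\cup\{i,o\}$, $I'=I\cup\{i\}$, $O'=O\cup\{o\}$, $\alpha'$ the involution of $H'$ extending $\alpha$ with $\alpha'(i)=o$. Let $\sigma'$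 be obtained from $\sigma$ by inserting $i$ just before $r$ in the cycle of $r$ (i.e. $\sigma'(\sigma^{ -1}(r))=i$, $\sigma'(i)=r$) and setting $\sigma'(o)=o$; let $\phi'$ be obtained from $\phi$ by inserting $o$ just before $r$ in its cycle and setting $\phi'(i)=i$. Let $\pi_\circ=\sigma'_{|I'}$ and $\pi_\bullet=\phi'_{|O'}$ (each regarded as a permutation of $H'$ acting as the identity outside $I'$, resp. $O'$), $\pi=\pi_\circ\pi_\bullet^{ -1}$, $\tau'=\sigma'\pi_\circ^{ -1}$, $\tau=\tau'_{|H}$. Then $\Lambda_1(M,(I,O))=A=(H,\tau,\alpha)$ with root $\tau'(i)$ and $\Lambda_2(M,(I,O))=B=(H',\pi,\alpha')$ with root $i$. Finally $\Psi_1=\Lambda_1\circ\Delta$, $\Psi_2=\Lambda_2\circ\Delta$. -}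

module Defs where

open import Data.Bool.Base using (if_then_else_)
open import Data.Fin.Base using (Fin; suc; toℕ; _<_; _≤_)
open import Data.Fin.Patterns using (0F; 1F)
open import Data.Fin.Permutation
  using (Permutation; Permutation′; _⟨$⟩ʳ_; _∘ₚ_; flip; transpose; lift₀; swap; remove; _≈_)
open import Data.Fin.Properties using (_≟_; _<?_; _≤?_; all?; any?)
open import Data.Fin.Subset using (Subset; inside; outside; _∈_; _∉_; ⊤; ∁; Empty)
open import Data.Fin.Subset.Properties using (_∈?_)
import Data.Integer.Base as ℤ
open import Data.List.Base using (allFin; filter; foldr; length)
open import Data.Maybe.Base as Maybe using (Maybe; just; nothing)
open import Data.Maybe.Relation.Unary.Any as Any using (Any)
open import Data.Nat.Base using (ℕ; 2+; _⊔_)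
open import Data.Nat.GeneralisedArithmetic using (iterate)
open import Data.Product.Base using (Σ; ∃-syntax; _×_; _,_; proj₁; proj₂)
open import Data.Sum.Base using (_⊎_)
open import Data.Vec.Base using (_∷_; tabulate)
open import Function.Bundles using (_⇔_)
open import Relation.Binary.Construct.Closure.Equivalence using (EqClosure)
open import Relation.Binary.PropositionalEquality.Core using (_≡_; _≢_)
open import Relation.Nullary.Decidable using (Dec; does; ¬?; _×-dec_; _⊎-dec_)

private
  variable
    l m n : ℕ

------------------------------------------------------------------------
-- Permutations and their cycles

-- Composition is right to left, as opposed to _∘ₚ_.
infixr 9 _·_
_·_ : Permutation m n → Permutation l m → Permutation l n
σ · α = α ∘ₚ σ

SameCycle : Permutation′ m → Fin m → Fin m → Set
SameCycle π x y = ∃[ k ] iterate (π ⟨$⟩ʳ_) x k ≡ y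

-- h is the smallest element of its cycle (whose length is at most m, so
-- that k < m suffices).
IsLeader : Permutation′ m → Fin m → Set
IsLeader {m} π h = (k : Fin m) → h ≤ iterate (π ⟨$⟩ʳ_) h (toℕ k)

isLeader? : (π : Permutation′ m) (h : Fin m) → Dec (IsLeader π h)
isLeader? π h = all? λ k → h ≤? _

-- The number of cycles of π contained in S, where S is a union of cycles
-- of π: each cycle is counted through its smallest element.
#cycles : Subset m → Permutation′ m → ℕ
#cycles S π = length (filter (λ h → (h ∈? S) ×-dec isLeader? π h) (allFin _))

-- Erasing x from its cycle: x becomes a fixed point, and the preimage of
-- x is now sent to the image of x.
erase : Fin m → Permutation′ m → Permutation′ m
erase x π = transpose x (π ⟨$⟩ʳ x) · π

-- The restriction of π to S, regarded as a permutation which is the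
-- identity outside S.
restrict : Subset m → Permutation′ m → Permutation′ m
restrict S π = foldr erase π (filter (λ x → ¬? (x ∈? S)) (allFin _))

-- For a fixed point x of π, inserting x just before r: x is now sent to
-- r, and the preimage of r is now sent to x.
insertBefore : Fin m → Fin m → Permutation′ m → Permutation′ m
insertBefore x r π = transpose x r · π

------------------------------------------------------------------------
-- Maps

-- The half-edge set is H = Fin size, and the root is `nothing` only for
-- H = ∅ (see `IsMap`).
record PreMap : Set where
  field
    {size} : ℕ
    σ α    : Permutation′ size
    root   : Maybe (Fin size)

  φ : Permutation′ size
  φ = σ · α

open PreMap

-- The orbits of the group generated by σ and α are the classes of the
-- equivalence relation generated by h ∼ σ h and h ∼ α h.
TransitiveOn : Subset m → (σ α : Permutation′ m) → Set
TransitiveOn S σ α = ∀ {x y} → x ∈ S → y ∈ S →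
  EqClosure (λ h h′ → σ ⟨$⟩ʳ h ≡ h′ ⊎ α ⟨$⟩ʳ h ≡ h′) x y

record IsMap (M : PreMap) : Set where
  field
    involutive     : ∀ h → α M ⟨$⟩ʳ (α M ⟨$⟩ʳ h) ≡ h
    fixedPointFree : ∀ h → α M ⟨$⟩ʳ h ≢ h
    transitive     : TransitiveOn ⊤ (σ M) (α M)
    rooted         : root M ≡ nothing → size M ≡ 0

-- In #vertices, #faces and #submapFaces, `1 ⊔_` is the convention that
-- the empty map has one vertex and one face; it has no effect in the
-- presence of half-edges, where there is at least one cycle.
#vertices #edges #faces : PreMap → ℕ
#vertices M = 1 ⊔ #cycles ⊤ (σ M)
#edges    M = #cycles ⊤ (α M)
#faces    M = 1 ⊔ #cycles ⊤ (φ M)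

HasGenus : ℕ → PreMap → Set
HasGenus g M =
  ℤ.+ #vertices M ℤ.- ℤ.+ #edges M ℤ.+ ℤ.+ #faces M ≡ ℤ.+ 2 ℤ.- ℤ.+ 2 ℤ.* ℤ.+ g

-- A colouring of the vertices is given by the set W of the half-edges
-- incident to a white vertex.
record IsProperColouring (M : PreMap) (W : Subset (size M)) : Set where
  field
    vertexwise : ∀ h → (σ M ⟨$⟩ʳ h) ∈ W ⇔ h ∈ W
    proper     : ∀ h → (α M ⟨$⟩ʳ h) ∈ W ⇔ h ∉ W

IsBipartite : PreMap → Set
IsBipartite M = ∃[ W ] IsProperColouring M W

-- For a map with at least one edge.
#whiteVertices #blackVertices : (M : PreMap) → Subset (size M) → ℕ
#whiteVertices M W = #cycles W (σ M)
#blackVertices M W = #cycles (∁ W) (σ M)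

record IsPlaneTree (n : ℕ) (M : PreMap) : Set where
  field
    isMap   : IsMap M
    oneFace : #faces M ≡ 1
    genus   : HasGenus 0 M
    edges   : #edges M ≡ n

record IsBipartiteUnicellularMap (n g : ℕ) (M : PreMap) : Set where
  field
    isMap     : IsMap M
    bipartite : IsBipartite M
    oneFace   : #faces M ≡ 1
    genus     : HasGenus g M
    edges     : #edges M ≡ n

record IsIso (M N : PreMap) (ι : Permutation (size M) (size N)) : Set where
  field
    σ-conj : σ N ≈ ι · σ M · flip ι
    α-conj : α N ≈ ι · α M · flip ι
    root-≡ : root N ≡ Maybe.map (ι ⟨$⟩ʳ_) (root M)

_≅_ : PreMap → PreMap → Set
M ≅ N = ∃[ ι ] IsIso M N ι

------------------------------------------------------------------------
-- Spanned maps and covered maps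

#submapFaces : (M : PreMap) → Subset (size M) → ℕ
#submapFaces M S = 1 ⊔ #cycles S (restrict S (σ M) · restrict S (α M))

record IsCovered (M : PreMap) (S : Subset (size M)) : Set where
  field
    stable     : ∀ h → h ∈ S → (α M ⟨$⟩ʳ h) ∈ S
    transitive : TransitiveOn S (restrict S (σ M)) (restrict S (α M))
    connecting : (∀ h → ∃[ s ] s ∈ S × SameCycle (σ M) h s)
               ⊎ (Empty S × #vertices M ≡ 1)
    oneFace    : #submapFaces M S ≡ 1

record CoveredMap (n g : ℕ) : Set where
  field
    map       : PreMap
    submap    : Subset (size map)
    isMap     : IsMap map
    isCovered : IsCovered map submap
    genus     : HasGenus g map
    edges     : #edges map ≡ n

open CoveredMap

_≅ᶜ_ : ∀ {n g} → CoveredMap n g → CoveredMap n g → Set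
C ≅ᶜ D = ∃[ ι ] IsIso (map C) (map D) ι
  × (∀ h → h ∈ submap C ⇔ (ι ⟨$⟩ʳ h) ∈ submap D)

-- A rooted plane tree with n edges, and a rooted bipartite unicellular
-- map with n′ edges and genus g.
Pair : (n n′ g : ℕ) → Set
Pair n n′ g = Σ PreMap (IsPlaneTree n) × Σ PreMap (IsBipartiteUnicellularMap n′ g)

_≅ᵖ_ : ∀ {n n′ g} → Pair n n′ g → Pair n n′ g → Set
(A , B) ≅ᵖ (A′ , B′) = proj₁ A ≅ proj₁ A′ × proj₁ B ≅ proj₁ B′

------------------------------------------------------------------------
-- The step Δ

motion : (M : PreMap) → Subset (size M) → Fin (size M) → Fin (size M)
motion M S h = if does (h ∈? S) then φ M ⟨$⟩ʳ h else σ M ⟨$⟩ʳ h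

-- The appearance order: a precedes b in the sequence
-- r, θ r, θ² r, …, θ^(|H|-1) r.
Precedes : (M : PreMap) (S : Subset (size M)) (a b : Fin (size M)) → Set
Precedes M S a b = Any
  (λ r → ∃[ j ] ∃[ k ] j < k × visit r j ≡ a × visit r k ≡ b)
  (root M)
  where
  visit : Fin (size M) → Fin (size M) → Fin (size M)
  visit r k = iterate (motion M S) r (toℕ k)

precedes? : ∀ M S a b → Dec (Precedes M S a b)
precedes? M S a b = Any.dec
  (λ r → any? λ j → any? λ k → (j <? k) ×-dec ((_ ≟ a) ×-dec (_ ≟ b)))
  (root M)

-- An orientation H = I ⊎ O is given by its set I of ingoing half-edges.
Δ : (M : PreMap) → Subset (size M) → Subset (size M)
Δ M S = tabulate λ h → does
  (((h ∈? S) ×-dec precedes? M S (α M ⟨$⟩ʳ h) h) ⊎-dec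
   (¬? (h ∈? S) ×-dec precedes? M S h (α M ⟨$⟩ʳ h)))

------------------------------------------------------------------------
-- The step Λ

-- H′ = Fin (2 + |H|), where i = 0F and o = 1F are the new half-edges and
-- h ∈ H is renamed suc (suc h).
module Unfold (M : PreMap) (I : Subset (size M)) where

  O : Subset (size M)
  O = ∁ I

  I′ O′ H : Subset (2+ (size M))
  I′ = inside  ∷ outside ∷ I
  O′ = outside ∷ inside  ∷ O
  H  = outside ∷ outside ∷ ⊤

  -- Inserting a new half-edge just before the root, if there is one.
  insertRoot : Fin (2+ (size M)) → Permutation′ (size M) → Permutation′ (2+ (size M))
  insertRoot x π =
    Maybe.maybe (λ r → insertBefore x (suc (suc r)) π⁺) π⁺ (root M)
    where
    π⁺ : Permutation′ (2+ (size M))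
    π⁺ = lift₀ (lift₀ π)

  α′ σ′ φ′ π∘ π• π τ′ : Permutation′ (2+ (size M))
  α′ = swap (α M)
  σ′ = insertRoot 0F (σ M)
  φ′ = insertRoot 1F (φ M)
  π∘ = restrict I′ σ′
  π• = restrict O′ φ′
  π  = π∘ · flip π•
  τ′ = σ′ · flip π∘

  -- restrict H τ′ fixes i and o, so `remove` merely drops them.
  τ : Permutation′ (size M)
  τ = remove 0F (remove 0F (restrict H τ′))

  fromH : Fin (2+ (size M)) → Maybe (Fin (size M))
  fromH (suc (suc h)) = just h
  fromH _             = nothing

  Λ₁ Λ₂ : PreMap
  Λ₁ = record { σ = τ ; α = α M ; root = fromH (τ′ ⟨$⟩ʳ 0F) }
  Λ₂ = record { σ = π ; α = α′  ; root = just 0F }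

Ψ₁ Ψ₂ : ∀ {n g} → CoveredMap n g → PreMap
Ψ₁ C = Unfold.Λ₁ (map C) (Δ (map C) (submap C))
Ψ₂ C = Unfold.Λ₂ (map C) (Δ (map C) (submap C))

{-# OPTIONS --safe #-}

-- Add to the half-edges an edge {i, o}, with i inserted before the root and o a leaf: the motion becomes a
-- cyclic permutation θ′ that starts at o and ends at i. Its orientation is characterised by: σ sends an
-- ingoing half-edge to the successor (for θ′) of the first visit of its edge, and an outgoing one to the
-- successor of the second visit. Hence the rank "time of the second visit" increases along the vertices
-- of A until they reach their unique ingoing half-edge, which makes A a tree. Whatever the orientation,
-- conjugating by α shows that the contour of A, restricted to the ingoing half-edges, is inverse to the
-- square of the face permutation of B, restricted to the white half-edges. So B is unicellular because A
-- is, and the edges of A and B can be identified from A and B alone. This identification recovers σ from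
-- (A , B), and then the motion: at its first visit an edge is left by σ of its ingoing half-edge, at the
-- second one by σ of the outgoing half-edge. For an arbitrary tree and an arbitrary mobile this walk
-- visits everything, since an unvisited edge would force an unvisited edge of greater rank, up to {i, o}.

module Submission where

open import Data.Empty using (⊥-elim)
open import Data.Fin.Base as Fin using (Fin; zero; suc; toℕ; fromℕ<)
open import Data.Fin.Patterns using (0F; 1F)
open import Data.Fin.Permutation as Perm using (Permutation; Permutation′; permutation; _⟨$⟩ʳ_; _⟨$⟩ˡ_; inverseˡ; inverseʳ; flip; transpose; lift₀; swap; remove; lift₀-remove; ↔⇒≡)
open import Data.Fin.Properties as Finₚ using (_≟_; toℕ-injective; toℕ<n; toℕ-fromℕ<; pigeonhole; injective⇒≤; any?; ¬∀⟶∃¬)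
open import Data.Fin.Subset using (Subset; inside; outside; _∈_; _∉_; ⊤; ∁)
open import Data.Fin.Subset.Properties using (_∈?_; ∈⊤; x∈p⇒x∉∁p; x∈∁p⇒x∉p; x∉p⇒x∈∁p; x∉∁p⇒x∈p; nonempty?)
import Data.Fin.Induction as Finᵢ
import Data.Integer.Base as ℤ
import Data.Integer.Properties as ℤ using (+-injective)
import Data.Integer.Tactic.RingSolver as ℤ-Solver
open import Data.List.Base using (List; []; _∷_; length; filter; foldr; allFin; lookup)
open import Data.List.Membership.Propositional using () renaming (_∈_ to _∈ˡ_; _∉_ to _∉ˡ_)
open import Data.List.Membership.Propositional.Properties using (∈-lookup; ∈-filter⁺; ∈-filter⁻; ∈-allFin)
open import Data.List.Membership.DecPropositional using () renaming (_∈?_ to mem?)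
open import Data.List.Properties using (filter-accept; filter-reject; filter-notAll; filter-all; length-tabulate)
open import Data.List.Relation.Unary.All as All using (All; []; _∷_)
open import Data.List.Relation.Unary.AllPairs using ([]; _∷_)
open import Data.List.Relation.Unary.Any as AnyL using (here; there; index)
open import Data.List.Relation.Unary.Any.Properties using (lookup-index)
open import Data.List.Relation.Unary.Unique.Propositional using (Unique)
open import Data.List.Relation.Unary.Unique.Propositional.Properties using (allFin⁺; filter⁺)
open import Data.Maybe.Base as Maybe using (Maybe; just; nothing)
open import Data.Maybe.Properties using (map-id; map-∘; map-cong; just-injective)
open import Data.Maybe.Relation.Unary.Any using (Any; just)
open import Data.Nat.Base using (ℕ; zero; suc; 2+; _+_; _∸_; _⊔_; _≤_; _<_; z≤n; s≤s; s≤s⁻¹)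
open import Data.Nat.Properties as ℕ using (≤-refl; ≤-trans; ≤-antisym; <-cmp; <-irrefl; <-trans)
open import Data.Nat.GeneralisedArithmetic using (iterate)
open import Data.Nat.Induction using (<-wellFounded)
open import Data.Product.Base using (Σ-syntax; ∃-syntax; _×_; _,_; proj₁; proj₂)
open import Data.Sum.Base using (_⊎_; inj₁; inj₂; [_,_]′)
open import Data.Vec.Base using ([]; _∷_; tabulate; here; there)
open import Data.Vec.Properties using (lookup∘tabulate; lookup⇒[]=; []=⇒lookup)
open import Function.Base using (_∘_; id; case_of_)
open import Function.Bundles using (_⇔_; mk⇔; Equivalence; Injection)
open import Function.Properties.Inverse using (↔⇒↣)
open import Function.Structures using (IsBijection)
open import Induction.WellFounded using (Acc; acc)
open import Relation.Binary.Construct.Closure.ReflexiveTransitive as Star using (ε; _◅_)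
open import Relation.Binary.Construct.Closure.Equivalence using (EqClosure)
open import Relation.Binary.Construct.Closure.Symmetric using (fwd)
open import Relation.Binary.Structures using (IsEquivalence)
open import Relation.Binary.Definitions using (tri<; tri≈; tri>)
open import Relation.Binary.PropositionalEquality using (_≡_; _≢_; refl; sym; trans; cong; cong₂; subst; subst₂; module ≡-Reasoning)
open import Relation.Nullary using (¬_; Dec; yes; no; does)
open import Relation.Nullary.Decidable using (_×-dec_; _⊎-dec_; ¬?; decidable-stable; dec-true)
open import Relation.Unary using (Decidable)
open import Defs

-- The relation between the contour of A (`D`, taken on the ingoing half-edges) and the faces of B
-- (`F`) serves three times. It carries connectedness from A to B. It forces an isomorphism of trees
-- and an isomorphism of mobiles to be the same bijection, since both intertwine `D` and agree at i.
-- It lets an arbitrary tree and an arbitrary mobile be glued by aligning two cycles, root edge on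
-- root edge; only the white part `π∘` is then transported, because σ = τ π∘, and the black part
-- follows by cancellation. That A is a tree is a matter of counting: each vertex but {o} has
-- exactly one ingoing half-edge. For the image of a covered map the rank comes from the motion; for
-- a given tree it comes from the contour, and a count of vertices shows that no vertex has two
-- ingoing half-edges. The walk that rebuilds the motion asks only for some rank that is constant on
-- edges and grows under σ at outgoing half-edges. The genus is obtained through the Euler relation
-- alone, once vertices and faces of M are counted as white and black vertices of B. The edge {i, o}
-- also gives the empty map a nonempty tour, so that n = 0 follows the general argument.

private
  variable
    l m n : ℕ

-- Orbits

perm-inj : (π : Permutation m n) {x y : Fin m} → π ⟨$⟩ʳ x ≡ π ⟨$⟩ʳ y → x ≡ y
perm-inj π = Injection.injective (↔⇒↣ π)

iterate-suc : {A : Set} (f : A → A) (x : A) (k : ℕ) → iterate f x (suc k) ≡ f (iterate f x k)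
iterate-suc f x zero    = refl
iterate-suc f x (suc k) = iterate-suc f (f x) k

iterate-+ : {A : Set} (f : A → A) (x : A) (j k : ℕ) → iterate f x (j + k) ≡ iterate f (iterate f x j) k
iterate-+ f x zero    k = refl
iterate-+ f x (suc j) k = iterate-+ f (f x) j k

iterate-inj : (π : Permutation′ m) (k : ℕ) {x y : Fin m} →
  iterate (π ⟨$⟩ʳ_) x k ≡ iterate (π ⟨$⟩ʳ_) y k → x ≡ y
iterate-inj π zero    eq = eq
iterate-inj π (suc k) eq = perm-inj π (iterate-inj π k eq)

-- A data type rather than an instance of Star: comparing two instances compares π by name instead of
-- evaluating it.
data Reach (π : Permutation′ m) : Fin m → Fin m → Set where
  ε   : ∀ {x} → Reach π x x
  _◅_ : ∀ {x y z} → π ⟨$⟩ʳ x ≡ y → Reach π y z → Reach π x z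

infixr 5 _◅_ _◅◅_

_◅◅_ : {π : Permutation′ m} {x y z : Fin m} → Reach π x y → Reach π y z → Reach π x z
ε       ◅◅ s = s
(e ◅ r) ◅◅ s = e ◅ (r ◅◅ s)

Reach-conj : {π : Permutation′ m} {ρ : Permutation′ n} (ι : Fin m → Fin n) →
  (∀ x → ρ ⟨$⟩ʳ (ι x) ≡ ι (π ⟨$⟩ʳ x)) → ∀ {x y} → Reach π x y → Reach ρ (ι x) (ι y)
Reach-conj ι conj ε       = ε
Reach-conj ι conj (e ◅ r) = trans (conj _) (cong ι e) ◅ Reach-conj ι conj r

reach-iterate : (π : Permutation′ m) (x : Fin m) (k : ℕ) → Reach π x (iterate (π ⟨$⟩ʳ_) x k)
reach-iterate π x zero    = ε
reach-iterate π x (suc k) = refl ◅ reach-iterate π (π ⟨$⟩ʳ x) k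

SameCycle⇒Reach : (π : Permutation′ m) {x y : Fin m} → SameCycle π x y → Reach π x y
SameCycle⇒Reach π (k , refl) = reach-iterate π _ k

Reach⇒SameCycle : (π : Permutation′ m) {x y : Fin m} → Reach π x y → SameCycle π x y
Reach⇒SameCycle π ε = 0 , refl
Reach⇒SameCycle π (refl ◅ r) with k , eq ← Reach⇒SameCycle π r = suc k , eq

-- Two of the first m + 1 iterates coincide, and injectivity cancels their common prefix. The bound
-- on d is what allows `IsLeader`, which tests only m iterates, to speak about the whole cycle.
period : (π : Permutation′ m) (x : Fin m) → ∃[ d ] d < m × iterate (π ⟨$⟩ʳ_) x (suc d) ≡ x
period {m} π x
  with i , j , i<j , eq ← pigeonhole (ℕ.n<1+n m) (λ (i : Fin (suc m)) → iterate (π ⟨$⟩ʳ_) x (toℕ i))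
  with d , i+sd≡j ← ℕ.m≤n⇒∃[o]m+o≡n i<j
  = d , ℕ.≤-trans (s≤s (ℕ.m≤n+m d (toℕ i))) (ℕ.≤-trans (ℕ.≤-reflexive i+sd≡j) (s≤s⁻¹ (toℕ<n j)))
  , iterate-inj π (toℕ i) (trans (sym (iterate-+ _ x (suc d) (toℕ i)))
      (trans (cong (iterate _ x) (trans (cong suc (ℕ.+-comm d (toℕ i))) i+sd≡j)) (sym eq)))

-- π is a permutation of a finite set, so every step can be undone by going around the cycle
reach-back : (π : Permutation′ m) (x : Fin m) → Reach π (π ⟨$⟩ʳ x) x
reach-back π x with d , _ , eq ← period π x = subst (Reach π _) eq (reach-iterate π _ d)

reach-sym : (π : Permutation′ m) {x y : Fin m} → Reach π x y → Reach π y x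
reach-sym π ε          = ε
reach-sym π (refl ◅ r) = reach-sym π r ◅◅ reach-back π _

iterate-mod : {A : Set} (f : A → A) (x : A) {d : ℕ} → iterate f x (suc d) ≡ x → ∀ k →
  ∃[ j ] j ≤ d × iterate f x j ≡ iterate f x k
iterate-mod f x per zero = 0 , z≤n , refl
iterate-mod f x per (suc k) with j , j≤d , eq ← iterate-mod f x per k with ℕ.m≤n⇒m<n∨m≡n j≤d
... | inj₁ j<d  = suc j , j<d , trans (iterate-suc f x j) (trans (cong f eq) (sym (iterate-suc f x k)))
... | inj₂ refl = 0 , z≤n , trans (sym per) (trans (iterate-suc f x j) (trans (cong f eq) (sym (iterate-suc f x k))))

iterate-bounded : (π : Permutation′ m) (x : Fin m) (k : ℕ) →
  ∃[ j ] j < m × iterate (π ⟨$⟩ʳ_) x j ≡ iterate (π ⟨$⟩ʳ_) x k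
iterate-bounded π x k with d , d<m , per ← period π x with j , j≤d , eq ← iterate-mod _ x per k
  = j , ℕ.≤-<-trans j≤d d<m , eq

reach-bounded : (π : Permutation′ m) {x y : Fin m} → Reach π x y → ∃[ k ] k < m × iterate (π ⟨$⟩ʳ_) x k ≡ y
reach-bounded π r with k , refl ← Reach⇒SameCycle π r = iterate-bounded π _ k

reach-closed : (π : Permutation′ m) (P : Fin m → Set) → (∀ {x} → P x → P (π ⟨$⟩ʳ x)) →
  ∀ {x y} → Reach π x y → P x → P y
reach-closed π P cl ε p = p
reach-closed π P cl (refl ◅ r) p = reach-closed π P cl r (cl p)

fixed-alone : (π : Permutation′ m) {x y : Fin m} → π ⟨$⟩ʳ x ≡ x → Reach π x y → x ≡ y
fixed-alone π fix ε          = refl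
fixed-alone π fix (e ◅ r) with refl ← trans (sym fix) e = fixed-alone π fix r

-- Counting cycles

leader-≤ : (π : Permutation′ m) {x y : Fin m} → IsLeader π x → Reach π x y → toℕ x ≤ toℕ y
leader-≤ π lead r with k , k<m , refl ← reach-bounded π r
  = subst (λ k → _ ≤ toℕ (iterate _ _ k)) (toℕ-fromℕ< k<m) (lead (fromℕ< k<m))

leader-unique : (π : Permutation′ m) {x y : Fin m} → IsLeader π x → IsLeader π y → Reach π x y → x ≡ y
leader-unique π lx ly r = toℕ-injective (≤-antisym (leader-≤ π lx r) (leader-≤ π ly (reach-sym π r)))

leader : (π : Permutation′ m) (x : Fin m) → ∃[ l ] IsLeader π l × Reach π x l
leader {m} π x = go x (Finᵢ.<-wellFounded x)
  where
  go : ∀ x → Acc Fin._<_ x → ∃[ l ] IsLeader π l × Reach π x l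
  go x (acc rec) with isLeader? π x
  ... | yes lead = x , lead , ε
  ... | no ¬lead
    with k , nle ← ¬∀⟶∃¬ m _ (λ k → x Finₚ.≤? iterate (π ⟨$⟩ʳ_) x (toℕ k)) ¬lead
    with l , lead , r ← go _ (rec (ℕ.≰⇒> nle))
    = l , lead , reach-iterate π x (toℕ k) ◅◅ r

lookup-unique : {A : Set} {xs : List A} → Unique xs → ∀ {i j} → lookup xs i ≡ lookup xs j → i ≡ j
lookup-unique (x∉ ∷ u) {zero}  {zero}  eq = refl
lookup-unique (x∉ ∷ u) {zero}  {suc j} eq = ⊥-elim (All.lookup x∉ (∈-lookup j) eq)
lookup-unique (x∉ ∷ u) {suc i} {zero}  eq = ⊥-elim (All.lookup x∉ (∈-lookup i) (sym eq))
lookup-unique (x∉ ∷ u) {suc i} {suc j} eq = cong suc (lookup-unique u eq)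

-- A relation replaces the usual injection: a partner is chosen inside the proof, as an index into
-- ys, so callers never have to build a function on lists.
length-≤ : {A B : Set} {xs : List A} {ys : List B} (R : A → B → Set) → Unique xs →
  (∀ {x} → x ∈ˡ xs → ∃[ y ] y ∈ˡ ys × R x y) →
  (∀ {x x′ y} → x ∈ˡ xs → x′ ∈ˡ xs → R x y → R x′ y → x ≡ x′) →
  length xs ≤ length ys
length-≤ {xs = xs} {ys} R uniq tot inj = injective⇒≤ {f = f} λ {i} {j} eq → lookup-unique uniq
  (inj (∈-lookup i) (∈-lookup j) (rel i) (subst (R _) (cong (lookup ys) (sym eq)) (rel j)))
  where
  f : Fin (length xs) → Fin (length ys)
  f i = index (proj₁ (proj₂ (tot (∈-lookup i))))
  rel : ∀ i → R (lookup xs i) (lookup ys (f i))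
  rel i with y , y∈ , r ← tot (∈-lookup {xs = xs} i) = subst (R _) (lookup-index y∈) r

leaders : Subset m → Permutation′ m → List (Fin m)
leaders S π = filter (λ h → (h ∈? S) ×-dec isLeader? π h) (allFin _)

∈-leaders : (S : Subset m) (π : Permutation′ m) {x : Fin m} → x ∈ S → IsLeader π x → x ∈ˡ leaders S π
∈-leaders S π x∈ lead = ∈-filter⁺ (λ h → (h ∈? S) ×-dec isLeader? π h) (∈-allFin _) (x∈ , lead)

leaders-∈ : (S : Subset m) (π : Permutation′ m) {x : Fin m} → x ∈ˡ leaders S π → x ∈ S × IsLeader π x
leaders-∈ S π x∈ = proj₂ (∈-filter⁻ (λ h → (h ∈? S) ×-dec isLeader? π h) {xs = allFin _} x∈)

leaders-unique : (S : Subset m) (π : Permutation′ m) → Unique (leaders S π)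
leaders-unique S π = filter⁺ (λ h → (h ∈? S) ×-dec isLeader? π h) (allFin⁺ _)

Closed : Subset m → Permutation′ m → Set
Closed S π = ∀ {x} → x ∈ S → π ⟨$⟩ʳ x ∈ S

⊤-closed : (π : Permutation′ m) → Closed ⊤ π
⊤-closed π _ = ∈⊤

#cycles≤length : {B : Set} (S : Subset m) (π : Permutation′ m) (ys : List B) (R : Fin m → B → Set) →
  (∀ {x} → x ∈ S → ∃[ y ] y ∈ˡ ys × R x y) →
  (∀ {x x′ y} → x ∈ S → x′ ∈ S → R x y → R x′ y → Reach π x x′) →
  #cycles S π ≤ length ys
#cycles≤length S π ys R tot inj = length-≤ R (leaders-unique S π)
  (λ x∈ → tot (proj₁ (leaders-∈ S π x∈)))
  λ x∈ x′∈ r r′ → let (x∈S , lx) = leaders-∈ S π x∈ ; (x′∈S , lx′) = leaders-∈ S π x′∈ in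
    leader-unique π lx lx′ (inj x∈S x′∈S r r′)

-- The relation need not respect cycles. Relating x to the leader of the cycle of a partner turns it
-- into an injection from the cycles of π to those of π′; most equalities between numbers of cycles
-- are two uses of this.
#cycles-≤ : (S : Subset m) (π : Permutation′ m) (S′ : Subset n) (π′ : Permutation′ n) → Closed S′ π′ →
  (R : Fin m → Fin n → Set) →
  (∀ {x} → x ∈ S → ∃[ y ] y ∈ S′ × R x y) →
  (∀ {x x′ y y′} → x ∈ S → x′ ∈ S → R x y → R x′ y′ → Reach π′ y y′ → Reach π x x′) →
  #cycles S π ≤ #cycles S′ π′
#cycles-≤ S π S′ π′ cl R tot inj = #cycles≤length S π (leaders S′ π′)
  (λ x l → ∃[ y ] R x y × Reach π′ y l)
  (λ x∈ → let (y , y∈ , r) = tot x∈ ; (l , lead , y⇝l) = leader π′ y in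
    l , ∈-leaders S′ π′ (reach-closed π′ (_∈ S′) cl y⇝l y∈) lead , y , r , y⇝l)
  λ x∈ x′∈ (y , r , y⇝l) (y′ , r′ , y′⇝l) → inj x∈ x′∈ r r′ (y⇝l ◅◅ reach-sym π′ y′⇝l)

∈ˡ⇒length≥1 : {A : Set} {xs : List A} {z : A} → z ∈ˡ xs → 1 ≤ length xs
∈ˡ⇒length≥1 (here _)  = s≤s z≤n
∈ˡ⇒length≥1 (there _) = s≤s z≤n

#cycles≥1 : (S : Subset m) (π : Permutation′ m) {x : Fin m} → x ∈ S → Closed S π → 1 ≤ #cycles S π
#cycles≥1 S π {x} x∈ cl with l , lead , r ← leader π x
  = ∈ˡ⇒length≥1 (∈-leaders S π (reach-closed π (_∈ S) cl r x∈) lead)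

#cycles≡1 : (S : Subset m) (π : Permutation′ m) {x : Fin m} → x ∈ S → Closed S π →
  (∀ {y z} → y ∈ S → z ∈ S → Reach π y z) → #cycles S π ≡ 1
#cycles≡1 S π {x} x∈ cl conn = ≤-antisym
  (#cycles≤length S π (x ∷ []) (λ _ _ → Fin 1) (λ _ → x , here refl , zero) λ y∈ z∈ _ _ → conn y∈ z∈)
  (#cycles≥1 S π x∈ cl)

#cycles≤1⇒Reach : (S : Subset m) (π : Permutation′ m) → Closed S π → #cycles S π ≤ 1 →
  ∀ {x y} → x ∈ S → y ∈ S → Reach π x y
#cycles≤1⇒Reach S π cl ≤1 {x} {y} x∈ y∈ with lx , leadx , rx ← leader π x with ly , leady , ry ← leader π y
  = rx ◅◅ subst (λ l → Reach π l y)
      (same ≤1 (∈-leaders S π (reach-closed π (_∈ S) cl ry y∈) leady) (∈-leaders S π (reach-closed π (_∈ S) cl rx x∈) leadx))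
      (reach-sym π ry)
  where
  same : {xs : List (Fin _)} {a b : Fin _} → length xs ≤ 1 → a ∈ˡ xs → b ∈ˡ xs → a ≡ b
  same {_ ∷ []} _ (here refl) (here refl) = refl
  same {_ ∷ _ ∷ _} (s≤s ()) _ _

length-filter-⊎ : {A : Set} {P Q R : A → Set} (P? : Decidable P) (Q? : Decidable Q) (R? : Decidable R) →
  (∀ x → R x → P x ⊎ Q x) → (∀ {x} → P x → ¬ Q x) → (∀ {x} → P x → R x) → (∀ {x} → Q x → R x) → ∀ xs →
  length (filter P? xs) + length (filter Q? xs) ≡ length (filter R? xs)
length-filter-⊎ P? Q? R? split dis PR QR [] = refl
length-filter-⊎ P? Q? R? split dis PR QR (x ∷ xs) with ih ← length-filter-⊎ P? Q? R? split dis PR QR xs with P? x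
... | yes p
  rewrite filter-reject Q? {x} {xs} (dis p) | filter-accept R? {x} {xs} (PR p) = cong suc ih
... | no ¬p with Q? x
... | yes q
  rewrite filter-accept R? {x} {xs} (QR q) = trans (ℕ.+-suc _ _) (cong suc ih)
... | no ¬q
  rewrite filter-reject R? {x} {xs} (λ r → [ ¬p , ¬q ]′ (split x r)) = ih

-- `#cycles` counts leaders, and each leader lies on one side of S, so the count splits for any S.
#cycles-∁ : (S : Subset m) (π : Permutation′ m) → #cycles S π + #cycles (∁ S) π ≡ #cycles ⊤ π
#cycles-∁ {m} S π = length-filter-⊎ (P? S) (P? (∁ S)) (P? ⊤)
  (λ x (_ , lead) → case x ∈? S of λ where
    (yes x∈) → inj₁ (x∈ , lead)
    (no x∉)  → inj₂ (x∉p⇒x∈∁p x∉ , lead))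
  (λ (x∈ , _) (x∈∁ , _) → x∈p⇒x∉∁p x∈ x∈∁)
  (λ (_ , lead) → ∈⊤ , lead) (λ (_ , lead) → ∈⊤ , lead) (allFin m)
  where
  P? : (T : Subset m) (h : Fin m) → Dec (h ∈ T × IsLeader π h)
  P? T h = (h ∈? T) ×-dec isLeader? π h

id-leader : (x : Fin m) → IsLeader Perm.id x
id-leader x k = ℕ.≤-reflexive (cong toℕ (sym (fix x (toℕ k))))
  where
  fix : ∀ x k → iterate (Perm.id ⟨$⟩ʳ_) x k ≡ x
  fix x zero    = refl
  fix x (suc k) = fix x k

#cycles-id : (n : ℕ) → #cycles ⊤ (Perm.id {n}) ≡ n
#cycles-id n = trans (cong length (filter-all (λ h → (h ∈? ⊤) ×-dec isLeader? Perm.id h) {allFin n}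
  (All.tabulate λ {x} _ → ∈⊤ , id-leader x))) (length-tabulate id)

-- First returns and restrictions

transpose-left : (i j : Fin m) → transpose i j ⟨$⟩ʳ i ≡ j
transpose-left i j with i ≟ i
... | yes _  = refl
... | no i≢i = ⊥-elim (i≢i refl)

transpose-right : (i j : Fin m) → transpose i j ⟨$⟩ʳ j ≡ i
transpose-right i j with j ≟ i
... | yes j≡i = j≡i
... | no _ with j ≟ j
... | yes _  = refl
... | no j≢j = ⊥-elim (j≢j refl)

transpose-other : (i j : Fin m) {k : Fin m} → k ≢ i → k ≢ j → transpose i j ⟨$⟩ʳ k ≡ k
transpose-other i j {k} k≢i k≢j with k ≟ i
... | yes k≡i = ⊥-elim (k≢i k≡i)
... | no _ with k ≟ j
... | yes k≡j = ⊥-elim (k≢j k≡j)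
... | no _    = refl

-- The first element of P that π meets after leaving x, where x itself may lie in P or not. The
-- derivation lists the skipped elements, so statements about restrictions become inductions without
-- any number of steps.
data Ret (P : Fin m → Set) (π : Permutation′ m) : Fin m → Fin m → Set where
  stop : ∀ {x y} → π ⟨$⟩ʳ x ≡ y → P y → Ret P π x y
  skip : ∀ {x y z} → π ⟨$⟩ʳ x ≡ z → ¬ P z → Ret P π z y → Ret P π x y

module _ {P : Fin m → Set} {π : Permutation′ m} where

  Ret-target : ∀ {x y} → Ret P π x y → P y
  Ret-target (stop _ p)   = p
  Ret-target (skip _ _ r) = Ret-target r

  Ret⇒Reach : ∀ {x y} → Ret P π x y → Reach π x y
  Ret⇒Reach (stop e _)   = e ◅ ε
  Ret⇒Reach (skip e _ r) = e ◅ Ret⇒Reach r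

  Ret-deterministic : ∀ {x y z} → Ret P π x y → Ret P π x z → y ≡ z
  Ret-deterministic (stop refl _)    (stop refl _)    = refl
  Ret-deterministic (stop refl p)    (skip refl ¬p _) = ⊥-elim (¬p p)
  Ret-deterministic (skip refl ¬p _) (stop refl p)    = ⊥-elim (¬p p)
  Ret-deterministic (skip refl _ r)  (skip refl _ s)  = Ret-deterministic r s

  Ret-weaken : ∀ {Q : Fin m → Set} {x y} → (∀ {z} → ¬ P z → ¬ Q z) → Ret P π x y → Q y → Ret Q π x y
  Ret-weaken PQ (stop e _)    q = stop e q
  Ret-weaken PQ (skip e ¬p r) q = skip e (PQ ¬p) (Ret-weaken PQ r q)

  Ret-join : ∀ {Q : Fin m → Set} {x y z} → (∀ {z} → ¬ P z → ¬ Q z) → Ret P π x z → ¬ Q z → Ret Q π z y → Ret Q π x y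
  Ret-join PQ (stop e _)    ¬q s = skip e ¬q s
  Ret-join PQ (skip e ¬p r) ¬q s = skip e (PQ ¬p) (Ret-join PQ r ¬q s)

  -- A return applies π only at its start and at skipped points; hence π may be exchanged for a
  -- permutation that agrees with it off P and has the same first image. This is how σ is traded for
  -- τ, and σ for the motion.
  Ret-head : ∀ {π′ : Permutation′ m} {x y z} → (∀ {w} → ¬ P w → π ⟨$⟩ʳ w ≡ π′ ⟨$⟩ʳ w) → π ⟨$⟩ʳ x ≡ π′ ⟨$⟩ʳ y →
    Ret P π x z → Ret P π′ y z
  Ret-head off eq (stop e p)    = stop (trans (sym eq) e) p
  Ret-head off eq (skip e ¬p r) = skip (trans (sym eq) e) ¬p (Ret-head off (off ¬p) r)

  Ret-conj : ∀ {Q : Fin n → Set} {π′ : Permutation′ n} (ι : Fin m → Fin n) →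
    (∀ {x} → P x → Q (ι x)) → (∀ {x} → ¬ P x → ¬ Q (ι x)) → (∀ x → π′ ⟨$⟩ʳ (ι x) ≡ ι (π ⟨$⟩ʳ x)) →
    ∀ {x y} → Ret P π x y → Ret Q π′ (ι x) (ι y)
  Ret-conj ι PQ ¬PQ conj (stop e p)    = stop (trans (conj _) (cong ι e)) (PQ p)
  Ret-conj ι PQ ¬PQ conj (skip e ¬p r) = skip (trans (conj _) (cong ι e)) (¬PQ ¬p) (Ret-conj ι PQ ¬PQ conj r)

-- Induction on the list. Erasing `a` redirects only its preimage, whose return first arrives at `a`
-- and is then continued by the return of `a` itself.
erase-all : (π : Permutation′ m) (xs : List (Fin m)) →
  (∀ {x} → x ∈ˡ xs → foldr erase π xs ⟨$⟩ʳ x ≡ x) ×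
  (∀ {x} → x ∉ˡ xs → Ret (_∉ˡ xs) π x (foldr erase π xs ⟨$⟩ʳ x))
erase-all π [] = (λ ()) , λ _ → stop refl λ ()
erase-all {m} π (a ∷ xs) with fixed , ret ← erase-all π xs = fixed′ , ret′
  where
  ρ = foldr erase π xs
  fixed′ : ∀ {x} → x ∈ˡ (a ∷ xs) → erase a ρ ⟨$⟩ʳ x ≡ x
  fixed′ (here refl) = transpose-right a (ρ ⟨$⟩ʳ a)
  fixed′ {x} (there x∈) with x ≟ a
  ... | yes refl = transpose-right a (ρ ⟨$⟩ʳ a)
  ... | no x≢a   = trans (cong (transpose a (ρ ⟨$⟩ʳ a) ⟨$⟩ʳ_) (fixed x∈))
    (transpose-other a (ρ ⟨$⟩ʳ a) x≢a λ x≡ρa → x≢a (perm-inj ρ (trans (fixed x∈) x≡ρa)))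
  ∉⇒∉∷ : ∀ {z} → ¬ (z ∉ˡ xs) → ¬ (z ∉ˡ (a ∷ xs))
  ∉⇒∉∷ z∈ z∉ = z∈ (λ z∈xs → z∉ (there z∈xs))
  ret′ : ∀ {x} → x ∉ˡ (a ∷ xs) → Ret (_∉ˡ (a ∷ xs)) π x (erase a ρ ⟨$⟩ʳ x)
  ret′ {x} x∉ = go (ρ ⟨$⟩ʳ x ≟ a)
    where
    x≢a : x ≢ a
    x≢a refl = x∉ (here refl)
    go : Dec (ρ ⟨$⟩ʳ x ≡ a) → Ret (_∉ˡ (a ∷ xs)) π x (erase a ρ ⟨$⟩ʳ x)
    go (yes ρx≡a) = subst (Ret _ π x) (sym (trans (cong (transpose a (ρ ⟨$⟩ʳ a) ⟨$⟩ʳ_) ρx≡a) (transpose-left a (ρ ⟨$⟩ʳ a))))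
        (Ret-join ∉⇒∉∷ (subst (Ret _ π x) ρx≡a (ret (x∉ ∘ there))) (λ a∉ → a∉ (here refl))
          (Ret-weaken ∉⇒∉∷ (ret a∉xs) λ where
            (here ρa≡a) → x≢a (perm-inj ρ (trans ρx≡a (sym ρa≡a)))
            (there ρa∈) → Ret-target (ret a∉xs) ρa∈))
      where
      a∉xs : a ∉ˡ xs
      a∉xs a∈ = x≢a (perm-inj ρ (trans ρx≡a (sym (fixed a∈))))
    go (no ρx≢a) = subst (Ret _ π x) (sym (transpose-other a (ρ ⟨$⟩ʳ a) ρx≢a (λ ρx≡ρa → x≢a (perm-inj ρ ρx≡ρa))))
        (Ret-weaken ∉⇒∉∷ (ret (x∉ ∘ there)) λ where
          (here ρx≡a) → ρx≢a ρx≡a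
          (there ρx∈) → Ret-target (ret (x∉ ∘ there)) ρx∈)

module _ (S : Subset m) (π : Permutation′ m) where
  private
    outsiders = filter (λ x → ¬? (x ∈? S)) (allFin m)
    ∉⇒∈ˡ : ∀ {x} → x ∉ S → x ∈ˡ outsiders
    ∉⇒∈ˡ x∉ = ∈-filter⁺ (λ x → ¬? (x ∈? S)) (∈-allFin _) x∉
    ∈ˡ⇒∉ : ∀ {x} → x ∈ˡ outsiders → x ∉ S
    ∈ˡ⇒∉ x∈ = proj₂ (∈-filter⁻ (λ x → ¬? (x ∈? S)) {xs = allFin m} x∈)

  abstract
    restrict-∉ : ∀ {x} → x ∉ S → restrict S π ⟨$⟩ʳ x ≡ x
    restrict-∉ x∉ = proj₁ (erase-all π outsiders) (∉⇒∈ˡ x∉)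

    restrict-Ret : ∀ {x} → x ∈ S → Ret (_∈ S) π x (restrict S π ⟨$⟩ʳ x)
    restrict-Ret {x} x∈ = Ret-weaken {P = _∉ˡ outsiders} (λ z∈ z∈S → z∈ (λ z∈o → ∈ˡ⇒∉ z∈o z∈S)) ret
      (decidable-stable (_ ∈? S) (λ y∉ → Ret-target ret (∉⇒∈ˡ y∉)))
      where
      ret : Ret (_∉ˡ outsiders) π x (restrict S π ⟨$⟩ʳ x)
      ret = proj₂ (erase-all π outsiders) (λ x∈o → ∈ˡ⇒∉ x∈o x∈)

  restrict-closed : Closed S (restrict S π)
  restrict-closed x∈ = Ret-target (restrict-Ret x∈)

  Ret⇒restrict : ∀ {x y} → x ∈ S → Ret (_∈ S) π x y → restrict S π ⟨$⟩ʳ x ≡ y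
  Ret⇒restrict x∈ r = Ret-deterministic (restrict-Ret x∈) r

  restrict-stable : ∀ {x} → x ∈ S → π ⟨$⟩ʳ x ∈ S → restrict S π ⟨$⟩ʳ x ≡ π ⟨$⟩ʳ x
  restrict-stable x∈ πx∈ = Ret⇒restrict x∈ (stop refl πx∈)

  Reach-restrict⁻ : ∀ {x y} → x ∈ S → Reach (restrict S π) x y → Reach π x y
  Reach-restrict⁻ x∈ ε = ε
  Reach-restrict⁻ x∈ (refl ◅ r) = Ret⇒Reach (restrict-Ret x∈) ◅◅ Reach-restrict⁻ (restrict-closed x∈) r

  Reach-restrict : ∀ {x y} → x ∈ S → y ∈ S → Reach π x y → Reach (restrict S π) x y
  Reach-restrict {y = y} x∈ y∈ r = goS x∈ r
    where
    goS : ∀ {x} → x ∈ S → Reach π x y → Reach (restrict S π) x y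
    -- The continuation remembers the elements skipped between x and z: it prefixes them to any
    -- return from z.
    goN : ∀ {x z} → x ∈ S → z ∉ S → (∀ {u} → Ret (_∈ S) π z u → Ret (_∈ S) π x u) → Reach π z y →
      Reach (restrict S π) x y
    goS x∈ ε = ε
    goS x∈ (_◅_ {y = z} e r) with z ∈? S
    ... | yes z∈ = Ret⇒restrict x∈ (stop e z∈) ◅ goS z∈ r
    ... | no z∉  = goN x∈ z∉ (skip e z∉) r
    goN x∈ z∉ K ε = ⊥-elim (z∉ y∈)
    goN x∈ z∉ K (_◅_ {y = w} e r) with w ∈? S
    ... | yes w∈ = Ret⇒restrict x∈ (K (stop e w∈)) ◅ goS w∈ r
    ... | no w∉  = goN x∈ w∉ (λ s → K (skip e w∉ s)) r

restrict-conj : (S : Subset m) (π : Permutation′ m) (T : Subset n) (ρ : Permutation′ n) (ι : Fin m → Fin n) →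
  (∀ {x} → x ∈ S → ι x ∈ T) → (∀ {x} → x ∉ S → ι x ∉ T) → (∀ x → ρ ⟨$⟩ʳ (ι x) ≡ ι (π ⟨$⟩ʳ x)) →
  ∀ x → restrict T ρ ⟨$⟩ʳ (ι x) ≡ ι (restrict S π ⟨$⟩ʳ x)
restrict-conj S π T ρ ι ∈ι ∉ι conj x with x ∈? S
... | yes x∈ = Ret⇒restrict T ρ (∈ι x∈) (Ret-conj ι ∈ι ∉ι conj (restrict-Ret S π x∈))
... | no x∉  = trans (restrict-∉ T ρ (∉ι x∉)) (cong ι (sym (restrict-∉ S π x∉)))

-- A cycle survives restriction exactly when it meets S, whence the condition that S meets every
-- cycle inside T.
#cycles-restrict : (S T : Subset m) (π : Permutation′ m) → Closed T π → (∀ {x} → x ∈ S → x ∈ T) →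
  (∀ {x} → x ∈ T → ∃[ y ] y ∈ S × Reach π x y) → #cycles S (restrict S π) ≡ #cycles T π
#cycles-restrict S T π clT S⊆T hit = ≤-antisym
  (#cycles-≤ S (restrict S π) T π clT _≡_ (λ x∈ → _ , S⊆T x∈ , refl)
    λ { x∈ x′∈ refl refl r → Reach-restrict S π x∈ x′∈ r })
  (#cycles-≤ T π S (restrict S π) (restrict-closed S π) (λ x y → y ∈ S × Reach π x y)
    (λ x∈ → let (y , y∈ , r) = hit x∈ in y , y∈ , y∈ , r)
    λ _ _ (y∈ , r) (y′∈ , r′) s → r ◅◅ Reach-restrict⁻ S π y∈ s ◅◅ reach-sym π r′)

-- Subsets cut out by decidable predicates

comprehension : {P : Fin m → Set} → Decidable P → Subset m
comprehension P? = tabulate λ h → does (P? h)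

module _ {P : Fin m → Set} (P? : Decidable P) where

  ∈-comprehension⁺ : ∀ {x} → P x → x ∈ comprehension P?
  ∈-comprehension⁺ {x} p = lookup⇒[]= x _ (trans (lookup∘tabulate _ x) (dec-true (P? x) p))

  ∈-comprehension⁻ : ∀ {x} → x ∈ comprehension P? → P x
  ∈-comprehension⁻ {x} x∈ = does⁻ (P? x) (trans (sym (lookup∘tabulate _ x)) ([]=⇒lookup x∈))
    where
    does⁻ : (d : Dec (P x)) → does d ≡ inside → P x
    does⁻ (yes p) _ = p

-- Positions along a cyclic permutation

least : {P : ℕ → Set} → Decidable P → ∀ k → P k → ∃[ i ] P i × (∀ {j} → P j → i ≤ j)
least P? zero p = 0 , p , λ _ → z≤n
least {P} P? (suc k) p with P? 0
... | yes p₀ = 0 , p₀ , λ _ → z≤n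
... | no ¬p₀ with i , pᵢ , min ← least {λ j → P (suc j)} (λ j → P? (suc j)) k p
  = suc i , pᵢ , below
  where
  below : ∀ {j} → P j → suc i ≤ j
  below {zero}  p₀ = ⊥-elim (¬p₀ p₀)
  below {suc j} pⱼ = s≤s (min pⱼ)

-- Here π is a single cycle, read as a tour that starts at s: `pos` is the time of the first visit,
-- and `last` is the element from which the tour returns to s.
module Tour (π : Permutation′ n) (s : Fin n) (reach : ∀ x → Reach π s x) where

  abstract
    visit : ℕ → Fin n
    visit = iterate (π ⟨$⟩ʳ_) s

    visit-zero : visit 0 ≡ s
    visit-zero = refl

    visit-suc : ∀ k → visit (suc k) ≡ π ⟨$⟩ʳ visit k
    visit-suc = iterate-suc _ s

    visit-mod : ∀ {d} → visit (suc d) ≡ s → ∀ k → ∃[ j ] j ≤ d × visit j ≡ visit k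
    visit-mod = iterate-mod (π ⟨$⟩ʳ_) s

    pos-spec : ∀ x → ∃[ k ] visit k ≡ x × (∀ {j} → visit j ≡ x → k ≤ j)
    pos-spec x with k , eq ← Reach⇒SameCycle π (reach x) = least (λ k → visit k ≟ x) k eq

    pos : Fin n → ℕ
    pos x = proj₁ (pos-spec x)

    visit-pos : ∀ x → visit (pos x) ≡ x
    visit-pos x = proj₁ (proj₂ (pos-spec x))

    pos-min : ∀ {k x} → visit k ≡ x → pos x ≤ k
    pos-min = proj₂ (proj₂ (pos-spec _))

    pos< : ∀ x → pos x < n
    pos< x with k , k<n , eq ← reach-bounded π (reach x) = ℕ.≤-<-trans (pos-min eq) k<n

  pos-inj : ∀ {x y} → pos x ≡ pos y → x ≡ y
  pos-inj {x} {y} eq = trans (sym (visit-pos x)) (trans (cong visit eq) (visit-pos y))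

  pos-start : pos s ≡ 0
  pos-start = ℕ.n≤0⇒n≡0 (pos-min visit-zero)

  pos≡0 : ∀ {x} → pos x ≡ 0 → x ≡ s
  pos≡0 eq = pos-inj (trans eq (sym pos-start))

  pos-suc : ∀ {x} → π ⟨$⟩ʳ x ≢ s → pos (π ⟨$⟩ʳ x) ≡ suc (pos x)
  pos-suc {x} ≢s with pos (π ⟨$⟩ʳ x) in eq
  ... | zero  = ⊥-elim (≢s (pos≡0 eq))
  ... | suc k = cong suc (≤-antisym
    (s≤s⁻¹ (subst (_≤ suc (pos x)) eq (pos-min (trans (visit-suc (pos x)) (cong (π ⟨$⟩ʳ_) (visit-pos x))))))
    (pos-min (perm-inj π (trans (sym (visit-suc k)) (trans (cong visit (sym eq)) (visit-pos _))))))

  last : Fin n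
  last = π ⟨$⟩ˡ s

  π-last : π ⟨$⟩ʳ last ≡ s
  π-last = inverseʳ π

  last-unique : ∀ {x} → π ⟨$⟩ʳ x ≡ s → x ≡ last
  last-unique eq = perm-inj π (trans eq (sym π-last))

  pos-visit : ∀ k → k ≤ pos last → pos (visit k) ≡ k
  pos-visit zero    _ = trans (cong pos visit-zero) pos-start
  pos-visit (suc k) k< = trans (cong pos (visit-suc k)) (trans (pos-suc ≢s) (cong suc ih))
    where
    ih = pos-visit k (ℕ.<⇒≤ k<)
    ≢s : π ⟨$⟩ʳ visit k ≢ s
    ≢s eq = ℕ.<⇒≢ k< (trans (sym ih) (cong pos (last-unique eq)))

  visit-suc-last : visit (suc (pos last)) ≡ s
  visit-suc-last = trans (visit-suc (pos last)) (trans (cong (π ⟨$⟩ʳ_) (visit-pos last)) π-last)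

  pos≤last : ∀ x → pos x ≤ pos last
  pos≤last x with k , k≤ , eq ← visit-mod visit-suc-last (pos x) = ≤-trans (pos-min (trans eq (visit-pos x))) k≤

  -- Positions are injective and bounded by `pos last`, so n elements fit into `suc (pos last)`
  -- places.
  pos-last : suc (pos last) ≡ n
  pos-last = ≤-antisym (pos< last) (injective⇒≤ {f = λ x → fromℕ< (s≤s (pos≤last x))} λ {x} {y} eq →
    pos-inj (trans (sym (toℕ-fromℕ< (s≤s (pos≤last x)))) (trans (cong toℕ eq) (toℕ-fromℕ< (s≤s (pos≤last y))))))

-- Arborescences

record IsOrientation (α : Permutation′ m) (I : Subset m) : Set where
  field
    involutive : ∀ x → α ⟨$⟩ʳ (α ⟨$⟩ʳ x) ≡ x
    ∈⇒∉        : ∀ {x} → x ∈ I → α ⟨$⟩ʳ x ∉ I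
    ∉⇒∈        : ∀ {x} → x ∉ I → α ⟨$⟩ʳ x ∈ I

module Ascent (rk : Fin m → ℕ) (K : ℕ) (rk≤ : ∀ x → rk x ≤ K) where

  ascend : (P : Fin m → Set) → (∀ x → (∀ y → rk x < rk y → P y) → P x) → ∀ x → P x
  ascend P step x = go x (<-wellFounded (K ∸ rk x))
    where
    go : ∀ x → Acc _<_ (K ∸ rk x) → P x
    go x (acc rec) = step x λ y x<y → go y (rec (ℕ.∸-monoʳ-< x<y (rk≤ y)))

  module _ (S : Subset m) (π : Permutation′ m) (o : Fin m)
    (up : ∀ {x} → x ∉ S → x ≢ o → rk x < rk (π ⟨$⟩ʳ x)) where

    -- Outside S the rank grows along π, and it is bounded; the path must therefore enter S or stop
    -- at o. The last component keeps the increase strict when at least one step was made.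
    sink : ∀ x → (∃[ y ] y ∈ S × Reach π x y × rk x ≤ rk y × (x ∉ S → rk x < rk y)) ⊎ Reach π x o
    sink = ascend _ λ x ih → case x ∈? S of λ where
      (yes x∈) → inj₁ (x , x∈ , ε , ≤-refl , λ x∉ → ⊥-elim (x∉ x∈))
      (no x∉) → case x ≟ o of λ where
        (yes refl) → inj₂ ε
        (no x≢o) → case ih _ (up x∉ x≢o) of λ where
          (inj₁ (y , y∈ , r , ≤y , _)) → let x<y = ℕ.<-≤-trans (up x∉ x≢o) ≤y in
            inj₁ (y , y∈ , refl ◅ r , ℕ.<⇒≤ x<y , λ _ → x<y)
          (inj₂ r) → inj₂ (refl ◅ r)

-- The vertices of a plane tree are the cycles of τ, the leaf {o} being the root; the ingoing half-edge
-- of an edge is the one on the child's side, and the rank increases towards the root.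
record Arborescence (α τ : Permutation′ m) (I : Subset m) (o : Fin m) : Set where
  field
    orientation : IsOrientation α I
    rk          : Fin m → ℕ
    bound       : ℕ
    rk≤         : ∀ x → rk x ≤ bound
    rk-α        : ∀ x → rk (α ⟨$⟩ʳ x) ≡ rk x
    up          : ∀ {x} → x ∉ I → x ≢ o → rk x < rk (τ ⟨$⟩ʳ x)
    unique      : ∀ {x y} → x ∈ I → y ∈ I → Reach τ x y → x ≡ y
    τ-o         : τ ⟨$⟩ʳ o ≡ o
    o∉I         : o ∉ I

  open IsOrientation orientation public
  open Ascent rk bound rk≤ public

  reach-o : ∀ {x} → Reach τ x o → x ≡ o
  reach-o r = sym (fixed-alone τ τ-o (reach-sym τ r))

  -- The fixed point o is reached only from itself, which leaves the first outcome of `sink`: the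
  -- ingoing half-edge of the vertex of x, on the edge to its parent.
  parent : ∀ x → x ≢ o → ∃[ y ] y ∈ I × Reach τ x y × rk x ≤ rk y × (x ∉ I → rk x < rk y)
  parent x x≢o with sink I τ o up x
  ... | inj₁ p = p
  ... | inj₂ r = ⊥-elim (x≢o (reach-o r))

  -- The contour tours the subtree below the edge of x and comes out at `α x`. The outer induction
  -- is on the rank of x; the inner one goes around the child's vertex from `τ (α x)` up to its
  -- ingoing half-edge `α x`. An outgoing g met there has smaller rank than x, so its subtree is
  -- toured by the outer hypothesis, and the contour goes on with `τ g`.
  paired : ∀ x → x ∉ I → Reach (τ · α) x (α ⟨$⟩ʳ x)
  paired x = go x (<-wellFounded (rk x))
    where
    go : ∀ x → Acc _<_ (rk x) → x ∉ I → Reach (τ · α) x (α ⟨$⟩ʳ x)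
    go x (acc rec) x∉ = refl ◅ ascend (λ g → Reach τ (α ⟨$⟩ʳ x) g → Reach (τ · α) g (α ⟨$⟩ʳ x)) chain _ (refl ◅ ε)
      where
      chain : ∀ g → (∀ h → rk g < rk h → Reach τ (α ⟨$⟩ʳ x) h → Reach (τ · α) h (α ⟨$⟩ʳ x)) →
        Reach τ (α ⟨$⟩ʳ x) g → Reach (τ · α) g (α ⟨$⟩ʳ x)
      chain g ih r with g ∈? I
      ... | yes g∈ = subst (Reach (τ · α) g) (sym (unique (∉⇒∈ x∉) g∈ r)) ε
      ... | no g∉ = go g (rec g<x) g∉ ◅◅ cong (τ ⟨$⟩ʳ_) (involutive g) ◅ ih _ (up g∉ g≢o) (r ◅◅ (refl ◅ ε))
        where
        g≢o : g ≢ o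
        g≢o refl = o∉I (subst (_∈ I) (reach-o r) (∉⇒∈ x∉))
        g<x : rk g < rk x
        g<x with y , y∈ , r′ , _ , g<y ← parent g g≢o with refl ← unique (∉⇒∈ x∉) y∈ (r ◅◅ r′)
          = subst (rk g <_) (rk-α x) (g<y g∉)

  -- Climb towards the root: an outgoing x is followed, after its subtree, by `τ x`, and an ingoing
  -- x by `τ (α x)`; the rank grows each time.
  connected : ∀ x → Reach (τ · α) x o
  connected = ascend _ λ x ih → case x ≟ o of λ where
    (yes refl) → ε
    (no x≢o) → case x ∈? I of λ where
      (no x∉) → paired x x∉ ◅◅ cong (τ ⟨$⟩ʳ_) (involutive x) ◅ ih _ (up x∉ x≢o)
      (yes x∈) → case α ⟨$⟩ʳ x ≟ o of λ where
        -- Here x is i: `paired` leads from o to i, and this path is reversed.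
        (yes αx≡o) → subst (Reach (τ · α) x) αx≡o
          (reach-sym (τ · α) (subst (Reach (τ · α) _) (involutive x) (paired _ (∈⇒∉ x∈))))
        (no αx≢o)  → refl ◅ ih _ (subst (_< rk (τ ⟨$⟩ʳ (α ⟨$⟩ʳ x))) (rk-α x) (up (∈⇒∉ x∈) αx≢o))

  -- By induction from the root downwards: the parent vertex of an edge x already has its ingoing half-edge
  -- in J, hence αx is not in J.
  orientation-unique : (J : Fin m → Set) → Decidable J → (∀ {x} → ¬ J x → J (α ⟨$⟩ʳ x)) → ¬ J o →
    (∀ {x y} → J x → J y → Reach τ x y → x ≡ y) → ∀ x → x ∈ I → J x
  orientation-unique J J? flips ¬Jo uniqueJ = ascend _ λ x ih x∈ →
    subst J (involutive x) (flips λ Jαx →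
      let αx≢o = λ eq → ¬Jo (subst J eq Jαx)
          (y , y∈ , r , _ , <y) = parent _ αx≢o
          Jy = ih y (subst (_< rk y) (rk-α x) (<y (∈⇒∉ x∈))) y∈
      in ∈⇒∉ x∈ (subst (_∈ I) (sym (uniqueJ Jαx Jy r)) y∈))

-- Unfolding at the level of permutations

-- `D` runs through the ingoing half-edges in contour order; `α · τ` is conjugate under α to the
-- face permutation `τ · α` of the tree. `F` is the face permutation of the mobile.
module UnfoldedPermutations (α σ : Permutation′ m) (I : Subset m) where

  -- Abstract, so that the type checker compares these permutations by name.
  abstract
    π∘ π• π τ D : Permutation′ m
    π∘ = restrict I σ
    π• = restrict (∁ I) (σ · α)
    π  = π∘ · flip π•
    τ  = σ · flip π∘
    D  = restrict I (α · τ)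

    π∘≡ : π∘ ≡ restrict I σ
    π∘≡ = refl

    π•≡ : π• ≡ restrict (∁ I) (σ · α)
    π•≡ = refl

    π-spec : ∀ x → π ⟨$⟩ʳ x ≡ π∘ ⟨$⟩ʳ (π• ⟨$⟩ˡ x)
    π-spec x = refl

    τ≡ : τ ≡ σ · flip (restrict I σ)
    τ≡ = refl

    τ-spec : ∀ x → τ ⟨$⟩ʳ x ≡ σ ⟨$⟩ʳ (π∘ ⟨$⟩ˡ x)
    τ-spec x = refl

    D≡ : D ≡ restrict I (α · τ)
    D≡ = refl

    π∘-fix : ∀ {x} → x ∉ I → π∘ ⟨$⟩ʳ x ≡ x
    π∘-fix = restrict-∉ I σ

    π∘-Ret : ∀ {x} → x ∈ I → Ret (_∈ I) σ x (π∘ ⟨$⟩ʳ x)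
    π∘-Ret = restrict-Ret I σ

    π•-fix : ∀ {x} → x ∈ I → π• ⟨$⟩ʳ x ≡ x
    π•-fix x∈ = restrict-∉ (∁ I) (σ · α) (x∈p⇒x∉∁p x∈)

    π•-Ret : ∀ {x} → x ∉ I → Ret (_∈ ∁ I) (σ · α) x (π• ⟨$⟩ʳ x)
    π•-Ret x∉ = restrict-Ret (∁ I) (σ · α) (x∉p⇒x∈∁p x∉)

    D-closed : Closed I D
    D-closed = restrict-closed I (α · τ)

    Ret⇒D : ∀ {x y} → x ∈ I → Ret (_∈ I) (α · τ) x y → D ⟨$⟩ʳ x ≡ y
    Ret⇒D = Ret⇒restrict I (α · τ)

    Reach-D : ∀ {x y} → x ∈ I → y ∈ I → Reach (α · τ) x y → Reach D x y
    Reach-D = Reach-restrict I (α · τ)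

  F : Permutation′ m
  F = π · α

module Unfolding (α σ : Permutation′ m) (I : Subset m) (orient : IsOrientation α I) where
  open IsOrientation orient
  open UnfoldedPermutations α σ I public

  π∘-∉ : ∀ {x} → x ∉ I → π∘ ⟨$⟩ˡ x ≡ x
  π∘-∉ x∉ = perm-inj π∘ (trans (inverseʳ π∘) (sym (π∘-fix x∉)))

  π•-∈ : ∀ {x} → x ∈ I → π• ⟨$⟩ˡ x ≡ x
  π•-∈ x∈ = perm-inj π• (trans (inverseʳ π•) (sym (π•-fix x∈)))

  π•-∉ : ∀ {x} → x ∉ I → π• ⟨$⟩ˡ x ∉ I
  π•-∉ {x} x∉ k∈ = x∉ (subst (_∈ I) (trans (sym (π•-fix k∈)) (inverseʳ π•)) k∈)

  τ-∉ : ∀ {x} → x ∉ I → τ ⟨$⟩ʳ x ≡ σ ⟨$⟩ʳ x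
  τ-∉ x∉ = trans (τ-spec _) (cong (σ ⟨$⟩ʳ_) (π∘-∉ x∉))

  τ-π∘ : ∀ x → τ ⟨$⟩ʳ (π∘ ⟨$⟩ʳ x) ≡ σ ⟨$⟩ʳ x
  τ-π∘ x = trans (τ-spec _) (cong (σ ⟨$⟩ʳ_) (inverseˡ π∘))

  π-∈ : ∀ {x} → x ∈ I → π ⟨$⟩ʳ x ≡ π∘ ⟨$⟩ʳ x
  π-∈ x∈ = trans (π-spec _) (cong (π∘ ⟨$⟩ʳ_) (π•-∈ x∈))

  π-∉ : ∀ {x} → x ∉ I → π ⟨$⟩ʳ x ≡ π• ⟨$⟩ˡ x
  π-∉ x∉ = trans (π-spec _) (π∘-fix (π•-∉ x∉))

  π-closed : ∀ {x} → x ∈ I → π ⟨$⟩ʳ x ∈ I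
  π-closed x∈ = subst (_∈ I) (sym (π-∈ x∈)) (Ret-target (π∘-Ret x∈))

  π-closed-∉ : ∀ {x} → x ∉ I → π ⟨$⟩ʳ x ∉ I
  π-closed-∉ x∉ = subst (_∉ I) (sym (π-∉ x∉)) (π•-∉ x∉)

  -- Put `w = π∘⁻¹ x`. From x, τ starts as σ does from w, and the two agree off I; so the first
  -- return of τ to I is `π∘ w`, that is x itself.
  unique : ∀ {x y} → x ∈ I → y ∈ I → Reach τ x y → x ≡ y
  unique {x} x∈ y∈ r = fixed-alone (restrict I τ) fixed (Reach-restrict I τ x∈ y∈ r)
    where
    w = π∘ ⟨$⟩ˡ x
    w∈ : w ∈ I
    w∈ = decidable-stable (w ∈? I) λ w∉ →
      w∉ (subst (_∈ I) (trans (sym (inverseʳ π∘)) (π∘-fix w∉)) x∈)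
    fixed : restrict I τ ⟨$⟩ʳ x ≡ x
    fixed = Ret⇒restrict I τ x∈ (Ret-head (λ z∉ → sym (τ-∉ z∉)) (sym (τ-spec x))
      (subst (Ret (_∈ I) σ w) (inverseʳ π∘) (π∘-Ret w∈)))

  F-∈ : ∀ {x} → x ∈ I → F ⟨$⟩ʳ x ∉ I
  F-∈ x∈ = π-closed-∉ (∈⇒∉ x∈)

  F-∉ : ∀ {x} → x ∉ I → F ⟨$⟩ʳ x ∈ I
  F-∉ x∉ = π-closed (∉⇒∈ x∉)

  -- Conjugation by α turns π• into the restriction of α σ to I, and α σ differs from α τ only on I.
  D-F-F : ∀ {x} → x ∈ I → D ⟨$⟩ʳ (F ⟨$⟩ʳ (F ⟨$⟩ʳ x)) ≡ x
  D-F-F {x} x∈ = trans (cong (D ⟨$⟩ʳ_) FFx)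
    (Ret⇒D (Ret-target (π∘-Ret w∈))
      (Ret-head (λ z∉ → cong (α ⟨$⟩ʳ_) (sym (τ-∉ z∉))) (cong (α ⟨$⟩ʳ_) (sym (τ-π∘ w))) ret))
    where
    k = π• ⟨$⟩ˡ (α ⟨$⟩ʳ x)
    w = α ⟨$⟩ʳ k
    k∉ : k ∉ I
    k∉ = π•-∉ (∈⇒∉ x∈)
    w∈ : w ∈ I
    w∈ = ∉⇒∈ k∉
    FFx : F ⟨$⟩ʳ (F ⟨$⟩ʳ x) ≡ π∘ ⟨$⟩ʳ w
    FFx = trans (cong (F ⟨$⟩ʳ_) (π-∉ (∈⇒∉ x∈))) (π-∈ w∈)
    ret : Ret (_∈ I) (α · σ) w x
    ret = subst (Ret (_∈ I) (α · σ) w) (trans (cong (α ⟨$⟩ʳ_) (inverseʳ π•)) (involutive x))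
      (Ret-conj (α ⟨$⟩ʳ_) (λ z∈ → ∉⇒∈ (x∈∁p⇒x∉p z∈)) (λ z∉ → ∈⇒∉ (x∉∁p⇒x∈p z∉)) (λ _ → refl)
        (π•-Ret k∉))

  -- A step of `D` is undone by two steps of `F`, so a path of `D` read backwards is a path of `F`;
  -- half-edges off I are one step of `F` away from I.
  F-connected : (∀ x y → Reach (α · τ) x y) → ∀ x y → Reach F x y
  F-connected conn x y = case x ∈? I of λ where
      (yes x∈) → fromI x∈
      (no x∉)  → refl ◅ fromI (F-∉ x∉)
    where
    back : ∀ {z x} → z ∈ I → x ∈ I → Reach D z x → Reach F x z
    back z∈ x∈ ε = ε
    back {z} z∈ x∈ (refl ◅ r) = back (D-closed z∈) x∈ r
      ◅◅ refl ◅ perm-inj D (D-F-F (D-closed z∈)) ◅ ε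
    onI : ∀ {x z} → x ∈ I → z ∈ I → Reach F x z
    onI x∈ z∈ = back z∈ x∈ (Reach-D z∈ x∈ (conn _ _))
    fromI : ∀ {x} → x ∈ I → Reach F x y
    fromI x∈ = case y ∈? I of λ where
      (yes y∈) → onI x∈ y∈
      (no y∉)  → onI x∈ (F-∉ y∉) ◅◅ reach-back F y

-- The motion of a covered map and the orientation it induces

module EdgeRank (α : Permutation′ m) (invol : ∀ x → α ⟨$⟩ʳ (α ⟨$⟩ʳ x) ≡ x) (pos : Fin m → ℕ) (pos< : ∀ x → pos x < m) where

  rk : Fin m → ℕ
  rk x = pos x ⊔ pos (α ⟨$⟩ʳ x)

  rk-α : ∀ x → rk (α ⟨$⟩ʳ x) ≡ rk x
  rk-α x = trans (cong (λ y → pos (α ⟨$⟩ʳ x) ⊔ pos y) (invol x)) (ℕ.⊔-comm _ (pos x))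

  rk≤ : ∀ x → rk x ≤ m
  rk≤ x = ℕ.⊔-lub (ℕ.<⇒≤ (pos< x)) (ℕ.<⇒≤ (pos< _))

Ingoing : (Fin m → ℕ) → Permutation′ m → Subset m → Fin m → Set
Ingoing pos α S x = (x ∈ S × pos (α ⟨$⟩ʳ x) < pos x) ⊎ (x ∉ S × pos x < pos (α ⟨$⟩ʳ x))

-- The covered map after the addition of {i, o}, at the level of permutations. I is tied to S only
-- by the two implications, so that the record can be produced both from a submap, by Δ, and from an
-- orientation, by the walk.
record IsMotion (α σ θ : Permutation′ m) (S I : Subset m) (o : Fin m) : Set where
  field
    invol  : ∀ x → α ⟨$⟩ʳ (α ⟨$⟩ʳ x) ≡ x
    fpf    : ∀ x → α ⟨$⟩ʳ x ≢ x
    stable : Closed S α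
    σ-o    : σ ⟨$⟩ʳ o ≡ o
    o∈S    : o ∈ S
    θ-∈    : ∀ {x} → x ∈ S → θ ⟨$⟩ʳ x ≡ σ ⟨$⟩ʳ (α ⟨$⟩ʳ x)
    θ-∉    : ∀ {x} → x ∉ S → θ ⟨$⟩ʳ x ≡ σ ⟨$⟩ʳ x
    reach  : ∀ x → Reach θ o x
    ⇒      : ∀ {x} → x ∈ I → Ingoing (Tour.pos θ o reach) α S x
    ⇐      : ∀ {x} → Ingoing (Tour.pos θ o reach) α S x → x ∈ I

  open Tour θ o reach public

  stable⁻ : ∀ {x} → x ∉ S → α ⟨$⟩ʳ x ∉ S
  stable⁻ x∉ αx∈ = x∉ (subst (_∈ S) (invol _) (stable αx∈))

  last≡αo : last ≡ α ⟨$⟩ʳ o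
  last≡αo = sym (last-unique (trans (θ-∈ (stable o∈S)) (trans (cong (σ ⟨$⟩ʳ_) (invol o)) σ-o)))

  abstract
    orientation : IsOrientation α I
    orientation = record { involutive = invol ; ∈⇒∉ = ∈⇒∉ ; ∉⇒∈ = ∉⇒∈ }
      where
      ∈⇒∉ : ∀ {x} → x ∈ I → α ⟨$⟩ʳ x ∉ I
      ∈⇒∉ {x} x∈ αx∈ with ⇒ x∈ | ⇒ αx∈
      ... | inj₁ (_ , lt)  | inj₁ (_ , gt)   = ℕ.<-asym lt (subst (λ y → pos y < pos (α ⟨$⟩ʳ x)) (invol x) gt)
      ... | inj₁ (x∈ , _)  | inj₂ (αx∉ , _)  = αx∉ (stable x∈)
      ... | inj₂ (x∉ , _)  | inj₁ (αx∈ , _)  = stable⁻ x∉ αx∈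
      ... | inj₂ (_ , lt)  | inj₂ (_ , gt)   = ℕ.<-asym lt (subst (λ y → pos (α ⟨$⟩ʳ x) < pos y) (invol x) gt)
      ∉⇒∈ : ∀ {x} → x ∉ I → α ⟨$⟩ʳ x ∈ I
      ∉⇒∈ {x} x∉ with <-cmp (pos x) (pos (α ⟨$⟩ʳ x)) | x ∈? S
      ... | tri≈ _ eq _ | _       = ⊥-elim (fpf x (pos-inj (sym eq)))
      ... | tri< lt _ _ | yes x∈S = ⇐ (inj₁ (stable x∈S , subst (λ y → pos y < pos (α ⟨$⟩ʳ x)) (sym (invol x)) lt))
      ... | tri< lt _ _ | no x∉S  = ⊥-elim (x∉ (⇐ (inj₂ (x∉S , lt))))
      ... | tri> _ _ gt | yes x∈S = ⊥-elim (x∉ (⇐ (inj₁ (x∈S , gt))))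
      ... | tri> _ _ gt | no x∉S  = ⇐ (inj₂ (stable⁻ x∉S , subst (λ y → pos (α ⟨$⟩ʳ x) < pos y) (sym (invol x)) gt))

  open IsOrientation orientation using (∈⇒∉; ∉⇒∈)

  αo∈I : α ⟨$⟩ʳ o ∈ I
  αo∈I = ⇐ (inj₁ (stable o∈S , subst (_< pos (α ⟨$⟩ʳ o)) (trans (sym pos-start) (cong pos (sym (invol o))))
    (ℕ.n≢0⇒n>0 (λ eq → fpf o (pos≡0 eq)))))

  o∉I : o ∉ I
  o∉I = subst (_∉ I) (invol o) (∈⇒∉ αo∈I)

  open EdgeRank α invol pos pos<

  -- A step of θ advances the clock by one, except from `α o`, where the tour returns to o at time
  -- 0.
  θ-rk : ∀ {x y z} → y ≢ α ⟨$⟩ʳ o → θ ⟨$⟩ʳ y ≡ z → rk x ≤ pos y → rk x < rk z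
  θ-rk y≢ refl ≤y = ℕ.≤-trans (s≤s ≤y) (≤-trans
    (ℕ.≤-reflexive (sym (pos-suc (λ eq → y≢ (trans (last-unique eq) last≡αo))))) (ℕ.m≤m⊔n _ _))

  -- The second visit of the edge is made at `α x` if x lies in S and at x otherwise; in both cases
  -- θ goes on to `σ x`.
  up : ∀ {x} → x ∉ I → x ≢ o → rk x < rk (σ ⟨$⟩ʳ x)
  up {x} x∉ x≢o with <-cmp (pos x) (pos (α ⟨$⟩ʳ x)) | x ∈? S
  ... | tri≈ _ eq _ | _       = ⊥-elim (fpf x (pos-inj (sym eq)))
  ... | tri< lt _ _ | yes x∈S = θ-rk (λ eq → x≢o (perm-inj α eq))
    (trans (θ-∈ (stable x∈S)) (cong (σ ⟨$⟩ʳ_) (invol x))) (ℕ.⊔-lub (ℕ.<⇒≤ lt) ≤-refl)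
  ... | tri< lt _ _ | no x∉S  = ⊥-elim (x∉ (⇐ (inj₂ (x∉S , lt))))
  ... | tri> _ _ gt | yes x∈S = ⊥-elim (x∉ (⇐ (inj₁ (x∈S , gt))))
  ... | tri> _ _ gt | no x∉S  = θ-rk (λ eq → x∉ (subst (_∈ I) (sym eq) αo∈I)) (θ-∉ x∉S)
    (ℕ.⊔-lub ≤-refl (ℕ.<⇒≤ gt))

  -- The dual of `up`: as `α x` is outgoing, `σ (α x)` follows the second visit of the edge. So the
  -- rank grows along a face until an outgoing half-edge is met.
  up-face : ∀ {x} → x ∈ I → x ≢ α ⟨$⟩ʳ o → rk x < rk (σ ⟨$⟩ʳ (α ⟨$⟩ʳ x))
  up-face {x} x∈ x≢i with ⇒ x∈
  ... | inj₁ (x∈S , lt) = θ-rk x≢i (θ-∈ x∈S) (ℕ.⊔-lub ≤-refl (ℕ.<⇒≤ lt))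
  ... | inj₂ (x∉S , gt) = θ-rk (λ eq → o∉I (subst (_∈ I) (perm-inj α eq) x∈)) (θ-∉ (stable⁻ x∉S))
    (ℕ.⊔-lub (ℕ.<⇒≤ gt) ≤-refl)

  open Unfolding α σ I orientation using (τ; τ-∉; unique)

  arborescence : Arborescence α τ I o
  arborescence = record
    { orientation = orientation ; rk = rk ; bound = m ; rk≤ = rk≤ ; rk-α = rk-α
    ; up     = λ {x} x∉ x≢o → subst (λ y → rk x < rk y) (sym (τ-∉ x∉)) (up x∉ x≢o)
    ; unique = unique
    ; τ-o    = trans (τ-∉ o∉I) σ-o
    ; o∉I    = o∉I }

  open Ascent rk m rk≤ using (sink)

  -- By `sink` every vertex other than {o} contains an ingoing half-edge, so {o} is the only cycle
  -- lost by restricting to I.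
  #white : (T : Subset m) → (∀ {x} → x ∈ T → x ≢ o) → (∀ {x} → x ≢ o → x ∈ T) →
    #cycles I (restrict I σ) ≡ #cycles T σ
  #white T T⇒ ⇒T = #cycles-restrict I T σ
    (λ x∈ → ⇒T λ eq → T⇒ x∈ (perm-inj σ (trans eq (sym σ-o))))
    (λ x∈ → ⇒T λ { refl → o∉I x∈ })
    (λ {x} x∈ → case sink I σ o up x of λ where
      (inj₁ (y , y∈ , r , _)) → y , y∈ , r
      (inj₂ r) → ⊥-elim (T⇒ x∈ (sym (fixed-alone σ σ-o (reach-sym σ r)))))

  #black : #cycles (∁ I) (restrict (∁ I) (σ · α)) ≡ #cycles ⊤ (σ · α)
  #black = #cycles-restrict (∁ I) ⊤ (σ · α) (⊤-closed (σ · α)) (λ _ → ∈⊤)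
    (λ {x} _ → case sink (∁ I) (σ · α) (α ⟨$⟩ʳ o) (λ x∉ → up-face (x∉∁p⇒x∈p x∉)) x of λ where
      (inj₁ (y , y∈ , r , _)) → y , y∈ , r
      -- If the face runs into i, its next half-edge is o, which is outgoing.
      (inj₂ r) → o , x∉p⇒x∈∁p o∉I , r ◅◅ trans (cong (σ ⟨$⟩ʳ_) (invol o)) σ-o ◅ ε)

-- Inserting and erasing the half-edges i = 0F and o = 1F

infix 8 _⁺
_⁺ : Fin m → Fin (2+ m)
h ⁺ = suc (suc h)

H⁺ : Subset (2+ m)
H⁺ = outside ∷ outside ∷ ⊤

⁺∈H⁺ : (h : Fin m) → h ⁺ ∈ H⁺
⁺∈H⁺ h = there (there ∈⊤)

0∉H⁺ : 0F ∉ H⁺ {m}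
0∉H⁺ ()

1∉H⁺ : 1F ∉ H⁺ {m}
1∉H⁺ (there ())

⁺-injective : {h k : Fin m} → h ⁺ ≡ k ⁺ → h ≡ k
⁺-injective refl = refl

-- Erasing i and o from π′ leaves π. Stated through first returns, this allows none, one or both of
-- them to be inserted.
Extends : Permutation′ m → Permutation′ (2+ m) → Set
Extends π π′ = ∀ h → Ret (_∈ H⁺) π′ (h ⁺) ((π ⟨$⟩ʳ h) ⁺)

module _ {π : Permutation′ m} {π′ : Permutation′ (2+ m)} (ext : Extends π π′) where

  Reach-⁺ : ∀ {h k} → Reach π h k → Reach π′ (h ⁺) (k ⁺)
  Reach-⁺ ε          = ε
  Reach-⁺ (refl ◅ r) = Ret⇒Reach (ext _) ◅◅ Reach-⁺ r

  Reach-⁺⁻ : ∀ {h k} → Reach π′ (h ⁺) (k ⁺) → Reach π h k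
  Reach-⁺⁻ {h} {k} r = go (Reach-restrict H⁺ π′ (⁺∈H⁺ h) (⁺∈H⁺ k) r) h refl
    where
    go : ∀ {x} → Reach (restrict H⁺ π′) x (k ⁺) → ∀ h → x ≡ h ⁺ → Reach π h k
    go ε       h refl = ε
    go (e ◅ r) h refl = refl ◅ go r (π ⟨$⟩ʳ h) (trans (sym e) (Ret⇒restrict H⁺ π′ (⁺∈H⁺ h) (ext h)))

  -- The convention 1 ⊔ _ accounts for the cycle of i when there are no other half-edges.
  #cycles-extends : (T : Subset (2+ m)) → Closed T π′ → 0F ∈ T → (∀ h → h ⁺ ∈ T) →
    (∀ {x} → x ∈ T → Reach π′ 0F x ⊎ ∃[ h ] x ≡ h ⁺) → (m ≡ 0 ⊎ ∃[ h ] Reach π′ 0F (h ⁺)) →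
    #cycles T π′ ≡ 1 ⊔ #cycles ⊤ π
  #cycles-extends T cl 0∈ ⁺∈ near (inj₁ refl) = #cycles≡1 T π′ 0∈ cl λ y∈ z∈ → reach-sym π′ (from0 y∈) ◅◅ from0 z∈
    where
    from0 : ∀ {x} → x ∈ T → Reach π′ 0F x
    from0 x∈ with inj₁ r ← near x∈ = r
  #cycles-extends T cl 0∈ ⁺∈ near (inj₂ (h₀ , r₀)) = trans (≤-antisym
    (#cycles-≤ T π′ ⊤ π (⊤-closed π) (λ x h → Reach π′ x (h ⁺))
      (λ x∈ → case near x∈ of λ where
        (inj₁ r)          → h₀ , ∈⊤ , reach-sym π′ r ◅◅ r₀
        (inj₂ (h , refl)) → h , ∈⊤ , ε)
      λ _ _ r r′ s → r ◅◅ Reach-⁺ s ◅◅ reach-sym π′ r′)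
    (#cycles-≤ ⊤ π T π′ cl (λ h x → x ≡ h ⁺) (λ {h} _ → h ⁺ , ⁺∈ h , refl) λ { _ _ refl refl r → Reach-⁺⁻ r }))
    (sym (ℕ.m≤n⇒m⊔n≡n (#cycles≥1 ⊤ π {h₀} ∈⊤ (⊤-closed π))))

  module _ (fix : π′ ⟨$⟩ʳ 1F ≡ 1F) where

    -- With o fixed, only i can stand between h and its image.
    extension-step : ∀ h → π′ ⟨$⟩ʳ (h ⁺) ≡ (π ⟨$⟩ʳ h) ⁺ ⊎ (π′ ⟨$⟩ʳ (h ⁺) ≡ 0F × π′ ⟨$⟩ʳ 0F ≡ (π ⟨$⟩ʳ h) ⁺)
    extension-step h with ext h
    ... | stop e _ = inj₁ e
    ... | skip {z = suc (suc z)} e ¬p _ = ⊥-elim (¬p (⁺∈H⁺ z))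
    ... | skip {z = 1F} e _ _ with () ← perm-inj π′ (trans e (sym fix))
    ... | skip {z = 0F} e _ (stop e′ _) = inj₂ (e , e′)
    ... | skip {z = 0F} e _ (skip {z = suc (suc z)} e′ ¬p _) = ⊥-elim (¬p (⁺∈H⁺ z))
    ... | skip {z = 0F} e _ (skip {z = 1F} e′ _ _) with () ← perm-inj π′ (trans e′ (sym fix))
    ... | skip {z = 0F} e _ (skip {z = 0F} e′ _ _) with () ← perm-inj π′ (trans e (sym e′))

    -- β′ exchanges i and o, so where π′ has i inserted the product has i followed by o. This covers
    -- the faces of the map, the contour of the tree and the motion.
    extends-∘ : {β : Permutation′ m} {β′ : Permutation′ (2+ m)} → (∀ h → β′ ⟨$⟩ʳ (h ⁺) ≡ (β ⟨$⟩ʳ h) ⁺) →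
      β′ ⟨$⟩ʳ 0F ≡ 1F → β′ ⟨$⟩ʳ 1F ≡ 0F → Extends (π · β) (π′ · β′)
    extends-∘ {β} β⁺ β0 β1 h with extension-step (β ⟨$⟩ʳ h)
    ... | inj₁ e        = stop (trans (cong (π′ ⟨$⟩ʳ_) (β⁺ h)) e) (⁺∈H⁺ _)
    ... | inj₂ (e , e′) = skip (trans (cong (π′ ⟨$⟩ʳ_) (β⁺ h)) e) 0∉H⁺
      (skip (trans (cong (π′ ⟨$⟩ʳ_) β0) fix) 1∉H⁺ (stop (trans (cong (π′ ⟨$⟩ʳ_) β1) e′) (⁺∈H⁺ _)))

contract : Permutation′ (2+ m) → Permutation′ m
contract π′ = remove 0F (remove 0F (restrict H⁺ π′))

contract-⁺ : (π′ : Permutation′ (2+ m)) (h : Fin m) → restrict H⁺ π′ ⟨$⟩ʳ (h ⁺) ≡ (contract π′ ⟨$⟩ʳ h) ⁺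
contract-⁺ π′ h = sym (trans (cong suc (lift₀-remove (remove 0F (restrict H⁺ π′)) fix₁ (suc h))) (lift₀-remove (restrict H⁺ π′) fix₀ (h ⁺)))
  where
  fix₀ = restrict-∉ H⁺ π′ 0∉H⁺
  fix₁ : remove 0F (restrict H⁺ π′) ⟨$⟩ʳ 0F ≡ 0F
  fix₁ = Finₚ.suc-injective (trans (lift₀-remove (restrict H⁺ π′) fix₀ 1F) (restrict-∉ H⁺ π′ 1∉H⁺))

contract-extends : (π′ : Permutation′ (2+ m)) → Extends (contract π′) π′
contract-extends π′ h = subst (Ret (_∈ H⁺) π′ (h ⁺)) (contract-⁺ π′ h) (restrict-Ret H⁺ π′ (⁺∈H⁺ h))

lift² : Permutation m n → Permutation (2+ m) (2+ n)
lift² ι = lift₀ (lift₀ ι)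

lift²-H⁺ : (ι : Permutation m n) {x : Fin (2+ m)} → x ∈ H⁺ → lift² ι ⟨$⟩ʳ x ∈ H⁺
lift²-H⁺ ι (there (there _)) = there (there ∈⊤)

lift²-∉H⁺ : (ι : Permutation m n) {x : Fin (2+ m)} → x ∉ H⁺ → lift² ι ⟨$⟩ʳ x ∉ H⁺
lift²-∉H⁺ ι {0F} x∉ = 0∉H⁺
lift²-∉H⁺ ι {1F} x∉ = 1∉H⁺
lift²-∉H⁺ ι {suc (suc h)} x∉ _ = x∉ (⁺∈H⁺ h)

Conj : Permutation m n → Permutation′ m → Permutation′ n → Set
Conj ι π ρ = ∀ x → ρ ⟨$⟩ʳ (ι ⟨$⟩ʳ x) ≡ ι ⟨$⟩ʳ (π ⟨$⟩ʳ x)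

contract-conj : (ι : Permutation m n) (π′ : Permutation′ (2+ m)) (ρ′ : Permutation′ (2+ n)) →
  Conj (lift² ι) π′ ρ′ → Conj ι (contract π′) (contract ρ′)
contract-conj ι π′ ρ′ conj h = ⁺-injective (trans (sym (contract-⁺ ρ′ (ι ⟨$⟩ʳ h)))
  (trans (restrict-conj H⁺ π′ H⁺ ρ′ (lift² ι ⟨$⟩ʳ_) (lift²-H⁺ ι) (lift²-∉H⁺ ι) conj (h ⁺))
    (cong (lift² ι ⟨$⟩ʳ_) (contract-⁺ π′ h))))

-- An extension that fixes o is determined by π and the image of i, so matching the images of i is
-- enough to lift a conjugation.
extension-conj : (ι : Permutation m n) {π : Permutation′ m} {π′ : Permutation′ (2+ m)}
  {ρ : Permutation′ n} {ρ′ : Permutation′ (2+ n)} → Extends π π′ → π′ ⟨$⟩ʳ 1F ≡ 1F →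
  Extends ρ ρ′ → ρ′ ⟨$⟩ʳ 1F ≡ 1F → Conj ι π ρ → ρ′ ⟨$⟩ʳ 0F ≡ lift² ι ⟨$⟩ʳ (π′ ⟨$⟩ʳ 0F) → Conj (lift² ι) π′ ρ′
extension-conj ι {π} {π′} {ρ} {ρ′} ext fix ext′ fix′ conj eq₀ 0F = eq₀
extension-conj ι {π} {π′} {ρ} {ρ′} ext fix ext′ fix′ conj eq₀ 1F = trans fix′ (cong (lift² ι ⟨$⟩ʳ_) (sym fix))
extension-conj ι {π} {π′} {ρ} {ρ′} ext fix ext′ fix′ conj eq₀ (suc (suc h))
  with extension-step {π = π} {π′} ext fix h | extension-step {π = ρ} {ρ′} ext′ fix′ (ι ⟨$⟩ʳ h)
... | inj₁ e | inj₁ e′ = trans e′ (trans (cong _⁺ (conj h)) (cong (lift² ι ⟨$⟩ʳ_) (sym e)))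
... | inj₂ (e , _) | inj₂ (e′ , _) = trans e′ (cong (lift² ι ⟨$⟩ʳ_) (sym e))
-- If i were inserted after h on one side only, h and i would have the same image.
... | inj₁ e | inj₂ (_ , e′)
  with () ← perm-inj π′ (trans e (perm-inj (lift² ι) (trans (cong _⁺ (sym (conj h))) (trans (sym e′) eq₀))))
... | inj₂ (_ , e) | inj₁ e′
  with () ← perm-inj ρ′ {(ι ⟨$⟩ʳ h) ⁺} {0F} (trans e′ (trans (cong _⁺ (conj h)) (trans (cong (lift² ι ⟨$⟩ʳ_) (sym e)) (sym eq₀))))

insert : Maybe (Fin m) → Fin (2+ m) → Permutation′ m → Permutation′ (2+ m)
insert ρ x π = Maybe.maybe (λ r → insertBefore x (suc (suc r)) (lift² π)) (lift² π) ρ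

insert-1 : (ρ : Maybe (Fin m)) (π : Permutation′ m) → insert ρ 0F π ⟨$⟩ʳ 1F ≡ 1F
insert-1 nothing  π = refl
insert-1 (just r) π = refl

unlift : Fin (2+ m) → Maybe (Fin m)
unlift 0F            = nothing
unlift 1F            = nothing
unlift (suc (suc h)) = just h

insert-0 : (ρ : Maybe (Fin m)) (π : Permutation′ m) → unlift (insert ρ 0F π ⟨$⟩ʳ 0F) ≡ ρ
insert-0 nothing  π = refl
insert-0 (just r) π = refl

insert-extends : (ρ : Maybe (Fin m)) (π : Permutation′ m) → Extends π (insert ρ 0F π)
insert-extends nothing  π h = stop refl (⁺∈H⁺ _)
insert-extends (just r) π h = case π ⟨$⟩ʳ h ≟ r of λ where
  (yes e) → skip (trans (cong (λ y → transpose 0F (r ⁺) ⟨$⟩ʳ (y ⁺)) e) (transpose-right 0F (r ⁺))) 0∉H⁺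
    (stop (cong _⁺ (sym e)) (⁺∈H⁺ _))
  (no ne) → stop (transpose-other 0F (r ⁺) (λ ()) λ e → ne (⁺-injective e)) (⁺∈H⁺ _)

-- An abstract copy of swap, so that the type checker does not compare its inverse laws.
abstract
  swap⁺ : Permutation′ m → Permutation′ (2+ m)
  swap⁺ = swap

  swap⁺≡ : (α : Permutation′ m) → swap⁺ α ≡ swap α
  swap⁺≡ α = refl

  swap⁺-0 : (α : Permutation′ m) → swap⁺ α ⟨$⟩ʳ 0F ≡ 1F
  swap⁺-0 α = refl

  swap⁺-1 : (α : Permutation′ m) → swap⁺ α ⟨$⟩ʳ 1F ≡ 0F
  swap⁺-1 α = refl

  swap⁺-⁺ : (α : Permutation′ m) (h : Fin m) → swap⁺ α ⟨$⟩ʳ (h ⁺) ≡ (α ⟨$⟩ʳ h) ⁺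
  swap⁺-⁺ α h = refl

  swap⁺-involutive : (α : Permutation′ m) → (∀ h → α ⟨$⟩ʳ (α ⟨$⟩ʳ h) ≡ h) → ∀ x → swap⁺ α ⟨$⟩ʳ (swap⁺ α ⟨$⟩ʳ x) ≡ x
  swap⁺-involutive α inv 0F            = refl
  swap⁺-involutive α inv 1F            = refl
  swap⁺-involutive α inv (suc (suc h)) = cong _⁺ (inv h)

  swap⁺-fixedPointFree : (α : Permutation′ m) → (∀ h → α ⟨$⟩ʳ h ≢ h) → ∀ x → swap⁺ α ⟨$⟩ʳ x ≢ x
  swap⁺-fixedPointFree α fpf (suc (suc h)) eq = fpf h (⁺-injective eq)

  swap⁺-closed : (α : Permutation′ m) (S : Subset m) → Closed S α → Closed (inside ∷ inside ∷ S) (swap⁺ α)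
  swap⁺-closed α S st {0F}          _                 = there here
  swap⁺-closed α S st {1F}          _                 = here
  swap⁺-closed α S st {suc (suc h)} (there (there p)) = there (there (st p))

  swap⁺-conj : (ι : Permutation m n) {α : Permutation′ m} {β : Permutation′ n} → Conj ι α β →
    Conj (lift² ι) (swap⁺ α) (swap⁺ β)
  swap⁺-conj ι conj 0F            = refl
  swap⁺-conj ι conj 1F            = refl
  swap⁺-conj ι conj (suc (suc h)) = cong _⁺ (conj h)

insert-fixes-0 : (ρ : Maybe (Fin m)) (π : Permutation′ m) → insert ρ 1F π ⟨$⟩ʳ 0F ≡ 0F
insert-fixes-0 nothing  π = refl
insert-fixes-0 (just r) π = refl

-- Before the root `φ″` passes through i and then o, while `φ′` passes through o alone; apart from
-- i, only the half-edge just before this place sees the difference.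
insert-face-step : (ρ : Maybe (Fin m)) (σ α : Permutation′ m) (x : Fin (2+ m)) → x ≢ 0F →
  let φ′ = insert ρ 1F (σ · α) ; φ″ = insert ρ 0F σ · swap α in
  φ′ ⟨$⟩ʳ x ≡ φ″ ⟨$⟩ʳ x ⊎ (φ′ ⟨$⟩ʳ x ≡ 1F × φ″ ⟨$⟩ʳ x ≡ 0F)
insert-face-step ρ        σ α 0F x≢0 = ⊥-elim (x≢0 refl)
insert-face-step nothing  σ α 1F x≢0 = inj₂ (refl , refl)
insert-face-step (just r) σ α 1F x≢0 = inj₁ refl
insert-face-step nothing  σ α (suc (suc h)) x≢0 = inj₁ refl
insert-face-step (just r) σ α (suc (suc h)) x≢0 = case σ ⟨$⟩ʳ (α ⟨$⟩ʳ h) ≟ r of λ where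
  (yes e) → inj₂ (trans (cong (λ y → transpose 1F (r ⁺) ⟨$⟩ʳ (y ⁺)) e) (transpose-right 1F (r ⁺))
                , trans (cong (λ y → transpose 0F (r ⁺) ⟨$⟩ʳ (y ⁺)) e) (transpose-right 0F (r ⁺)))
  (no ne) → inj₁ (trans (transpose-other 1F (r ⁺) (λ ()) λ e → ne (⁺-injective e))
                (sym (transpose-other 0F (r ⁺) (λ ()) λ e → ne (⁺-injective e))))

-- ρ makes a detour through i on its way to o where π goes to o directly, and the detour disappears
-- since i is outside S.
restrict-delayed : (S : Subset m) (π ρ : Permutation′ m) (i o : Fin m) → i ∉ S → o ∈ S → π ⟨$⟩ʳ i ≡ i → ρ ⟨$⟩ʳ i ≡ o →
  (∀ x → x ≢ i → π ⟨$⟩ʳ x ≡ ρ ⟨$⟩ʳ x ⊎ (π ⟨$⟩ʳ x ≡ o × ρ ⟨$⟩ʳ x ≡ i)) →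
  ∀ x → restrict S π ⟨$⟩ʳ x ≡ restrict S ρ ⟨$⟩ʳ x
restrict-delayed {m} S π ρ i o i∉ o∈ πi ρi compare x = case x ∈? S of λ where
    (yes x∈) → sym (Ret⇒restrict S ρ x∈ (go (λ { refl → i∉ x∈ }) (restrict-Ret S π x∈)))
    (no x∉)  → trans (restrict-∉ S π x∉) (sym (restrict-∉ S ρ x∉))
  where
  go : ∀ {x y} → x ≢ i → Ret (_∈ S) π x y → Ret (_∈ S) ρ x y
  go {x} x≢i (stop refl p) with compare x x≢i
  ... | inj₁ e        = stop (sym e) p
  ... | inj₂ (e , e′) = skip e′ i∉ (stop (trans ρi (sym e)) p)
  go {x} x≢i (skip {z = z} refl ¬p r) with compare x x≢i
  ... | inj₁ e       = skip (sym e) ¬p (go (λ e₀ → x≢i (perm-inj π (trans e₀ (sym πi)))) r)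
  ... | inj₂ (e , _) = ⊥-elim (¬p (subst (_∈ S) (sym e) o∈))

-- The two ways of extending φ, by o alone or by the sequence i, o, agree on the outgoing half-edges.
insert-face : (ρ : Maybe (Fin m)) (σ α : Permutation′ m) (O : Subset m) (x : Fin (2+ m)) →
  restrict (outside ∷ inside ∷ O) (insert ρ 1F (σ · α)) ⟨$⟩ʳ x
  ≡ restrict (outside ∷ inside ∷ O) (insert ρ 0F σ · swap⁺ α) ⟨$⟩ʳ x
insert-face ρ σ α O x = subst
  (λ α′ → restrict O′ (insert ρ 1F (σ · α)) ⟨$⟩ʳ x ≡ restrict O′ (insert ρ 0F σ · α′) ⟨$⟩ʳ x) (sym (swap⁺≡ α))
  (restrict-delayed O′ (insert ρ 1F (σ · α)) (insert ρ 0F σ · swap α)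
    0F 1F (λ ()) (there here) (insert-fixes-0 ρ (σ · α)) (insert-1 ρ σ) (insert-face-step ρ σ α) x)
  where O′ = outside ∷ inside ∷ O

-- Covered maps are the maps whose motion is cyclic

#cycles≤1 : (S : Subset m) (π : Permutation′ m) → (∀ {x y} → x ∈ S → y ∈ S → Reach π x y) → #cycles S π ≤ 1
#cycles≤1 S π conn = #cycles≤length {B = Fin 1} S π (0F ∷ []) (λ _ _ → Fin 1) (λ _ → 0F , here refl , 0F)
  λ x∈ y∈ _ _ → conn x∈ y∈

1⊔≡1⇒≤1 : ∀ {k} → 1 ⊔ k ≡ 1 → k ≤ 1
1⊔≡1⇒≤1 {k} eq = subst (k ≤_) eq (ℕ.m≤n⊔m 1 k)

≤1⇒1⊔≡1 : ∀ {k} → k ≤ 1 → 1 ⊔ k ≡ 1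
≤1⇒1⊔≡1 = ℕ.m≥n⇒m⊔n≡m

Reach-cong : (π ρ : Permutation′ m) → (∀ x → π ⟨$⟩ʳ x ≡ ρ ⟨$⟩ʳ x) → ∀ {x y} → Reach π x y → Reach ρ x y
Reach-cong π ρ eq = Reach-conj id (λ x → sym (eq x))

Connected : Permutation′ m → Set
Connected π = ∀ x y → Reach π x y

Connected-swap : (π α : Permutation′ m) → (∀ x → α ⟨$⟩ʳ (α ⟨$⟩ʳ x) ≡ x) → Connected (π · α) → Connected (α · π)
Connected-swap π α inv conn x y = subst₂ (Reach (α · π)) (inv x) (inv y)
  (Reach-conj {π = π · α} {α · π} (α ⟨$⟩ʳ_) (λ _ → refl) (conn (α ⟨$⟩ʳ x) (α ⟨$⟩ʳ y)))

-- `u` is α on S and the identity elsewhere, which makes `θ` the motion, as a permutation; `ρ` is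
-- the face permutation of the submap.
module _ {m} (σ α : Permutation′ m) (S : Subset m) (stable : Closed S α) where
  private
    u θ ρ : Permutation′ m
    u = restrict S α
    θ = σ · u
    ρ = restrict S σ · u

  θ-outside : ∀ {x} → x ∉ S → θ ⟨$⟩ʳ x ≡ σ ⟨$⟩ʳ x
  θ-outside x∉ = cong (σ ⟨$⟩ʳ_) (restrict-∉ S α x∉)

  submap-closed : Closed S ρ
  submap-closed x∈ = restrict-closed S σ (restrict-closed S α x∈)

  -- Off S the motion is σ: leaving x by θ and waiting for S performs α once and then a first return
  -- of σ. The motion restricted to S is thus the face permutation of the submap.
  submap-Ret : ∀ {x} → x ∈ S → Ret (_∈ S) θ x (ρ ⟨$⟩ʳ x)
  submap-Ret x∈ = Ret-head (λ w∉ → sym (θ-outside w∉)) refl (restrict-Ret S σ (restrict-closed S α x∈))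

  restrict-θ : ∀ {x} → x ∈ S → restrict S θ ⟨$⟩ʳ x ≡ ρ ⟨$⟩ʳ x
  restrict-θ x∈ = Ret⇒restrict S θ x∈ (submap-Ret x∈)

  first-hit : ∀ {x y} → (∀ {z} → z ∉ S → θ ⟨$⟩ʳ z ≡ σ ⟨$⟩ʳ z) → Reach σ x y → y ∈ S → ∃[ s ] s ∈ S × Reach θ x s
  first-hit {x} agree r y∈ with x ∈? S
  ... | yes x∈ = x , x∈ , ε
  first-hit agree ε y∈          | no x∉ = ⊥-elim (x∉ y∈)
  first-hit agree (refl ◅ r) y∈ | no x∉ with s , s∈ , r′ ← first-hit agree r y∈ = s , s∈ , agree x∉ ◅ r′

  first-hit⁻ : ∀ {x y} → Reach θ x y → y ∈ S → ∃[ s ] s ∈ S × Reach σ x s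
  first-hit⁻ {x} r y∈ with x ∈? S
  ... | yes x∈ = x , x∈ , ε
  first-hit⁻ ε y∈          | no x∉ = ⊥-elim (x∉ y∈)
  first-hit⁻ (refl ◅ r) y∈ | no x∉ with s , s∈ , r′ ← first-hit⁻ r y∈ = s , s∈ , sym (θ-outside x∉) ◅ r′

  Reach-submap⁻ : ∀ {x y} → x ∈ S → Reach ρ x y → Reach θ x y
  Reach-submap⁻ x∈ ε          = ε
  Reach-submap⁻ x∈ (refl ◅ r) = Ret⇒Reach (submap-Ret x∈) ◅◅ Reach-submap⁻ (submap-closed x∈) r

  Reach-submap : ∀ {x y} → x ∈ S → y ∈ S → Reach θ x y → Reach ρ x y
  Reach-submap {y = y} x∈ y∈ r = go x∈ (Reach-restrict S θ x∈ y∈ r)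
    where
    go : ∀ {x} → x ∈ S → Reach (restrict S θ) x y → Reach ρ x y
    go x∈ ε          = ε
    go x∈ (refl ◅ r) = sym (restrict-θ x∈) ◅ go (restrict-closed S θ x∈) r

Reach⇒EqClosure : (σ α : Permutation′ m) → ∀ {x y} → Reach (σ · α) x y →
  EqClosure (λ h h′ → σ ⟨$⟩ʳ h ≡ h′ ⊎ α ⟨$⟩ʳ h ≡ h′) x y
Reach⇒EqClosure σ α ε       = ε
Reach⇒EqClosure σ α (e ◅ r) = fwd (inj₂ refl) ◅ fwd (inj₁ e) ◅ Reach⇒EqClosure σ α r

-- σ and θ run together until S is met, and within S the single face of the submap connects
-- everything. If S is empty, θ is σ and the single vertex does the same.
covered⇒connected : (M : PreMap) (S : Subset (PreMap.size M)) → IsCovered M S →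
  Connected (PreMap.σ M · restrict S (PreMap.α M))
covered⇒connected M S cov x y = case connecting of λ where
    (inj₁ hits) → let (s , s∈ , r) = reaches hits x ; (t , t∈ , r′) = reaches hits y in
      r ◅◅ Reach-submap⁻ σ α S (stable _) s∈
        (#cycles≤1⇒Reach S (restrict S σ · restrict S α) (submap-closed σ α S (stable _)) (1⊔≡1⇒≤1 oneFace) s∈ t∈) ◅◅ reach-sym θ r′
    (inj₂ (empty , v≡1)) → Reach-cong σ θ (λ z → sym (θ-outside σ α S (stable _) λ z∈ → empty (z , z∈)))
      (#cycles≤1⇒Reach ⊤ σ (⊤-closed σ) (1⊔≡1⇒≤1 v≡1) ∈⊤ ∈⊤)
  where
  open PreMap M
  open IsCovered cov
  θ = σ · restrict S α
  reaches : (∀ h → ∃[ s ] s ∈ S × SameCycle σ h s) → ∀ h → ∃[ s ] s ∈ S × Reach θ h s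
  reaches hits h with s , s∈ , r ← hits h
    = first-hit σ α S (stable _) (θ-outside σ α S (stable _)) (SameCycle⇒Reach σ r) s∈

connected⇒covered : (M : PreMap) (S : Subset (PreMap.size M)) → Closed S (PreMap.α M) →
  Connected (PreMap.σ M · restrict S (PreMap.α M)) → IsCovered M S
connected⇒covered M S stable conn = record
  { stable     = λ _ → stable
  ; transitive = λ x∈ y∈ → Reach⇒EqClosure (restrict S σ) (restrict S α) (Reach-submap σ α S stable x∈ y∈ (conn _ _))
  ; connecting = case nonempty? S of λ where
      (yes (s , s∈)) → inj₁ λ h → let (t , t∈ , r) = first-hit⁻ σ α S stable (conn h s) s∈ in
        t , t∈ , Reach⇒SameCycle σ r
      (no empty) → inj₂ (empty , ≤1⇒1⊔≡1 (#cycles≤1 ⊤ σ λ _ _ →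
        Reach-cong (σ · restrict S α) σ (λ z → θ-outside σ α S stable λ z∈ → empty (z , z∈)) (conn _ _)))
  ; oneFace    = ≤1⇒1⊔≡1 (#cycles≤1 S (restrict S σ · restrict S α) λ x∈ y∈ → Reach-submap σ α S stable x∈ y∈ (conn _ _))
  }
  where
  open PreMap M

-- The extended half-edge set

module _ {ξ : Permutation′ m} {ξ′ : Permutation′ (2+ m)} (ext : Extends ξ ξ′) (ξ0 : ξ′ ⟨$⟩ʳ 0F ≡ 1F) where

  connected-⁺ : m ≡ 0 ⊎ ∃[ r ] ξ′ ⟨$⟩ʳ 1F ≡ r ⁺ → Connected ξ → ∀ x → Reach ξ′ 1F x
  connected-⁺ root conn 0F = reach-sym ξ′ (ξ0 ◅ ε)
  connected-⁺ root conn 1F = ε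
  connected-⁺ (inj₂ (r , eq)) conn (suc (suc h)) = eq ◅ Reach-⁺ {π = ξ} {ξ′} ext (conn r h)
  connected-⁺ (inj₁ refl) conn (suc (suc ()))

  connected-⁺⁻ : (∀ x → Reach ξ′ 1F x) → Connected ξ
  connected-⁺⁻ conn h k = Reach-⁺⁻ {π = ξ} {ξ′} ext (reach-sym ξ′ (conn (h ⁺)) ◅◅ conn (k ⁺))

-- If o led back to i, the orbit {i, o} would be closed and leave no room for other half-edges.
root-of-connected : (ξ′ : Permutation′ (2+ m)) → ξ′ ⟨$⟩ʳ 0F ≡ 1F → (∀ x → Reach ξ′ 1F x) →
  m ≡ 0 ⊎ ∃[ r ] ξ′ ⟨$⟩ʳ 1F ≡ r ⁺
root-of-connected {zero}  ξ′ ξ0 conn = inj₁ refl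
root-of-connected {suc m} ξ′ ξ0 conn with ξ′ ⟨$⟩ʳ 1F in eq
... | suc (suc r) = inj₂ (r , refl)
... | 1F with () ← perm-inj ξ′ (trans ξ0 (sym eq))
... | 0F = case reach-closed ξ′ (λ x → x ≡ 0F ⊎ x ≡ 1F) closed (conn (0F ⁺)) (inj₂ refl) of λ where
    (inj₁ ())
    (inj₂ ())
  where
  closed : ∀ {x} → x ≡ 0F ⊎ x ≡ 1F → ξ′ ⟨$⟩ʳ x ≡ 0F ⊎ ξ′ ⟨$⟩ʳ x ≡ 1F
  closed (inj₁ refl) = inj₂ ξ0
  closed (inj₂ refl) = inj₁ eq

Any⇒just : {A : Set} {P : A → Set} {x : Maybe A} → Any P x → ∃[ a ] x ≡ just a × P a
Any⇒just (just p) = _ , refl , p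

just⇒Any : {A : Set} {P : A → Set} {x : Maybe A} {a : A} → x ≡ just a → P a → Any P x
just⇒Any refl p = just p

rooted? : (ρ : Maybe (Fin m)) → (ρ ≡ nothing → m ≡ 0) → m ≡ 0 ⊎ ∃[ r ] ρ ≡ just r
rooted? nothing  z = inj₁ (z refl)
rooted? (just r) z = inj₂ (r , refl)

insert-just : {ρ : Maybe (Fin m)} {r : Fin m} (π : Permutation′ m) → ρ ≡ just r → insert ρ 0F π ⟨$⟩ʳ 0F ≡ r ⁺
insert-just π refl = refl

restrict-swap⁺ : (α : Permutation′ m) (S : Subset m) → Closed S α → ∀ h →
  restrict (inside ∷ inside ∷ S) (swap⁺ α) ⟨$⟩ʳ (h ⁺) ≡ (restrict S α ⟨$⟩ʳ h) ⁺
restrict-swap⁺ α S st h = case h ∈? S of λ where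
    (yes h∈) → trans (restrict-stable S′ (swap⁺ α) (there (there h∈)) (swap⁺-closed α S st (there (there h∈))))
      (trans (swap⁺-⁺ α h) (cong _⁺ (sym (restrict-stable S α h∈ (st h∈)))))
    (no h∉)  → trans (restrict-∉ S′ (swap⁺ α) (λ { (there (there h∈)) → h∉ h∈ }))
      (cong _⁺ (sym (restrict-∉ S α h∉)))
  where S′ = inside ∷ inside ∷ S

-- Vertices, edges and colourings

#cycles-mono : (S T : Subset m) (π ρ : Permutation′ m) → Closed T ρ → (∀ {x} → x ∈ S → x ∈ T) →
  (∀ {x y} → x ∈ S → y ∈ S → Reach ρ x y → Reach π x y) → #cycles S π ≤ #cycles T ρ
#cycles-mono S T π ρ cl S⊆T refl-reach = #cycles-≤ S π T ρ cl _≡_ (λ x∈ → _ , S⊆T x∈ , refl)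
  λ { x∈ y∈ refl refl r → refl-reach x∈ y∈ r }

Reach-cong-on : (S : Subset m) (π ρ : Permutation′ m) → Closed S π → (∀ {x} → x ∈ S → π ⟨$⟩ʳ x ≡ ρ ⟨$⟩ʳ x) →
  ∀ {x y} → x ∈ S → Reach π x y → Reach ρ x y
Reach-cong-on S π ρ cl eq x∈ ε          = ε
Reach-cong-on S π ρ cl eq x∈ (refl ◅ r) = sym (eq x∈) ◅ Reach-cong-on S π ρ cl eq (cl x∈) r

#cycles-cong : (S : Subset m) (π ρ : Permutation′ m) → Closed S π → (∀ {x} → x ∈ S → π ⟨$⟩ʳ x ≡ ρ ⟨$⟩ʳ x) →
  #cycles S π ≡ #cycles S ρ
#cycles-cong S π ρ cl eq = ≤-antisym
  (#cycles-mono S S π ρ cl′ id λ x∈ _ → Reach-cong-on S ρ π cl′ (λ x∈ → sym (eq x∈)) x∈)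
  (#cycles-mono S S ρ π cl id λ x∈ _ → Reach-cong-on S π ρ cl eq x∈)
  where
  cl′ : Closed S ρ
  cl′ x∈ = subst (_∈ S) (eq x∈) (cl x∈)

#cycles-flip : (S : Subset m) (π ρ : Permutation′ m) → Closed S π → Closed S ρ →
  (∀ {x} → x ∈ S → π ⟨$⟩ʳ x ≡ ρ ⟨$⟩ˡ x) → #cycles S π ≡ #cycles S ρ
#cycles-flip S π ρ clπ clρ eq = ≤-antisym
  (#cycles-mono S S π ρ clρ id λ x∈ y∈ r → reach-sym π (go π ρ (λ x∈ → perm-inj ρ (undo x∈)) clρ x∈ r))
  (#cycles-mono S S ρ π clπ id λ x∈ y∈ r → reach-sym ρ (go ρ π (λ x∈ → trans (cong (ρ ⟨$⟩ʳ_) (eq x∈)) (inverseʳ ρ)) clπ x∈ r))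
  where
  undo : ∀ {x} → x ∈ S → ρ ⟨$⟩ʳ (π ⟨$⟩ʳ (ρ ⟨$⟩ʳ x)) ≡ ρ ⟨$⟩ʳ x
  undo x∈ = trans (cong (ρ ⟨$⟩ʳ_) (eq (clρ x∈))) (inverseʳ ρ)
  go : ∀ (π ρ : Permutation′ _) → (∀ {x} → x ∈ S → π ⟨$⟩ʳ (ρ ⟨$⟩ʳ x) ≡ x) → Closed S ρ →
    ∀ {x y} → x ∈ S → Reach ρ x y → Reach π y x
  go π ρ inv cl x∈ ε          = ε
  go π ρ inv cl x∈ (refl ◅ r) = go π ρ inv cl (cl x∈) r ◅◅ inv x∈ ◅ ε

id-reach : {x y : Fin m} → Reach (Perm.id {m}) x y → x ≡ y
id-reach = fixed-alone Perm.id refl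

-- Cardinality written as a number of cycles, so that the comparison lemmas also relate half-edges
-- to vertices and edges.
∣_∣ : Subset m → ℕ
∣ S ∣ = #cycles S Perm.id

module _ {α : Permutation′ m} {I : Subset m} (orient : IsOrientation α I) where
  open IsOrientation orient

  ∁-orientation : IsOrientation α (∁ I)
  ∁-orientation = record
    { involutive = involutive
    ; ∈⇒∉ = λ x∈ → x∈p⇒x∉∁p (∉⇒∈ (x∈∁p⇒x∉p x∈))
    ; ∉⇒∈ = λ x∉ → x∉p⇒x∈∁p (∈⇒∉ (x∉∁p⇒x∈p x∉)) }

  edge-orbit : ∀ {x y} → Reach α x y → y ≡ x ⊎ y ≡ α ⟨$⟩ʳ x
  edge-orbit ε = inj₁ refl
  edge-orbit (refl ◅ r) with edge-orbit r
  ... | inj₁ eq = inj₂ eq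
  ... | inj₂ eq = inj₁ (trans eq (involutive _))

  #ingoing : ∣ I ∣ ≡ #cycles ⊤ α
  #ingoing = ≤-antisym
    (#cycles-mono I ⊤ Perm.id α (⊤-closed α) (λ _ → ∈⊤) λ x∈ y∈ r → case edge-orbit r of λ where
      (inj₁ refl) → ε
      (inj₂ refl) → ⊥-elim (∈⇒∉ x∈ y∈))
    (#cycles-≤ ⊤ α I Perm.id id (λ x y → Reach α x y)
      (λ {x} _ → case x ∈? I of λ where
        (yes x∈) → x , x∈ , ε
        (no x∉)  → α ⟨$⟩ʳ x , ∉⇒∈ x∉ , refl ◅ ε)
      λ _ _ r r′ s → r ◅◅ subst (Reach α _) (id-reach s) ε ◅◅ reach-sym α r′)

-- Each edge has one ingoing and one outgoing half. A tree and a mobile with equal numbers of edges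
-- can then be matched half-edge by half-edge.
#size : {α : Permutation′ m} {I : Subset m} → IsOrientation α I → m ≡ #cycles ⊤ α + #cycles ⊤ α
#size {m} {α} {I} orient = trans (sym (#cycles-id m)) (trans (sym (#cycles-∁ I Perm.id))
  (cong₂ _+_ (#ingoing orient) (#ingoing (∁-orientation orient))))

#edges-swap : (α : Permutation′ m) → #cycles ⊤ (swap α) ≡ suc (#cycles ⊤ α)
#edges-swap {m} α = trans (sym (#cycles-∁ H⁺ (swap α))) (trans (cong₂ _+_ old new) (ℕ.+-comm _ 1))
  where
  cl : Closed H⁺ (swap α)
  cl (there (there _)) = there (there ∈⊤)
  ext : Extends α (swap α)
  ext h = stop refl (⁺∈H⁺ _)
  old : #cycles H⁺ (swap α) ≡ #cycles ⊤ α
  old = ≤-antisym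
    (#cycles-≤ H⁺ (swap α) ⊤ α (⊤-closed α) (λ x h → x ≡ h ⁺) (λ { (there (there _)) → _ , ∈⊤ , refl })
      λ { _ _ refl refl r → Reach-⁺ {π = α} {swap α} ext r })
    (#cycles-≤ ⊤ α H⁺ (swap α) cl (λ h x → x ≡ h ⁺) (λ _ → _ , ⁺∈H⁺ _ , refl)
      λ { _ _ refl refl r → Reach-⁺⁻ {π = α} {swap α} ext r })
  from0 : ∀ {x} → x ∈ ∁ H⁺ → Reach (swap α) 0F x
  from0 {0F} _ = ε
  from0 {1F} _ = refl ◅ ε
  from0 {suc (suc h)} x∈ = ⊥-elim (x∈∁p⇒x∉p x∈ (⁺∈H⁺ h))
  cl∁ : Closed (∁ H⁺) (swap α)
  cl∁ {0F} _ = there here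
  cl∁ {1F} _ = here
  cl∁ {suc (suc h)} x∈ = ⊥-elim (x∈∁p⇒x∉p x∈ (⁺∈H⁺ h))
  new : #cycles (∁ H⁺) (swap α) ≡ 1
  new = #cycles≡1 (∁ H⁺) (swap α) {0F} here cl∁ λ y∈ z∈ → reach-sym (swap α) (from0 y∈) ◅◅ from0 z∈

connected⇒transitive : (σ α : Permutation′ m) → Connected (σ · α) → TransitiveOn ⊤ σ α
connected⇒transitive σ α conn _ _ = Reach⇒EqClosure σ α (conn _ _)

oneFace : (M : PreMap) → Connected (PreMap.φ M) → #faces M ≡ 1
oneFace M conn = ≤1⇒1⊔≡1 (#cycles≤1 ⊤ (PreMap.φ M) λ _ _ → conn _ _)

oneFace⁻ : (M : PreMap) → #faces M ≡ 1 → Connected (PreMap.φ M)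
oneFace⁻ M eq _ _ = #cycles≤1⇒Reach ⊤ (PreMap.φ M) (⊤-closed (PreMap.φ M)) (1⊔≡1⇒≤1 eq) ∈⊤ ∈⊤

tree-genus : ∀ (M : PreMap) {e} → #vertices M ≡ suc e → #edges M ≡ e → #faces M ≡ 1 → HasGenus 0 M
tree-genus M {e} v e′ f rewrite v | e′ | f = arith (ℤ.+ e)
  where
  arith : ∀ e → ℤ.+ 1 ℤ.+ e ℤ.- e ℤ.+ ℤ.+ 1 ≡ ℤ.+ 2
  arith = ℤ-Solver.solve-∀

tree-genus⁻ : ∀ (M : PreMap) {e} → HasGenus 0 M → #edges M ≡ e → #faces M ≡ 1 → #vertices M ≡ suc e
tree-genus⁻ M {e} g e′ f rewrite e′ | f = ℤ.+-injective (begin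
  ℤ.+ #vertices M                                             ≡⟨ before (ℤ.+ #vertices M) (ℤ.+ e) ⟩
  (ℤ.+ #vertices M ℤ.- ℤ.+ e ℤ.+ ℤ.+ 1) ℤ.+ (ℤ.+ e ℤ.- ℤ.+ 1) ≡⟨ cong (ℤ._+ (ℤ.+ e ℤ.- ℤ.+ 1)) g ⟩
  ℤ.+ 2 ℤ.+ (ℤ.+ e ℤ.- ℤ.+ 1)                                 ≡⟨ after (ℤ.+ e) ⟩
  ℤ.+ suc e                                                   ∎)
  where
  open ≡-Reasoning
  before : ∀ v e → v ≡ (v ℤ.- e ℤ.+ ℤ.+ 1) ℤ.+ (e ℤ.- ℤ.+ 1)
  before = ℤ-Solver.solve-∀
  after : ∀ e → ℤ.+ 2 ℤ.+ (e ℤ.- ℤ.+ 1) ≡ ℤ.+ 1 ℤ.+ e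
  after = ℤ-Solver.solve-∀

-- The faces of M are counted among the vertices of M′, and the additional edge compensates for its
-- single face.
genus-transfer : (M M′ : PreMap) → #vertices M′ ≡ #vertices M + #faces M → #edges M′ ≡ suc (#edges M) →
  #faces M′ ≡ 1 →
  ℤ.+ #vertices M ℤ.- ℤ.+ #edges M ℤ.+ ℤ.+ #faces M ≡ ℤ.+ #vertices M′ ℤ.- ℤ.+ #edges M′ ℤ.+ ℤ.+ #faces M′
genus-transfer M M′ v e f rewrite v | e | f = arith (ℤ.+ #vertices M) (ℤ.+ #edges M) (ℤ.+ #faces M)
  where
  arith : ∀ v e f → v ℤ.- e ℤ.+ f ≡ (v ℤ.+ f) ℤ.- (ℤ.+ 1 ℤ.+ e) ℤ.+ ℤ.+ 1
  arith = ℤ-Solver.solve-∀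

colouring-face : (M : PreMap) {W : Subset (PreMap.size M)} → IsProperColouring M W → ∀ {x} →
  (x ∈ W → PreMap.φ M ⟨$⟩ʳ x ∉ W) × (x ∉ W → PreMap.φ M ⟨$⟩ʳ x ∈ W)
colouring-face M col {x} =
    (λ x∈ φx∈ → Equivalence.to (proper x) (Equivalence.to (vertexwise _) φx∈) x∈)
  , (λ x∉ → Equivalence.from (vertexwise _) (Equivalence.from (proper x) x∉))
  where open IsProperColouring col

-- Proper colourings alternate along faces, so agreement at r spreads over the single face, which
-- contains all half-edges.
colouring-unique : (M : PreMap) → Connected (PreMap.φ M) → {V W : Subset (PreMap.size M)} →
  IsProperColouring M V → IsProperColouring M W → ∀ {r} → r ∈ V → r ∈ W → ∀ {x} → x ∈ V → x ∈ W
colouring-unique M conn {V} {W} colV colW {r} r∈V r∈W {x} x∈V =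
  case reach-closed (PreMap.φ M) P step (conn r x) (inj₁ (r∈V , r∈W)) of λ where
    (inj₁ (_ , x∈W)) → x∈W
    (inj₂ (x∉V , _)) → ⊥-elim (x∉V x∈V)
  where
  P : Fin (PreMap.size M) → Set
  P x = (x ∈ V × x ∈ W) ⊎ (x ∉ V × x ∉ W)
  step : ∀ {x} → P x → P (PreMap.φ M ⟨$⟩ʳ x)
  step (inj₁ (v , w)) = inj₂ (proj₁ (colouring-face M colV) v , proj₁ (colouring-face M colW) w)
  step (inj₂ (v , w)) = inj₁ (proj₂ (colouring-face M colV) v , proj₂ (colouring-face M colW) w)

white-closed : (M : PreMap) {W : Subset (PreMap.size M)} → IsProperColouring M W → Closed W (PreMap.σ M)
white-closed M col x∈ = Equivalence.from (IsProperColouring.vertexwise col _) x∈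

black-closed : (M : PreMap) {W : Subset (PreMap.size M)} → IsProperColouring M W → Closed (∁ W) (PreMap.σ M)
black-closed M col x∈ = x∉p⇒x∈∁p λ σx∈ → x∈∁p⇒x∉p x∈ (Equivalence.to (IsProperColouring.vertexwise col _) σx∈)

colouring-counts : (M : PreMap) → Connected (PreMap.φ M) → {V W : Subset (PreMap.size M)} →
  IsProperColouring M V → IsProperColouring M W → ∀ {r} → r ∈ V → r ∈ W →
  #whiteVertices M V ≡ #whiteVertices M W × #blackVertices M V ≡ #blackVertices M W
colouring-counts M conn {V} {W} colV colW r∈V r∈W =
    ≤-antisym (#cycles-mono V W σ σ (white-closed M colW) to λ _ _ r → r)
              (#cycles-mono W V σ σ (white-closed M colV) from λ _ _ r → r)
  , ≤-antisym (#cycles-mono (∁ V) (∁ W) σ σ (black-closed M colW) (λ x∈ → x∉p⇒x∈∁p (x∈∁p⇒x∉p x∈ ∘ from)) λ _ _ r → r)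
              (#cycles-mono (∁ W) (∁ V) σ σ (black-closed M colV) (λ x∈ → x∉p⇒x∈∁p (x∈∁p⇒x∉p x∈ ∘ to)) λ _ _ r → r)
  where
  open PreMap M using (σ)
  to : ∀ {x} → x ∈ V → x ∈ W
  to = colouring-unique M conn colV colW r∈V r∈W
  from : ∀ {x} → x ∈ W → x ∈ V
  from = colouring-unique M conn colW colV r∈W r∈V

#vertices-coloured : (M : PreMap) (W : Subset (PreMap.size M)) → Fin (PreMap.size M) →
  #vertices M ≡ #whiteVertices M W + #blackVertices M W
#vertices-coloured M W x = trans (ℕ.m≤n⇒m⊔n≡n (#cycles≥1 ⊤ (PreMap.σ M) {x} ∈⊤ (⊤-closed (PreMap.σ M))))
  (sym (#cycles-∁ W (PreMap.σ M)))

module _ (α σ : Permutation′ m) (I : Subset m) (orient : IsOrientation α I) (ρ : Permutation′ m) where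
  open Unfolding α σ I orient

  unfolded-white : (∀ x → ρ ⟨$⟩ʳ x ≡ π ⟨$⟩ʳ x) → Closed I ρ → #cycles I ρ ≡ #cycles I (restrict I σ)
  unfolded-white ρ≡π closed = #cycles-cong I ρ (restrict I σ) closed
    λ {x} x∈ → trans (ρ≡π x) (trans (π-∈ x∈) (cong (_⟨$⟩ʳ x) π∘≡))

  unfolded-black : (∀ x → ρ ⟨$⟩ʳ x ≡ π ⟨$⟩ʳ x) → Closed (∁ I) ρ →
    #cycles (∁ I) ρ ≡ #cycles (∁ I) (restrict (∁ I) (σ · α))
  unfolded-black ρ≡π closed = #cycles-flip (∁ I) ρ (restrict (∁ I) (σ · α)) closed (restrict-closed (∁ I) (σ · α))
    λ {x} x∈ → trans (ρ≡π x) (trans (π-∉ (x∈∁p⇒x∉p x∈)) (cong (_⟨$⟩ˡ x) π•≡))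

-- The two maps produced by unfolding

-- All half-edges but o: the vertices of the extended map without the leaf {o}, which stand for the
-- vertices of the original map.
V : Subset (2+ m)
V = inside ∷ outside ∷ ⊤

≢1⇒∈V : {x : Fin (2+ m)} → x ≢ 1F → x ∈ V
≢1⇒∈V {x = 0F} _            = here
≢1⇒∈V {x = 1F} x≢1          = ⊥-elim (x≢1 refl)
≢1⇒∈V {x = suc (suc h)} x≢1 = there (there ∈⊤)

∈V⇒≢1 : {x : Fin (2+ m)} → x ∈ V → x ≢ 1F
∈V⇒≢1 (there ()) refl

#cycles-V : {π : Permutation′ m} {π′ : Permutation′ (2+ m)} → Extends π π′ → π′ ⟨$⟩ʳ 1F ≡ 1F →
  m ≡ 0 ⊎ ∃[ r ] π′ ⟨$⟩ʳ 0F ≡ r ⁺ → #cycles V π′ ≡ 1 ⊔ #cycles ⊤ π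
#cycles-V {π = π} {π′} ext fix nonempty = #cycles-extends {π = π} {π′} ext V
  (λ x∈ → ≢1⇒∈V λ eq → ∈V⇒≢1 x∈ (perm-inj π′ (trans eq (sym fix)))) here (λ _ → there (there ∈⊤))
  (λ { {0F} _ → inj₁ ε ; {1F} (there ()) ; {suc (suc h)} _ → inj₂ (h , refl) })
  (case nonempty of λ where
    (inj₁ m≡0)      → inj₁ m≡0
    (inj₂ (r , eq)) → inj₂ (r , eq ◅ ε))

module Tree {m} (α τ : Permutation′ m) (τ′ : Permutation′ (2+ m)) (ρ : Maybe (Fin m)) (I : Subset (2+ m))
  (ext : Extends τ τ′) (root≡ : ρ ≡ unlift (τ′ ⟨$⟩ʳ 0F))
  (inv : ∀ h → α ⟨$⟩ʳ (α ⟨$⟩ʳ h) ≡ h) (fpf : ∀ h → α ⟨$⟩ʳ h ≢ h)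
  (arb : Arborescence (swap⁺ α) τ′ I 1F) where
  open Arborescence arb hiding (involutive)

  A : PreMap
  A = record { σ = τ ; α = α ; root = ρ }

  ext-tour : Extends (τ · α) (τ′ · swap⁺ α)
  ext-tour = extends-∘ {π = τ} {τ′} ext τ-o {α} {swap⁺ α} (swap⁺-⁺ α) (swap⁺-0 α) (swap⁺-1 α)

  tour-0 : τ′ ⟨$⟩ʳ (swap⁺ α ⟨$⟩ʳ 0F) ≡ 1F
  tour-0 = trans (cong (τ′ ⟨$⟩ʳ_) (swap⁺-0 α)) τ-o

  conn′ : ∀ x → Reach (τ′ · swap⁺ α) 1F x
  conn′ x = reach-sym (τ′ · swap⁺ α) (connected x)

  conn : Connected (τ · α)
  conn = connected-⁺⁻ {ξ = τ · α} {τ′ · swap⁺ α} ext-tour tour-0 conn′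

  nonempty : m ≡ 0 ⊎ ∃[ r ] τ′ ⟨$⟩ʳ 0F ≡ r ⁺
  nonempty = case root-of-connected (τ′ · swap⁺ α) tour-0 conn′ of λ where
    (inj₁ z)        → inj₁ z
    (inj₂ (r , eq)) → inj₂ (r , trans (cong (τ′ ⟨$⟩ʳ_) (sym (swap⁺-1 α))) eq)

  isMap : IsMap A
  isMap = record
    { involutive = inv ; fixedPointFree = fpf ; transitive = connected⇒transitive τ α conn
    ; rooted = λ ρ≡nothing → case nonempty of λ where
        (inj₁ m≡0)      → m≡0
        (inj₂ (r , eq)) → case trans (sym ρ≡nothing) (trans root≡ (cong unlift eq)) of λ () }

  private
    V-closed : Closed V τ′
    V-closed x∈ = ≢1⇒∈V λ eq → ∈V⇒≢1 x∈ (perm-inj τ′ (trans eq (sym τ-o)))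

  -- Every vertex but {o} has exactly one ingoing half-edge, so these vertices are as many as the
  -- edges, {i, o} included.
  #vertices≡ : #vertices A ≡ suc (#edges A)
  #vertices≡ = trans (sym (#cycles-V {π = τ} {τ′} ext τ-o nonempty)) (trans (≤-antisym
    (#cycles-≤ V τ′ I Perm.id id (λ x y → Reach τ′ x y)
      (λ x∈ → let (y , y∈ , r , _) = parent _ (∈V⇒≢1 x∈) in y , y∈ , r)
      λ _ _ r r′ s → r ◅◅ subst (Reach τ′ _) (id-reach s) ε ◅◅ reach-sym τ′ r′)
    (#cycles-mono I V Perm.id τ′ V-closed (λ x∈ → ≢1⇒∈V λ { refl → o∉I x∈ })
      λ x∈ y∈ r → subst (Reach Perm.id _) (unique x∈ y∈ r) ε))
    (trans (#ingoing orientation) (trans (cong (#cycles ⊤) (swap⁺≡ α)) (#edges-swap α))))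

  isPlaneTree : ∀ {n} → #edges A ≡ n → IsPlaneTree n A
  isPlaneTree e = record
    { isMap = isMap ; oneFace = f
    ; genus = tree-genus A (trans #vertices≡ (cong suc e)) e f ; edges = e }
    where f = oneFace A conn

flip-cong : {π ρ : Permutation′ m} → (∀ x → π ⟨$⟩ʳ x ≡ ρ ⟨$⟩ʳ x) → ∀ x → π ⟨$⟩ˡ x ≡ ρ ⟨$⟩ˡ x
flip-cong {π = π} {ρ} eq x = perm-inj π (trans (inverseʳ π) (sym (trans (eq _) (inverseʳ ρ))))

-- Λ inserts o alone into φ, whereas the general study uses the faces of the extended map;
-- `insert-face` reconciles the two restrictions.
unfold-π : (M : PreMap) (I : Subset (PreMap.size M)) → ∀ x → Unfold.π M I ⟨$⟩ʳ x
  ≡ UnfoldedPermutations.π (swap⁺ (PreMap.α M)) (insert (PreMap.root M) 0F (PreMap.σ M)) (inside ∷ outside ∷ I) ⟨$⟩ʳ x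
unfold-π M I x = trans
  (cong (restrict (inside ∷ outside ∷ I) (insert root 0F σ) ⟨$⟩ʳ_)
    (flip-cong {π = Unfold.π• M I} {restrict (∁ (inside ∷ outside ∷ I)) (insert root 0F σ · swap⁺ α)} (insert-face root σ α (∁ I)) x))
  (sym (trans (π-spec x) (cong₂ (λ p q → p ⟨$⟩ʳ (q ⟨$⟩ˡ x)) π∘≡ π•≡)))
  where
  open PreMap M
  open UnfoldedPermutations (swap⁺ α) (insert root 0F σ) (inside ∷ outside ∷ I)

module Mobile {m} (α : Permutation′ m) (ρ σ : Permutation′ (2+ m)) (I : Subset (2+ m))
  (orient : IsOrientation (swap⁺ α) I) (ρ≡ : ∀ x → ρ ⟨$⟩ʳ x ≡ UnfoldedPermutations.π (swap⁺ α) σ I ⟨$⟩ʳ x) where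
  open Unfolding (swap⁺ α) σ I orient
  open IsOrientation orient

  B : PreMap
  B = record { σ = ρ ; α = swap α ; root = just 0F }

  swap⁺-swap : ∀ x → swap⁺ α ⟨$⟩ʳ x ≡ swap α ⟨$⟩ʳ x
  swap⁺-swap x = cong (_⟨$⟩ʳ x) (swap⁺≡ α)

  colouring : IsProperColouring B I
  colouring = record
    { vertexwise = λ h → mk⇔
        (λ πh∈ → decidable-stable (h ∈? I) λ h∉ → π-closed-∉ h∉ (subst (_∈ I) (ρ≡ h) πh∈))
        (λ h∈ → subst (_∈ I) (sym (ρ≡ h)) (π-closed h∈))
    ; proper = λ h → mk⇔ (λ αh∈ h∈ → ∈⇒∉ h∈ (subst (_∈ I) (sym (swap⁺-swap h)) αh∈))
                         (λ h∉ → subst (_∈ I) (swap⁺-swap h) (∉⇒∈ h∉)) }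

  #white : #whiteVertices B I ≡ #cycles I (restrict I σ)
  #white = unfolded-white (swap⁺ α) σ I orient ρ ρ≡ (white-closed B colouring)

  #black : #blackVertices B I ≡ #cycles (∁ I) (restrict (∁ I) (σ · swap⁺ α))
  #black = unfolded-black (swap⁺ α) σ I orient ρ ρ≡ (black-closed B colouring)

  module _ (conn : Connected (τ · swap⁺ α)) where

    connB : Connected (ρ · swap α)
    connB x y = Reach-cong F (ρ · swap α) (λ z → trans (sym (ρ≡ (swap⁺ α ⟨$⟩ʳ z))) (cong (ρ ⟨$⟩ʳ_) (swap⁺-swap z)))
      (F-connected (Connected-swap τ (swap⁺ α) involutive conn) x y)

    isMap : (∀ h → swap⁺ α ⟨$⟩ʳ h ≢ h) → IsMap B
    isMap fpf = record
      { involutive = subst (λ α′ → ∀ x → α′ ⟨$⟩ʳ (α′ ⟨$⟩ʳ x) ≡ x) (swap⁺≡ α) involutive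
      ; fixedPointFree = subst (λ α′ → ∀ x → α′ ⟨$⟩ʳ x ≢ x) (swap⁺≡ α) fpf
      ; transitive = connected⇒transitive ρ (swap α) connB ; rooted = λ () }

    counts : (W : Subset (2+ m)) → IsProperColouring B W → 0F ∈ I → 0F ∈ W →
      #whiteVertices B W ≡ #cycles I (restrict I σ) × #blackVertices B W ≡ #cycles (∁ I) (restrict (∁ I) (σ · swap⁺ α))
    counts W col 0∈I 0∈W = let (w , b) = colouring-counts B connB col colouring 0∈W 0∈I in trans w #white , trans b #black

    isUnicellular : (M : PreMap) → (∀ h → swap⁺ α ⟨$⟩ʳ h ≢ h) → #edges M ≡ #cycles ⊤ α →
      #cycles I (restrict I σ) ≡ #vertices M → #cycles (∁ I) (restrict (∁ I) (σ · swap⁺ α)) ≡ #faces M →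
      ∀ {n g} → #edges M ≡ n → HasGenus g M → IsBipartiteUnicellularMap (suc n) g B
    isUnicellular M fpf e w b e≡n genus = record
      { isMap = isMap fpf ; bipartite = I , colouring ; oneFace = oneFace B connB
      ; genus = trans (sym (genus-transfer M B
          (trans (#vertices-coloured B I 0F) (cong₂ _+_ (trans #white w) (trans #black b))) edgesB (oneFace B connB))) genus
      ; edges = trans edgesB (cong suc e≡n) }
      where
      edgesB : #edges B ≡ suc (#edges M)
      edgesB = trans (#edges-swap α) (cong suc (sym e))

-- Covered maps

Δ? : (M : PreMap) (S : Subset (PreMap.size M)) →
  Decidable (λ h → (h ∈ S × Precedes M S (PreMap.α M ⟨$⟩ʳ h) h) ⊎ (h ∉ S × Precedes M S h (PreMap.α M ⟨$⟩ʳ h)))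
Δ? M S h = ((h ∈? S) ×-dec precedes? M S (PreMap.α M ⟨$⟩ʳ h) h) ⊎-dec (¬? (h ∈? S) ×-dec precedes? M S h (PreMap.α M ⟨$⟩ʳ h))

motion-θ : (M : PreMap) (S : Subset (PreMap.size M)) → Closed S (PreMap.α M) → ∀ h →
  motion M S h ≡ (PreMap.σ M · restrict S (PreMap.α M)) ⟨$⟩ʳ h
motion-θ M S stable h with h ∈? S
... | yes h∈ = cong (PreMap.σ M ⟨$⟩ʳ_) (sym (restrict-stable S (PreMap.α M) h∈ (stable h∈)))
... | no h∉  = cong (PreMap.σ M ⟨$⟩ʳ_) (sym (restrict-∉ S (PreMap.α M) h∉))

-- The tour of ξ′ is o, then the tour of ξ, then i.
module ExtendedTour {m} (ξ : Permutation′ m) (ξ′ : Permutation′ (2+ m)) (ext : Extends ξ ξ′) (ξ0 : ξ′ ⟨$⟩ʳ 0F ≡ 1F)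
  (reach : ∀ x → Reach ξ′ 1F x) where
  open Tour ξ′ 1F reach

  i-last : last ≡ 0F
  i-last = sym (last-unique ξ0)

  pos-i : pos 0F ≡ suc m
  pos-i = ℕ.suc-injective (trans (cong (λ x → suc (pos x)) (sym i-last)) pos-last)

  module _ {r : Fin m} (root≡ : ξ′ ⟨$⟩ʳ 1F ≡ r ⁺) (f : Fin m → Fin m) (f≡ : ∀ h → f h ≡ ξ ⟨$⟩ʳ h) where

    visit-⁺ : ∀ j → j < m → visit (suc j) ≡ (iterate f r j) ⁺
    visit-⁺ zero    _  = trans (visit-suc 0) (trans (cong (ξ′ ⟨$⟩ʳ_) visit-zero) root≡)
    visit-⁺ (suc j) lt = trans (visit-suc (suc j)) (trans (cong (ξ′ ⟨$⟩ʳ_) (visit-⁺ j (ℕ.<⇒≤ lt)))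
      (trans (next (ext h)) (cong _⁺ (trans (sym (f≡ h)) (sym (iterate-suc f r j))))))
      where
      h = iterate f r j
      next : ∀ {k} → Ret (_∈ H⁺) ξ′ (h ⁺) (k ⁺) → ξ′ ⟨$⟩ʳ (h ⁺) ≡ k ⁺
      next (stop e _) = e
      next (skip {z = suc (suc z)} _ ¬p _) = ⊥-elim (¬p (⁺∈H⁺ z))
      next (skip {z = 1F} e _ _) with () ← perm-inj ξ′ (trans e (sym ξ0))
      -- The time here is at most m, but i is visited last, at time m + 1.
      next (skip {z = 0F} e _ _) = ⊥-elim (ℕ.<⇒≱ (s≤s lt) (subst (_≤ suc (suc j)) pos-i (pos-min
        (trans (visit-suc (suc j)) (trans (cong (ξ′ ⟨$⟩ʳ_) (visit-⁺ j (ℕ.<⇒≤ lt))) e)))))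

    pos-iterate : ∀ j → j < m → pos ((iterate f r j) ⁺) ≡ suc j
    pos-iterate j j<m = trans (cong pos (sym (visit-⁺ j j<m))) (pos-visit (suc j) (≤-trans j<m
      (≤-trans (ℕ.n≤1+n m) (ℕ.≤-reflexive (trans (sym pos-i) (cong pos (sym i-last)))))))

    index-of : ∀ h → ∃[ j ] suc (toℕ j) ≡ pos (h ⁺) × iterate f r (toℕ j) ≡ h
    index-of h with pos (h ⁺) in eq
    ... | zero with () ← pos≡0 eq
    ... | suc j = fromℕ< j<m , cong suc (toℕ-fromℕ< j<m) , trans (cong (iterate f r) (toℕ-fromℕ< j<m))
            (⁺-injective (trans (sym (visit-⁺ j j<m)) (trans (cong visit (sym eq)) (visit-pos _))))
      where
      j<m : j < m
      j<m with ℕ.m≤n⇒m<n∨m≡n (s≤s⁻¹ (subst (_≤ suc m) eq (s≤s⁻¹ (pos< (h ⁺)))))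
      ... | inj₁ lt = lt
      ... | inj₂ refl with () ← pos-inj {h ⁺} {0F} (trans eq (sym pos-i))

    Before : Fin m → Fin m → Set
    Before a b = Σ[ j ∈ Fin m ] Σ[ k ∈ Fin m ] j Fin.< k × iterate f r (toℕ j) ≡ a × iterate f r (toℕ k) ≡ b

    Before⇒< : ∀ {a b} → Before a b → pos (a ⁺) < pos (b ⁺)
    Before⇒< (j , k , j<k , vj , vk) = subst₂ _<_ (pos-of j vj) (pos-of k vk) (s≤s j<k)
      where
      pos-of : ∀ j {h} → iterate f r (toℕ j) ≡ h → suc (toℕ j) ≡ pos (h ⁺)
      pos-of j eq = trans (sym (pos-iterate (toℕ j) (toℕ<n j))) (cong (λ h → pos (h ⁺)) eq)

    <⇒Before : ∀ {a b} → pos (a ⁺) < pos (b ⁺) → Before a b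
    <⇒Before {a} {b} lt with j , ej , vj ← index-of a with k , ek , vk ← index-of b
      = j , k , s≤s⁻¹ (subst₂ _<_ (sym ej) (sym ek) lt) , vj , vk

module Extended (M : PreMap) (S : Subset (PreMap.size M)) (stable : Closed S (PreMap.α M)) where
  open PreMap M

  σ′ α′ : Permutation′ (2+ size)
  σ′ = insert root 0F σ
  α′ = swap⁺ α
  -- The new edge joins the submap: the motion then leads from o to the image of i, the root when
  -- there is one, and closes up from i to o.
  S′ : Subset (2+ size)
  S′ = inside ∷ inside ∷ S

  abstract
    θ′ : Permutation′ (2+ size)
    θ′ = σ′ · restrict S′ α′

    θ′-spec : ∀ x → θ′ ⟨$⟩ʳ x ≡ σ′ ⟨$⟩ʳ (restrict S′ α′ ⟨$⟩ʳ x)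
    θ′-spec x = refl

    subst-extends : ∀ {ξ} → Extends ξ (σ′ · restrict S′ α′) → Extends ξ θ′
    subst-extends ext = ext

  u-0 : restrict S′ α′ ⟨$⟩ʳ 0F ≡ 1F
  u-0 = trans (restrict-stable S′ α′ here (subst (_∈ S′) (sym (swap⁺-0 α)) (there here))) (swap⁺-0 α)

  u-1 : restrict S′ α′ ⟨$⟩ʳ 1F ≡ 0F
  u-1 = trans (restrict-stable S′ α′ (there here) (subst (_∈ S′) (sym (swap⁺-1 α)) here)) (swap⁺-1 α)

  θ′-extends : Extends (σ · restrict S α) θ′
  θ′-extends = subst-extends {σ · restrict S α} (extends-∘ {π = σ} {σ′} (insert-extends root σ) (insert-1 root σ) {restrict S α} {restrict S′ α′}
    (restrict-swap⁺ α S stable) u-0 u-1)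

  θ′-0 : θ′ ⟨$⟩ʳ 0F ≡ 1F
  θ′-0 = trans (θ′-spec 0F) (trans (cong (σ′ ⟨$⟩ʳ_) u-0) (insert-1 root σ))

  θ′-1 : θ′ ⟨$⟩ʳ 1F ≡ σ′ ⟨$⟩ʳ 0F
  θ′-1 = trans (θ′-spec 1F) (cong (σ′ ⟨$⟩ʳ_) u-1)

  θ′-∈ : ∀ {x} → x ∈ S′ → θ′ ⟨$⟩ʳ x ≡ σ′ ⟨$⟩ʳ (α′ ⟨$⟩ʳ x)
  θ′-∈ {x} x∈ = trans (θ′-spec x) (cong (σ′ ⟨$⟩ʳ_) (restrict-stable S′ α′ x∈ (swap⁺-closed α S stable x∈)))

  θ′-∉ : ∀ {x} → x ∉ S′ → θ′ ⟨$⟩ʳ x ≡ σ′ ⟨$⟩ʳ x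
  θ′-∉ {x} x∉ = trans (θ′-spec x) (cong (σ′ ⟨$⟩ʳ_) (restrict-∉ S′ α′ x∉))

module Covered (M : PreMap) (S : Subset (PreMap.size M)) (isMap : IsMap M) (stable : Closed S (PreMap.α M))
  (conn : Connected (PreMap.σ M · restrict S (PreMap.α M))) where
  open PreMap M
  open IsMap isMap
  open Extended M S stable

  nonempty : size ≡ 0 ⊎ ∃[ r ] root ≡ just r
  nonempty = rooted? root rooted

  abstract
    conn′ : ∀ x → Reach θ′ 1F x
    conn′ = connected-⁺ {ξ = σ · restrict S α} {θ′} θ′-extends θ′-0 (case nonempty of λ where
      (inj₁ z) → inj₁ z
      (inj₂ (r , eq)) → inj₂ (r , trans θ′-1 (insert-just σ eq))) conn

  open Tour θ′ 1F conn′ using (pos; pos-start)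

  module ET = ExtendedTour (σ · restrict S α) θ′ θ′-extends θ′-0 conn′

  θ′-root : ∀ {r} → root ≡ just r → θ′ ⟨$⟩ʳ 1F ≡ r ⁺
  θ′-root eq = trans θ′-1 (insert-just σ eq)

  Precedes⇒< : ∀ {a b} → Precedes M S a b → pos (a ⁺) < pos (b ⁺)
  Precedes⇒< p = let (r , eq , b) = Any⇒just p in ET.Before⇒< (θ′-root eq) (motion M S) (motion-θ M S stable) b

  <⇒Precedes : ∀ {r a b} → root ≡ just r → pos (a ⁺) < pos (b ⁺) → Precedes M S a b
  <⇒Precedes eq lt = just⇒Any eq (ET.<⇒Before (θ′-root eq) (motion M S) (motion-θ M S stable) lt)

  ∃root : Fin size → ∃[ r ] root ≡ just r
  ∃root h = case nonempty of λ where
    (inj₁ z)      → case subst Fin z h of λ ()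
    (inj₂ (r , e)) → r , e

  private
    at-⁺ : ∀ {h} → (pos (swap⁺ α ⟨$⟩ʳ (h ⁺)) < pos (h ⁺) → pos ((α ⟨$⟩ʳ h) ⁺) < pos (h ⁺))
                 × (pos (h ⁺) < pos (swap⁺ α ⟨$⟩ʳ (h ⁺)) → pos (h ⁺) < pos ((α ⟨$⟩ʳ h) ⁺))
    at-⁺ {h} = subst (λ y → pos y < pos (h ⁺)) (swap⁺-⁺ α h) , subst (λ y → pos (h ⁺) < pos y) (swap⁺-⁺ α h)

    at-⁺⁻ : ∀ {h} → (pos ((α ⟨$⟩ʳ h) ⁺) < pos (h ⁺) → pos (swap⁺ α ⟨$⟩ʳ (h ⁺)) < pos (h ⁺))
                  × (pos (h ⁺) < pos ((α ⟨$⟩ʳ h) ⁺) → pos (h ⁺) < pos (swap⁺ α ⟨$⟩ʳ (h ⁺)))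
    at-⁺⁻ {h} = subst (λ y → pos y < pos (h ⁺)) (sym (swap⁺-⁺ α h)) , subst (λ y → pos (h ⁺) < pos y) (sym (swap⁺-⁺ α h))

  Δ⇒ : ∀ {x} → x ∈ inside ∷ outside ∷ Δ M S → Ingoing pos (swap⁺ α) S′ x
  Δ⇒ {0F} _ = inj₁ (here , subst₂ _<_ (trans (sym pos-start) (cong pos (sym (swap⁺-0 α)))) (sym ET.pos-i) (s≤s z≤n))
  Δ⇒ {suc (suc h)} (there (there h∈)) = case ∈-comprehension⁻ (Δ? M S) h∈ of λ where
    (inj₁ (h∈S , p)) → inj₁ (there (there h∈S) , proj₁ at-⁺⁻ (Precedes⇒< p))
    (inj₂ (h∉S , p)) → inj₂ ((λ { (there (there h∈S)) → h∉S h∈S }) , proj₂ at-⁺⁻ (Precedes⇒< p))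

  Δ⇐ : ∀ {x} → Ingoing pos (swap⁺ α) S′ x → x ∈ inside ∷ outside ∷ Δ M S
  Δ⇐ {0F} _ = here
  Δ⇐ {1F} (inj₁ (_ , lt)) = ⊥-elim (ℕ.n≮0 (subst (pos (swap⁺ α ⟨$⟩ʳ 1F) <_) pos-start lt))
  Δ⇐ {1F} (inj₂ (∉S , _)) = ⊥-elim (∉S (there here))
  Δ⇐ {suc (suc h)} g = there (there (∈-comprehension⁺ (Δ? M S) (case g of λ where
    (inj₁ (there (there h∈S) , lt)) → inj₁ (h∈S , <⇒Precedes (proj₂ (∃root h)) (proj₁ at-⁺ lt))
    (inj₂ (h∉S , lt)) → inj₂ ((λ h∈S → h∉S (there (there h∈S))) , <⇒Precedes (proj₂ (∃root h)) (proj₂ at-⁺ lt)))))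

  abstract
    isMotion : IsMotion (swap⁺ α) (insert root 0F σ) θ′ (inside ∷ inside ∷ S) (inside ∷ outside ∷ Δ M S) 1F
    isMotion = record
      { invol = swap⁺-involutive α involutive ; fpf = swap⁺-fixedPointFree α fixedPointFree
      ; stable = λ {x} → swap⁺-closed α S stable {x} ; σ-o = insert-1 root σ ; o∈S = there here
      ; θ-∈ = θ′-∈ ; θ-∉ = θ′-∉ ; reach = conn′ ; ⇒ = λ {x} → Δ⇒ {x} ; ⇐ = λ {x} → Δ⇐ {x} }

  open IsMotion isMotion public using (orientation; arborescence; #white; #black)

fromH≡unlift : (M : PreMap) (I : Subset (PreMap.size M)) → ∀ x → Unfold.fromH M I x ≡ unlift x
fromH≡unlift M I 0F            = refl
fromH≡unlift M I 1F            = refl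
fromH≡unlift M I (suc (suc h)) = refl

-- A covered map M, its extension by i and o, and its images A and B. All permutations are fields, so that
-- the type checker treats them as variables.
record Unfolded (m : ℕ) : Set where
  field
    σ α     : Permutation′ m
    root    : Maybe (Fin m)
    σ′ θ′   : Permutation′ (2+ m)
    S′ I′   : Subset (2+ m)
    motion′ : IsMotion (swap⁺ α) σ′ θ′ S′ I′ 1F
    ext     : Extends σ σ′
    σ′-1    : σ′ ⟨$⟩ʳ 1F ≡ 1F
    σ′-root : m ≡ 0 ⊎ ∃[ r ] σ′ ⟨$⟩ʳ 0F ≡ r ⁺
    σ′-0    : unlift (σ′ ⟨$⟩ʳ 0F) ≡ root
    inv     : ∀ h → α ⟨$⟩ʳ (α ⟨$⟩ʳ h) ≡ h
    fpf     : ∀ h → α ⟨$⟩ʳ h ≢ h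
    0∈I′    : 0F ∈ I′
    τᴬ      : Permutation′ m
    rootᴬ   : Maybe (Fin m)
    τ′      : Permutation′ (2+ m)
    τ≡τ′    : UnfoldedPermutations.τ (swap⁺ α) σ′ I′ ≡ τ′
    extᴬ    : Extends τᴬ τ′
    rootᴬ≡  : rootᴬ ≡ unlift (τ′ ⟨$⟩ʳ 0F)
    ρ       : Permutation′ (2+ m)
    ρ≡      : ∀ x → ρ ⟨$⟩ʳ x ≡ UnfoldedPermutations.π (swap⁺ α) σ′ I′ ⟨$⟩ʳ x

  open IsMotion motion′ using (orientation; arborescence; #white; #black)
  open UnfoldedPermutations (swap⁺ α) σ′ I′ using (τ; π)

  M A B : PreMap
  M = record { σ = σ ; α = α ; root = root }
  A = record { σ = τᴬ ; α = α ; root = rootᴬ }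
  B = record { σ = ρ ; α = swap α ; root = just 0F }

  conn-τ : Connected (τ · swap⁺ α)
  conn-τ x y = connected x ◅◅ reach-sym (τ · swap⁺ α) (connected y)
    where open Arborescence arborescence

  white : #cycles I′ (restrict I′ σ′) ≡ #vertices M
  white = trans (#white V (λ {x} → ∈V⇒≢1 {x = x}) (λ {x} → ≢1⇒∈V {x = x})) (#cycles-V {π = σ} {σ′} ext σ′-1 σ′-root)

  -- In the extended map i and o are inserted consecutively before the root in its face, which
  -- creates no face; for the empty map they form the one face of the convention.
  black : #cycles (∁ I′) (restrict (∁ I′) (σ′ · swap⁺ α)) ≡ #faces M
  black = trans #black
    (#cycles-extends {π = σ · α} {σ′ · swap⁺ α} (extends-∘ {π = σ} {σ′} ext σ′-1 {α} {swap⁺ α} (swap⁺-⁺ α) (swap⁺-0 α) (swap⁺-1 α))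
      ⊤ (⊤-closed (σ′ · swap⁺ α)) ∈⊤ (λ _ → ∈⊤)
      (λ { {0F} _ → inj₁ ε ; {1F} _ → inj₁ (step₀ ◅ ε) ; {suc (suc h)} _ → inj₂ (h , refl) })
      (case σ′-root of λ where
        (inj₁ z)        → inj₁ z
        (inj₂ (r , eq)) → inj₂ (r , step₀ ◅ trans (cong (σ′ ⟨$⟩ʳ_) (swap⁺-1 α)) eq ◅ ε)))
    where
    step₀ : σ′ ⟨$⟩ʳ (swap⁺ α ⟨$⟩ʳ 0F) ≡ 1F
    step₀ = trans (cong (σ′ ⟨$⟩ʳ_) (swap⁺-0 α)) σ′-1

  private
    module Mob = Mobile α ρ σ′ I′ orientation ρ≡
    module Tre = Tree α τᴬ τ′ rootᴬ I′ extᴬ rootᴬ≡ inv fpf (subst (λ τ → Arborescence (swap⁺ α) τ I′ 1F) τ≡τ′ arborescence)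

  colouring : IsProperColouring B I′
  colouring = Mob.colouring

  connected : Connected (ρ · swap α)
  connected = Mob.connB conn-τ

  isBipartite : ∀ {n g} → #edges M ≡ n → HasGenus g M → IsBipartiteUnicellularMap (suc n) g B
  isBipartite = Mob.isUnicellular conn-τ M (swap⁺-fixedPointFree α fpf) refl white black

  whiteAndBlack : ∀ W → IsProperColouring B W → 0F ∈ W → #whiteVertices B W ≡ #vertices M × #blackVertices B W ≡ #faces M
  whiteAndBlack W col 0∈ = let (w , b) = Mob.counts conn-τ W col 0∈I′ 0∈ in trans w white , trans b black

  #vertices-B : #vertices B ≡ #vertices M + #faces M
  #vertices-B = trans (#vertices-coloured B I′ 0F) (cong₂ _+_ (trans Mob.#white white) (trans Mob.#black black))

  isTree : ∀ {n} → #edges M ≡ n → IsPlaneTree n A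
  isTree = Tre.isPlaneTree

module Image (M : PreMap) (S : Subset (PreMap.size M)) (isMap : IsMap M) (stable : Closed S (PreMap.α M))
  (conn : Connected (PreMap.σ M · restrict S (PreMap.α M))) where
  open PreMap M
  open IsMap isMap
  open Covered M S isMap stable conn public

  unfolded : Unfolded size
  unfolded = record
    { σ = σ ; α = α ; root = root ; σ′ = insert root 0F σ ; θ′ = Extended.θ′ M S stable
    ; S′ = inside ∷ inside ∷ S ; I′ = inside ∷ outside ∷ Δ M S ; motion′ = isMotion
    ; ext = insert-extends root σ ; σ′-1 = insert-1 root σ
    ; σ′-root = case nonempty of λ where
        (inj₁ z)        → inj₁ z
        (inj₂ (r , eq)) → inj₂ (r , insert-just σ eq)
    ; σ′-0 = insert-0 root σ ; inv = involutive ; fpf = fixedPointFree ; 0∈I′ = here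
    ; τᴬ = Unfold.τ M (Δ M S) ; rootᴬ = Unfold.fromH M (Δ M S) (Unfold.τ′ M (Δ M S) ⟨$⟩ʳ 0F) ; τ′ = Unfold.τ′ M (Δ M S)
    ; τ≡τ′ = UnfoldedPermutations.τ≡ (swap⁺ α) (insert root 0F σ) (inside ∷ outside ∷ Δ M S)
    ; extᴬ = contract-extends (Unfold.τ′ M (Δ M S)) ; rootᴬ≡ = fromH≡unlift M (Δ M S) (Unfold.τ′ M (Δ M S) ⟨$⟩ʳ 0F)
    ; ρ = Unfold.π M (Δ M S) ; ρ≡ = unfold-π M (Δ M S) }

unfoldedMap : ∀ {n g} (C : CoveredMap n g) → Unfolded (PreMap.size (CoveredMap.map C))
unfoldedMap C = Image.unfolded map submap isMap (λ {x} → IsCovered.stable isCovered x) (covered⇒connected map submap isCovered)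
  where open CoveredMap C

tree : ∀ {n g} (C : CoveredMap n g) → IsPlaneTree n (Ψ₁ C)
tree C = Unfolded.isTree (unfoldedMap C) (CoveredMap.edges C)

bip : ∀ {n g} (C : CoveredMap n g) → IsBipartiteUnicellularMap (suc n) g (Ψ₂ C)
bip C = Unfolded.isBipartite (unfoldedMap C) (CoveredMap.edges C) (CoveredMap.genus C)

vertexCounts : ∀ {n g} (C : CoveredMap n g) (W : Subset (PreMap.size (Ψ₂ C))) → IsProperColouring (Ψ₂ C) W →
  Any (_∈ W) (PreMap.root (Ψ₂ C)) →
  #whiteVertices (Ψ₂ C) W ≡ #vertices (CoveredMap.map C) × #blackVertices (Ψ₂ C) W ≡ #faces (CoveredMap.map C)
vertexCounts C W col (just 0∈W) = Unfolded.whiteAndBlack (unfoldedMap C) W col 0∈W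

-- Isomorphisms

Conj-· : (ι : Permutation m n) {π ρ : Permutation′ m} {π′ ρ′ : Permutation′ n} → Conj ι π π′ → Conj ι ρ ρ′ →
  Conj ι (π · ρ) (π′ · ρ′)
Conj-· ι {ρ = ρ} {π′} c d x = trans (cong (π′ ⟨$⟩ʳ_) (d x)) (c (ρ ⟨$⟩ʳ x))

Conj-flip : (ι : Permutation m n) {π : Permutation′ m} {π′ : Permutation′ n} → Conj ι π π′ → Conj ι (flip π) (flip π′)
Conj-flip ι {π} {π′} c x = perm-inj π′ (trans (inverseʳ π′) (sym (trans (c _) (cong (ι ⟨$⟩ʳ_) (inverseʳ π)))))

Conj-sym : (ι : Permutation m n) {π : Permutation′ m} {π′ : Permutation′ n} → Conj ι π π′ → Conj (flip ι) π′ π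
Conj-sym ι {π} {π′} c x = perm-inj ι (trans (sym (c _)) (trans (cong (π′ ⟨$⟩ʳ_) (inverseʳ ι)) (sym (inverseʳ ι))))

≈⇒Conj : (ι : Permutation m n) {π : Permutation′ m} {π′ : Permutation′ n} →
  (∀ x → π′ ⟨$⟩ʳ x ≡ ι ⟨$⟩ʳ (π ⟨$⟩ʳ (ι ⟨$⟩ˡ x))) → Conj ι π π′
≈⇒Conj ι {π} eq x = trans (eq _) (cong (λ y → ι ⟨$⟩ʳ (π ⟨$⟩ʳ y)) (inverseˡ ι))

Conj⇒≈ : (ι : Permutation m n) {π : Permutation′ m} {π′ : Permutation′ n} → Conj ι π π′ →
  ∀ x → π′ ⟨$⟩ʳ x ≡ ι ⟨$⟩ʳ (π ⟨$⟩ʳ (ι ⟨$⟩ˡ x))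
Conj⇒≈ ι {π′ = π′} c x = trans (cong (π′ ⟨$⟩ʳ_) (sym (inverseʳ ι))) (c (ι ⟨$⟩ˡ x))

record Iso (M N : PreMap) (ι : Permutation (PreMap.size M) (PreMap.size N)) : Set where
  field
    conj-σ : Conj ι (PreMap.σ M) (PreMap.σ N)
    conj-α : Conj ι (PreMap.α M) (PreMap.α N)
    root   : PreMap.root N ≡ Maybe.map (ι ⟨$⟩ʳ_) (PreMap.root M)

IsIso⇒Iso : ∀ {M N ι} → IsIso M N ι → Iso M N ι
IsIso⇒Iso {M} {N} {ι} iso = record
  { conj-σ = ≈⇒Conj ι {PreMap.σ M} {PreMap.σ N} (IsIso.σ-conj iso)
  ; conj-α = ≈⇒Conj ι {PreMap.α M} {PreMap.α N} (IsIso.α-conj iso) ; root = IsIso.root-≡ iso }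

Iso⇒IsIso : ∀ {M N ι} → Iso M N ι → IsIso M N ι
Iso⇒IsIso {M} {N} {ι} iso = record
  { σ-conj = Conj⇒≈ ι {PreMap.σ M} {PreMap.σ N} (Iso.conj-σ iso)
  ; α-conj = Conj⇒≈ ι {PreMap.α M} {PreMap.α N} (Iso.conj-α iso) ; root-≡ = Iso.root iso }

Iso-refl : ∀ {M} → Iso M M Perm.id
Iso-refl {M} = record { conj-σ = λ _ → refl ; conj-α = λ _ → refl ; root = sym (map-id (PreMap.root M)) }

Iso-sym : ∀ {M N ι} → Iso M N ι → Iso N M (flip ι)
Iso-sym {M} {N} {ι} iso = record
  { conj-σ = Conj-sym ι {PreMap.σ M} {PreMap.σ N} (Iso.conj-σ iso)
  ; conj-α = Conj-sym ι {PreMap.α M} {PreMap.α N} (Iso.conj-α iso)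
  ; root = sym (trans (cong (Maybe.map (ι ⟨$⟩ˡ_)) (Iso.root iso)) (trans (sym (map-∘ (PreMap.root M)))
      (trans (map-cong (λ _ → inverseˡ ι) (PreMap.root M)) (map-id (PreMap.root M))))) }

Iso-trans : ∀ {L M N ι κ} → Iso L M ι → Iso M N κ → Iso L N (κ · ι)
Iso-trans {L} {M} {N} {ι} {κ} i j = record
  { conj-σ = λ x → trans (Iso.conj-σ j _) (cong (κ ⟨$⟩ʳ_) (Iso.conj-σ i x))
  ; conj-α = λ x → trans (Iso.conj-α j _) (cong (κ ⟨$⟩ʳ_) (Iso.conj-α i x))
  ; root = trans (Iso.root j) (trans (cong (Maybe.map (κ ⟨$⟩ʳ_)) (Iso.root i)) (sym (map-∘ (PreMap.root L)))) }

≅-isEquivalence : IsEquivalence _≅_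
≅-isEquivalence = record
  { refl  = Perm.id , Iso⇒IsIso Iso-refl
  ; sym   = λ (ι , i) → flip ι , Iso⇒IsIso (Iso-sym (IsIso⇒Iso i))
  ; trans = λ (ι , i) (κ , j) → κ · ι , Iso⇒IsIso (Iso-trans (IsIso⇒Iso i) (IsIso⇒Iso j)) }

≅ᶜ-isEquivalence : ∀ {n g} → IsEquivalence (_≅ᶜ_ {n} {g})
≅ᶜ-isEquivalence = record
  { refl  = Perm.id , Iso⇒IsIso Iso-refl , λ _ → mk⇔ id id
  ; sym   = λ {C} {D} (ι , i , s) → flip ι , Iso⇒IsIso (Iso-sym (IsIso⇒Iso i)) , λ h → mk⇔
      (λ h∈ → Equivalence.from (s _) (subst (_∈ CoveredMap.submap D) (sym (inverseʳ ι)) h∈))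
      (λ h∈ → subst (_∈ CoveredMap.submap D) (inverseʳ ι) (Equivalence.to (s _) h∈))
  ; trans = λ (ι , i , s) (κ , j , t) → κ · ι , Iso⇒IsIso (Iso-trans (IsIso⇒Iso i) (IsIso⇒Iso j)) , λ h → mk⇔
      (Equivalence.to (t _) ∘ Equivalence.to (s h)) (Equivalence.from (s h) ∘ Equivalence.from (t _)) }

≅ᵖ-isEquivalence : ∀ {n n′ g} → IsEquivalence (_≅ᵖ_ {n} {n′} {g})
≅ᵖ-isEquivalence = record
  { refl  = E.refl , E.refl
  ; sym   = λ (a , b) → E.sym a , E.sym b
  ; trans = λ (a , b) (a′ , b′) → E.trans a a′ , E.trans b b′ }
  where module E = IsEquivalence ≅-isEquivalence

-- Unfolding is equivariant

_preserves_⇒_ : (ι : Permutation m n) → Subset m → Subset n → Set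
ι preserves S ⇒ T = (∀ {x} → x ∈ S → ι ⟨$⟩ʳ x ∈ T) × (∀ {x} → x ∉ S → ι ⟨$⟩ʳ x ∉ T)

⇔⇒preserves : (ι : Permutation m n) {S : Subset m} {T : Subset n} → (∀ h → h ∈ S ⇔ (ι ⟨$⟩ʳ h) ∈ T) → ι preserves S ⇒ T
⇔⇒preserves ι s = (λ x∈ → Equivalence.to (s _) x∈) , (λ x∉ ιx∈ → x∉ (Equivalence.from (s _) ιx∈))

preserves-∁ : (ι : Permutation m n) {S : Subset m} {T : Subset n} → ι preserves S ⇒ T → ι preserves (∁ S) ⇒ (∁ T)
preserves-∁ ι (to , to∉) = (λ x∈ → x∉p⇒x∈∁p (to∉ (x∈∁p⇒x∉p x∈))) , (λ x∉ → x∈p⇒x∉∁p (to (x∉∁p⇒x∈p x∉)))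

preserves-lift² : (ι : Permutation m n) {S : Subset m} {T : Subset n} → ι preserves S ⇒ T →
  lift² ι preserves (inside ∷ outside ∷ S) ⇒ (inside ∷ outside ∷ T)
preserves-lift² ι {S} {T} (to , to∉) = to′ , to∉′
  where
  to′ : ∀ {x} → x ∈ inside ∷ outside ∷ S → lift² ι ⟨$⟩ʳ x ∈ inside ∷ outside ∷ T
  to′ {0F} _ = here
  to′ {suc (suc h)} (there (there h∈)) = there (there (to h∈))
  to∉′ : ∀ {x} → x ∉ inside ∷ outside ∷ S → lift² ι ⟨$⟩ʳ x ∉ inside ∷ outside ∷ T
  to∉′ {0F} x∉ _ = x∉ here
  to∉′ {1F} x∉ (there ())
  to∉′ {suc (suc h)} x∉ (there (there h∈)) = to∉ (λ h∈S → x∉ (there (there h∈S))) h∈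

Conj-restrict : (ι : Permutation m n) {S : Subset m} {T : Subset n} {π : Permutation′ m} {π′ : Permutation′ n} →
  ι preserves S ⇒ T → Conj ι π π′ → Conj ι (restrict S π) (restrict T π′)
Conj-restrict ι {S} {T} {π} {π′} (to , to∉) c = restrict-conj S π T π′ (ι ⟨$⟩ʳ_) to to∉ c

module UnfoldConj (ι : Permutation m n) (α σ : Permutation′ m) (α₂ σ₂ : Permutation′ n) (I : Subset m) (I₂ : Subset n)
  (pres : ι preserves I ⇒ I₂) (cα : Conj ι α α₂) (cσ : Conj ι σ σ₂) where
  private
    module U = UnfoldedPermutations α σ I
    module V = UnfoldedPermutations α₂ σ₂ I₂

  conj-τ′ : Conj ι (σ · flip (restrict I σ)) (σ₂ · flip (restrict I₂ σ₂))
  conj-τ′ = Conj-· ι {σ} {flip (restrict I σ)} {σ₂} {flip (restrict I₂ σ₂)} cσ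
    (Conj-flip ι {restrict I σ} {restrict I₂ σ₂} (Conj-restrict ι {I} {I₂} {σ} {σ₂} pres cσ))

  conj-τ : Conj ι U.τ V.τ
  conj-τ = subst₂ (Conj ι) (sym U.τ≡) (sym V.τ≡) conj-τ′

  conj-π : Conj ι U.π V.π
  conj-π x = trans (V.π-spec _) (trans (cong (V.π∘ ⟨$⟩ʳ_) (Conj-flip ι {U.π•} {V.π•} c• x))
    (trans (c∘ _) (cong (ι ⟨$⟩ʳ_) (sym (U.π-spec x)))))
    where
    c∘ : Conj ι U.π∘ V.π∘
    c∘ = subst₂ (Conj ι) (sym U.π∘≡) (sym V.π∘≡) (Conj-restrict ι {I} {I₂} {σ} {σ₂} pres cσ)
    c• : Conj ι U.π• V.π•
    c• = subst₂ (Conj ι) (sym U.π•≡) (sym V.π•≡)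
      (Conj-restrict ι {∁ I} {∁ I₂} {σ · α} {σ₂ · α₂} (preserves-∁ ι pres) (Conj-· ι {σ} {α} {σ₂} {α₂} cσ cα))

unfold-τ′ : (M : PreMap) (I : Subset (PreMap.size M)) → Unfold.τ′ M I
  ≡ insert (PreMap.root M) 0F (PreMap.σ M) · flip (restrict (inside ∷ outside ∷ I) (insert (PreMap.root M) 0F (PreMap.σ M)))
unfold-τ′ M I = refl

insert-conj-0 : (ι : Permutation m n) (ρ : Maybe (Fin m)) (π : Permutation′ m) (π′ : Permutation′ n) →
  insert (Maybe.map (ι ⟨$⟩ʳ_) ρ) 0F π′ ⟨$⟩ʳ 0F ≡ lift² ι ⟨$⟩ʳ (insert ρ 0F π ⟨$⟩ʳ 0F)
insert-conj-0 ι nothing  π π′ = refl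
insert-conj-0 ι (just r) π π′ = refl

unlift-lift² : (ι : Permutation m n) (x : Fin (2+ m)) → unlift (lift² ι ⟨$⟩ʳ x) ≡ Maybe.map (ι ⟨$⟩ʳ_) (unlift x)
unlift-lift² ι 0F            = refl
unlift-lift² ι 1F            = refl
unlift-lift² ι (suc (suc h)) = refl

Iso-insert : ∀ {M N ι} → Iso M N ι →
  Conj (lift² ι) (insert (PreMap.root M) 0F (PreMap.σ M)) (insert (PreMap.root N) 0F (PreMap.σ N))
Iso-insert {M} {N} {ι} iso = extension-conj ι {PreMap.σ M} {insert (PreMap.root M) 0F (PreMap.σ M)} {PreMap.σ N}
  {insert (PreMap.root N) 0F (PreMap.σ N)}
  (insert-extends (PreMap.root M) (PreMap.σ M)) (insert-1 (PreMap.root M) (PreMap.σ M))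
  (insert-extends (PreMap.root N) (PreMap.σ N)) (insert-1 (PreMap.root N) (PreMap.σ N)) (Iso.conj-σ iso)
  (trans (cong (λ ρ → insert ρ 0F (PreMap.σ N) ⟨$⟩ʳ 0F) (Iso.root iso))
    (insert-conj-0 ι (PreMap.root M) (PreMap.σ M) (PreMap.σ N)))

swap-conj : (ι : Permutation m n) {α : Permutation′ m} {β : Permutation′ n} → Conj ι α β → Conj (lift² ι) (swap α) (swap β)
swap-conj ι {α} {β} c = subst₂ (Conj (lift² ι)) (swap⁺≡ α) (swap⁺≡ β) (swap⁺-conj ι {α} {β} c)

module UnfoldIso (M N : PreMap) (ι : Permutation (PreMap.size M) (PreMap.size N)) (iso : Iso M N ι)
  (I : Subset (PreMap.size M)) (J : Subset (PreMap.size N)) (pres : ι preserves I ⇒ J) where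
  private
    module UC = UnfoldConj (lift² ι) (swap⁺ (PreMap.α M)) (insert (PreMap.root M) 0F (PreMap.σ M))
      (swap⁺ (PreMap.α N)) (insert (PreMap.root N) 0F (PreMap.σ N)) (inside ∷ outside ∷ I) (inside ∷ outside ∷ J)
      (preserves-lift² ι pres) (swap⁺-conj ι {PreMap.α M} {PreMap.α N} (Iso.conj-α iso)) (Iso-insert iso)

  conj-τ′ : Conj (lift² ι) (Unfold.τ′ M I) (Unfold.τ′ N J)
  conj-τ′ = subst₂ (Conj (lift² ι)) (sym (unfold-τ′ M I)) (sym (unfold-τ′ N J)) UC.conj-τ′

  iso₁ : Iso (Unfold.Λ₁ M I) (Unfold.Λ₁ N J) ι
  iso₁ = record
    { conj-σ = contract-conj ι (Unfold.τ′ M I) (Unfold.τ′ N J) conj-τ′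
    ; conj-α = Iso.conj-α iso
    ; root = trans (fromH≡unlift N J (Unfold.τ′ N J ⟨$⟩ʳ 0F)) (trans (cong unlift (conj-τ′ 0F)) (trans (unlift-lift² ι (Unfold.τ′ M I ⟨$⟩ʳ 0F))
        (cong (Maybe.map (ι ⟨$⟩ʳ_)) (sym (fromH≡unlift M I (Unfold.τ′ M I ⟨$⟩ʳ 0F)))))) }

  iso₂ : Iso (Unfold.Λ₂ M I) (Unfold.Λ₂ N J) (lift² ι)
  iso₂ = record
    { conj-σ = λ x → trans (unfold-π N J _) (trans (UC.conj-π x) (cong (lift² ι ⟨$⟩ʳ_) (sym (unfold-π M I x))))
    ; conj-α = swap-conj ι {PreMap.α M} {PreMap.α N} (Iso.conj-α iso)
    ; root = refl }

-- The orientation Δ is equivariant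

Iso-motion : ∀ {M N ι} → Iso M N ι → {S : Subset (PreMap.size M)} {T : Subset (PreMap.size N)} → ι preserves S ⇒ T →
  ∀ h → motion N T (ι ⟨$⟩ʳ h) ≡ ι ⟨$⟩ʳ motion M S h
Iso-motion {M} {N} {ι} iso {S} {T} (to , to∉) h with h ∈? S | ι ⟨$⟩ʳ h ∈? T
... | yes _  | yes _  = trans (cong (PreMap.σ N ⟨$⟩ʳ_) (Iso.conj-α iso h)) (Iso.conj-σ iso _)
... | no _   | no _   = Iso.conj-σ iso h
... | yes h∈ | no ∉   = ⊥-elim (∉ (to h∈))
... | no h∉  | yes ∈T = ⊥-elim (to∉ h∉ ∈T)

iterate-conj : {A B : Set} {f : A → A} {g : B → B} (ι : A → B) → (∀ a → g (ι a) ≡ ι (f a)) →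
  ∀ a k → iterate g (ι a) k ≡ ι (iterate f a k)
iterate-conj ι c a zero = refl
iterate-conj {f = f} {g} ι c a (suc k) = trans (cong (λ b → iterate g b k) (c a)) (iterate-conj ι c (f a) k)

Iso-Precedes : ∀ {M N ι} → Iso M N ι → {S : Subset (PreMap.size M)} {T : Subset (PreMap.size N)} → ι preserves S ⇒ T →
  ∀ {a b} → Precedes M S a b → Precedes N T (ι ⟨$⟩ʳ a) (ι ⟨$⟩ʳ b)
Iso-Precedes {M} {N} {ι} iso {S} {T} pres p = let (r , root≡ , j , k , j<k , vj , vk) = Any⇒just p in
  just⇒Any (trans (Iso.root iso) (cong (Maybe.map (ι ⟨$⟩ʳ_)) root≡))
    ( Fin.cast (↔⇒≡ ι) j , Fin.cast (↔⇒≡ ι) k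
    , subst₂ _<_ (sym (Finₚ.toℕ-cast (↔⇒≡ ι) j)) (sym (Finₚ.toℕ-cast (↔⇒≡ ι) k)) j<k
    , visit j vj , visit k vk )
  where
  visit : ∀ {r a} j → iterate (motion M S) r (toℕ j) ≡ a →
    iterate (motion N T) (ι ⟨$⟩ʳ r) (toℕ (Fin.cast (↔⇒≡ ι) j)) ≡ ι ⟨$⟩ʳ a
  visit {r} j eq = trans (cong (iterate (motion N T) (ι ⟨$⟩ʳ r)) (Finₚ.toℕ-cast (↔⇒≡ ι) j))
    (trans (iterate-conj (ι ⟨$⟩ʳ_) (Iso-motion iso pres) r (toℕ j)) (cong (ι ⟨$⟩ʳ_) eq))

Iso-Δ : ∀ {M N ι} → Iso M N ι → {S : Subset (PreMap.size M)} {T : Subset (PreMap.size N)} → ι preserves S ⇒ T →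
  ∀ {h} → h ∈ Δ M S → ι ⟨$⟩ʳ h ∈ Δ N T
Iso-Δ {M} {N} {ι} iso {S} {T} pres {h} h∈ = ∈-comprehension⁺ (Δ? N T) (case ∈-comprehension⁻ (Δ? M S) h∈ of λ where
    (inj₁ (h∈S , p)) → inj₁ (proj₁ pres h∈S , subst (λ x → Precedes N T x (ι ⟨$⟩ʳ h)) (sym (Iso.conj-α iso h)) (Iso-Precedes iso pres p))
    (inj₂ (h∉S , p)) → inj₂ (proj₂ pres h∉S , subst (Precedes N T (ι ⟨$⟩ʳ h)) (sym (Iso.conj-α iso h)) (Iso-Precedes iso pres p)))

preserves-sym : (ι : Permutation m n) {S : Subset m} {T : Subset n} → ι preserves S ⇒ T → flip ι preserves T ⇒ S
preserves-sym ι {S} {T} (to , to∉) =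
    (λ {x} x∈ → decidable-stable (_ ∈? S) λ ∉S → to∉ ∉S (subst (_∈ T) (sym (inverseʳ ι)) x∈))
  , (λ {x} x∉ ∈S → x∉ (subst (_∈ T) (inverseʳ ι) (to ∈S)))

Ψ-cong : ∀ {n g} {C D : CoveredMap n g} → C ≅ᶜ D → Ψ₁ C ≅ Ψ₁ D × Ψ₂ C ≅ Ψ₂ D
Ψ-cong {C = C} {D} (ι , i , s) = (ι , Iso⇒IsIso U.iso₁) , (lift² ι , Iso⇒IsIso U.iso₂)
  where
  iso = IsIso⇒Iso i
  pres : ι preserves CoveredMap.submap C ⇒ CoveredMap.submap D
  pres = ⇔⇒preserves ι s
  presΔ : ι preserves Δ (CoveredMap.map C) (CoveredMap.submap C) ⇒ Δ (CoveredMap.map D) (CoveredMap.submap D)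
  presΔ = Iso-Δ iso pres , λ {x} x∉ ιx∈ → x∉ (subst (_∈ Δ (CoveredMap.map C) (CoveredMap.submap C)) (inverseˡ ι)
    (Iso-Δ (Iso-sym iso) (preserves-sym ι pres) ιx∈))
  module U = UnfoldIso (CoveredMap.map C) (CoveredMap.map D) ι iso _ _ presΔ

-- A covered map is determined by its two images

-- Of the facts `x ∈ I`, `x ∈ S` and "the edge of x was met before x", any two decide the third.
-- Given I, the submap can therefore be read off while the tour is being made.
module _ {α σ θ : Permutation′ m} {S I : Subset m} {o : Fin m} (M : IsMotion α σ θ S I o) where
  open IsMotion M

  motion-I∧S⇒ : ∀ {x} → x ∈ I → x ∈ S → pos (α ⟨$⟩ʳ x) < pos x
  motion-I∧S⇒ x∈I x∈S = case ⇒ x∈I of λ where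
    (inj₁ (_ , lt))  → lt
    (inj₂ (x∉S , _)) → ⊥-elim (x∉S x∈S)

  motion-I∧<⇒ : ∀ {x} → x ∈ I → pos (α ⟨$⟩ʳ x) < pos x → x ∈ S
  motion-I∧<⇒ x∈I lt = case ⇒ x∈I of λ where
    (inj₁ (x∈S , _)) → x∈S
    (inj₂ (_ , gt))  → ⊥-elim (ℕ.<-asym lt gt)

  motion-O∧S⇒ : ∀ {x} → x ∉ I → x ∈ S → ¬ pos (α ⟨$⟩ʳ x) < pos x
  motion-O∧S⇒ x∉I x∈S lt = x∉I (⇐ (inj₁ (x∈S , lt)))

  motion-O∧¬S⇒ : ∀ {x} → x ∉ I → x ∉ S → pos (α ⟨$⟩ʳ x) < pos x
  motion-O∧¬S⇒ {x} x∉I x∉S with <-cmp (pos x) (pos (α ⟨$⟩ʳ x))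
  ... | tri< lt _ _ = ⊥-elim (x∉I (⇐ (inj₂ (x∉S , lt))))
  ... | tri≈ _ eq _ = ⊥-elim (fpf x (pos-inj (sym eq)))
  ... | tri> _ _ gt = gt

module Determined
  {α₁ σ₁ θ₁ : Permutation′ m} {S₁ I₁ : Subset m} {o₁ : Fin m} (M₁ : IsMotion α₁ σ₁ θ₁ S₁ I₁ o₁)
  {α₂ σ₂ θ₂ : Permutation′ n} {S₂ I₂ : Subset n} {o₂ : Fin n} (M₂ : IsMotion α₂ σ₂ θ₂ S₂ I₂ o₂)
  (ι : Permutation m n) (cα : Conj ι α₁ α₂) (ι-o : ι ⟨$⟩ʳ o₁ ≡ o₂) where
  private
    module M₁ = IsMotion M₁
    module M₂ = IsMotion M₂
    module A₁ = Arborescence M₁.arborescence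
    module A₂ = Arborescence M₂.arborescence
    module U₁ = Unfolding α₁ σ₁ I₁ M₁.orientation
    module U₂ = Unfolding α₂ σ₂ I₂ M₂.orientation

  -- The two tours are compared step by step. The next step depends on whether the current half-edge
  -- lies in S, hence on I and on whether its edge was already met, which is a fact about the common
  -- past.
  module Submap (cσ : Conj ι σ₁ σ₂) (pres : ι preserves I₁ ⇒ I₂) where

    Earlier : Fin m → Set
    Earlier x = (M₁.pos (α₁ ⟨$⟩ʳ x) < M₁.pos x → M₂.pos (α₂ ⟨$⟩ʳ (ι ⟨$⟩ʳ x)) < M₂.pos (ι ⟨$⟩ʳ x))
              × (M₂.pos (α₂ ⟨$⟩ʳ (ι ⟨$⟩ʳ x)) < M₂.pos (ι ⟨$⟩ʳ x) → M₁.pos (α₁ ⟨$⟩ʳ x) < M₁.pos x)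

    S-to : ∀ {x} → Earlier x → x ∈ S₁ → ι ⟨$⟩ʳ x ∈ S₂
    S-to {x} (to , from) x∈S = case x ∈? I₁ of λ where
      (yes x∈I) → motion-I∧<⇒ M₂ (proj₁ pres x∈I) (to (motion-I∧S⇒ M₁ x∈I x∈S))
      (no x∉I)  → decidable-stable (_ ∈? S₂) λ ιx∉S →
        motion-O∧S⇒ M₁ x∉I x∈S (from (motion-O∧¬S⇒ M₂ (proj₂ pres x∉I) ιx∉S))

    S-from : ∀ {x} → Earlier x → x ∉ S₁ → ι ⟨$⟩ʳ x ∉ S₂
    S-from {x} (to , from) x∉S ιx∈S = case x ∈? I₁ of λ where
      (yes x∈I) → x∉S (motion-I∧<⇒ M₁ x∈I (from (motion-I∧S⇒ M₂ (proj₁ pres x∈I) ιx∈S)))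
      (no x∉I)  → motion-O∧S⇒ M₂ (proj₂ pres x∉I) ιx∈S (to (motion-O∧¬S⇒ M₁ x∉I x∉S))

    θ-agree : ∀ {x} → Earlier x → θ₂ ⟨$⟩ʳ (ι ⟨$⟩ʳ x) ≡ ι ⟨$⟩ʳ (θ₁ ⟨$⟩ʳ x)
    θ-agree {x} e = case x ∈? S₁ of λ where
      (yes x∈) → trans (M₂.θ-∈ (S-to e x∈)) (trans (cong (σ₂ ⟨$⟩ʳ_) (cα x)) (trans (cσ _) (cong (ι ⟨$⟩ʳ_) (sym (M₁.θ-∈ x∈)))))
      (no x∉)  → trans (M₂.θ-∉ (S-from e x∉)) (trans (cσ x) (cong (ι ⟨$⟩ʳ_) (sym (M₁.θ-∉ x∉))))

    last₁≤last₂ : M₁.pos M₁.last ≤ M₂.pos M₂.last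
    last₁≤last₂ = ℕ.≤-reflexive (ℕ.suc-injective (trans M₁.pos-last (trans (↔⇒≡ ι) (sym M₂.pos-last))))

    visit-agree : ∀ k → k ≤ M₁.pos M₁.last → ∀ j → j ≤ k → M₂.visit j ≡ ι ⟨$⟩ʳ M₁.visit j
    visit-agree zero _ .zero z≤n = trans M₂.visit-zero (trans (sym ι-o) (cong (ι ⟨$⟩ʳ_) (sym M₁.visit-zero)))
    visit-agree (suc k) k<last j j≤ = case ℕ.m≤n⇒m<n∨m≡n j≤ of λ where
        (inj₁ j<)   → ih j (s≤s⁻¹ j<)
        (inj₂ refl) → trans (M₂.visit-suc k) (trans (cong (θ₂ ⟨$⟩ʳ_) (ih k ≤-refl))
          (trans (θ-agree earlier) (cong (ι ⟨$⟩ʳ_) (sym (M₁.visit-suc k)))))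
      where
      k≤last : k ≤ M₁.pos M₁.last
      k≤last = ℕ.<⇒≤ k<last
      ih : ∀ j → j ≤ k → M₂.visit j ≡ ι ⟨$⟩ʳ M₁.visit j
      ih = visit-agree k k≤last
      x = M₁.visit k
      pos₁ : M₁.pos x ≡ k
      pos₁ = M₁.pos-visit k k≤last
      pos₂ : M₂.pos (ι ⟨$⟩ʳ x) ≡ k
      pos₂ = trans (cong M₂.pos (sym (ih k ≤-refl))) (M₂.pos-visit k (≤-trans k≤last last₁≤last₂))
      -- A visit of the other half before time k belongs to the part where the tours agree, and `ih`
      -- carries it across in either direction.
      earlier : Earlier x
      earlier =
          (λ lt → let j = M₁.pos (α₁ ⟨$⟩ʳ x) ; j<k = subst (j <_) pos₁ lt in
            subst (M₂.pos (α₂ ⟨$⟩ʳ (ι ⟨$⟩ʳ x)) <_) (sym pos₂) (ℕ.≤-<-trans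
              (M₂.pos-min (trans (ih j (ℕ.<⇒≤ j<k)) (trans (cong (ι ⟨$⟩ʳ_) (M₁.visit-pos _)) (sym (cα x))))) j<k))
        , (λ lt → let j = M₂.pos (α₂ ⟨$⟩ʳ (ι ⟨$⟩ʳ x)) ; j<k = subst (j <_) pos₂ lt in
            subst (M₁.pos (α₁ ⟨$⟩ʳ x) <_) (sym pos₁) (ℕ.≤-<-trans
              (M₁.pos-min (perm-inj ι (trans (sym (ih j (ℕ.<⇒≤ j<k))) (trans (M₂.visit-pos _) (cα x))))) j<k))

    pos-agree : ∀ x → M₂.pos (ι ⟨$⟩ʳ x) ≡ M₁.pos x
    pos-agree x = trans (cong M₂.pos (sym eq)) (M₂.pos-visit _ (≤-trans (M₁.pos≤last x) last₁≤last₂))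
      where
      eq : M₂.visit (M₁.pos x) ≡ ι ⟨$⟩ʳ x
      eq = trans (visit-agree _ (M₁.pos≤last x) _ ≤-refl) (cong (ι ⟨$⟩ʳ_) (M₁.visit-pos x))

    preserves-S : ι preserves S₁ ⇒ S₂
    preserves-S = (λ {x} → S-to (earlier x)) , (λ {x} → S-from (earlier x))
      where
      earlier : ∀ x → Earlier x
      earlier x = subst₂ _<_ (sym eα) (sym (pos-agree x)) , subst₂ _<_ eα (pos-agree x)
        where
        eα : M₂.pos (α₂ ⟨$⟩ʳ (ι ⟨$⟩ʳ x)) ≡ M₁.pos (α₁ ⟨$⟩ʳ x)
        eα = trans (cong M₂.pos (cα x)) (pos-agree _)

  module _ (cτ : Conj ι U₁.τ U₂.τ) where

    -- Pulled back along ι, I₂ chooses at most one half-edge in each vertex of the first tree and at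
    -- least one on each edge; `orientation-unique` leaves no freedom.
    preserves-I : ι preserves I₁ ⇒ I₂
    preserves-I = to , λ {x} x∉ ιx∈ → A₂.∈⇒∉ ιx∈ (subst (_∈ I₂) (sym (cα x)) (to (A₁.∉⇒∈ x∉)))
      where
      to : ∀ {x} → x ∈ I₁ → ι ⟨$⟩ʳ x ∈ I₂
      to {x} = A₁.orientation-unique (λ x → ι ⟨$⟩ʳ x ∈ I₂) (λ x → _ ∈? I₂)
        (λ {x} ∉ → subst (_∈ I₂) (cα x) (A₂.∉⇒∈ ∉)) (subst (_∉ I₂) (sym ι-o) A₂.o∉I)
        (λ x∈ y∈ r → perm-inj ι (A₂.unique x∈ y∈ (Reach-conj (ι ⟨$⟩ʳ_) cτ r))) x

    module _ (κ : Permutation m n) (κα : Conj κ α₁ α₂) (κ-o : κ ⟨$⟩ʳ o₁ ≡ o₂) (κπ : Conj κ U₁.π U₂.π)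
      (κI : κ preserves I₁ ⇒ I₂) where

      conj-D : Conj ι U₁.D U₂.D
      conj-D = subst₂ (Conj ι) (sym U₁.D≡) (sym U₂.D≡) (Conj-restrict ι {I₁} {I₂} {α₁ · U₁.τ} {α₂ · U₂.τ} preserves-I
        (Conj-· ι {α₁} {U₁.τ} {α₂} {U₂.τ} cα cτ))

      κ-D : ∀ {x} → x ∈ I₁ → U₂.D ⟨$⟩ʳ (κ ⟨$⟩ʳ x) ≡ κ ⟨$⟩ʳ (U₁.D ⟨$⟩ʳ x)
      κ-D {x} x∈ = trans (cong (U₂.D ⟨$⟩ʳ_) κx) (U₂.D-F-F (proj₁ κI (U₁.D-closed x∈)))
        where
        y = U₁.D ⟨$⟩ʳ x
        κF : Conj κ U₁.F U₂.F
        κF = Conj-· κ {U₁.π} {α₁} {U₂.π} {α₂} κπ κα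
        κx : κ ⟨$⟩ʳ x ≡ U₂.F ⟨$⟩ʳ (U₂.F ⟨$⟩ʳ (κ ⟨$⟩ʳ y))
        κx = trans (cong (κ ⟨$⟩ʳ_) (perm-inj U₁.D (sym (U₁.D-F-F (U₁.D-closed x∈)))))
          (trans (sym (κF (U₁.F ⟨$⟩ʳ y))) (cong (U₂.F ⟨$⟩ʳ_) (sym (κF y))))

      -- Both ι and κ intertwine the cyclic permutations D, and they agree at the root.
      ι≡κ-on-I : ∀ {x} → x ∈ I₁ → ι ⟨$⟩ʳ x ≡ κ ⟨$⟩ʳ x
      ι≡κ-on-I {x} x∈ = proj₂ (reach-closed U₁.D (λ x → x ∈ I₁ × ι ⟨$⟩ʳ x ≡ κ ⟨$⟩ʳ x)
        (λ (y∈ , eq) → U₁.D-closed y∈ , trans (sym (conj-D _)) (trans (cong (U₂.D ⟨$⟩ʳ_) eq) (κ-D y∈)))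
        (U₁.Reach-D i∈ x∈ (Connected-swap U₁.τ α₁ M₁.invol (λ y z → A₁.connected y ◅◅ reach-sym (U₁.τ · α₁) (A₁.connected z)) _ x))
        (i∈ , trans (sym (cα o₁)) (trans (cong (α₂ ⟨$⟩ʳ_) (trans ι-o (sym κ-o))) (κα o₁))))
        where
        i∈ : α₁ ⟨$⟩ʳ o₁ ∈ I₁
        i∈ = A₁.∉⇒∈ A₁.o∉I

      ι≡κ : ∀ x → ι ⟨$⟩ʳ x ≡ κ ⟨$⟩ʳ x
      ι≡κ x = case x ∈? I₁ of λ where
        (yes x∈) → ι≡κ-on-I x∈
        (no x∉)  → perm-inj α₂ (trans (cα x) (trans (ι≡κ-on-I (A₁.∉⇒∈ x∉)) (sym (κα x))))

      conj-π∘ : Conj ι U₁.π∘ U₂.π∘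
      conj-π∘ x = case x ∈? I₁ of λ where
        (yes x∈) → trans (sym (U₂.π-∈ (proj₁ preserves-I x∈))) (trans (cong (U₂.π ⟨$⟩ʳ_) (ι≡κ x)) (trans (κπ x)
          (trans (sym (ι≡κ _)) (cong (ι ⟨$⟩ʳ_) (U₁.π-∈ x∈)))))
        (no x∉)  → trans (U₂.π∘-fix (proj₂ preserves-I x∉)) (cong (ι ⟨$⟩ʳ_) (sym (U₁.π∘-fix x∉)))

      -- `σ = τ · π∘`, where τ is controlled by the isomorphism of trees and `π∘` by that of
      -- mobiles, now that the two bijections coincide.
      conj-σ : Conj ι σ₁ σ₂
      conj-σ x = trans (sym (U₂.τ-π∘ _)) (trans (cong (U₂.τ ⟨$⟩ʳ_) (conj-π∘ x)) (trans (cτ _) (cong (ι ⟨$⟩ʳ_) (U₁.τ-π∘ x))))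

      preserves-S : ι preserves S₁ ⇒ S₂
      preserves-S = Submap.preserves-S conj-σ preserves-I

extends-conj⁻ : (ι : Permutation m n) {π : Permutation′ m} {π′ : Permutation′ (2+ m)} {ρ : Permutation′ n}
  {ρ′ : Permutation′ (2+ n)} → Extends π π′ → Extends ρ ρ′ → Conj (lift² ι) π′ ρ′ → Conj ι π ρ
extends-conj⁻ ι ext ext′ c h = ⁺-injective (Ret-deterministic (ext′ (ι ⟨$⟩ʳ h))
  (Ret-conj (lift² ι ⟨$⟩ʳ_) (lift²-H⁺ ι) (lift²-∉H⁺ ι) c (ext h)))

lift²-root : (ι : Permutation m n) {x : Fin (2+ m)} {y : Fin (2+ n)} → x ≢ 1F → y ≢ 1F →
  unlift y ≡ Maybe.map (ι ⟨$⟩ʳ_) (unlift x) → y ≡ lift² ι ⟨$⟩ʳ x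
lift²-root ι {x = 1F} x≢ y≢ eq = ⊥-elim (x≢ refl)
lift²-root ι {x = 0F} {1F} x≢ y≢ eq = ⊥-elim (y≢ refl)
lift²-root ι {x = 0F} {0F} x≢ y≢ eq = refl
lift²-root ι {x = suc (suc h)} {1F} x≢ y≢ eq = ⊥-elim (y≢ refl)
lift²-root ι {x = suc (suc h)} {suc (suc k)} x≢ y≢ refl = refl

rooted-conj : (ι : Permutation m n) {π : Permutation′ m} {π′ : Permutation′ (2+ m)} {ρ : Permutation′ n}
  {ρ′ : Permutation′ (2+ n)} → Extends π π′ → π′ ⟨$⟩ʳ 1F ≡ 1F → Extends ρ ρ′ → ρ′ ⟨$⟩ʳ 1F ≡ 1F → Conj ι π ρ →
  unlift (ρ′ ⟨$⟩ʳ 0F) ≡ Maybe.map (ι ⟨$⟩ʳ_) (unlift (π′ ⟨$⟩ʳ 0F)) → Conj (lift² ι) π′ ρ′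
rooted-conj ι {π} {π′} {ρ} {ρ′} ext fix ext′ fix′ c eq = extension-conj ι {π} {π′} {ρ} {ρ′} ext fix ext′ fix′ c
  (lift²-root ι (λ e → case perm-inj π′ (trans e (sym fix)) of λ ()) (λ e → case perm-inj ρ′ (trans e (sym fix′)) of λ ()) eq)

-- The pullback of W along ι is a proper colouring of M that agrees with V at r.
Iso-colouring : ∀ {M N ι} → Iso M N ι → Connected (PreMap.φ M) →
  {V : Subset (PreMap.size M)} {W : Subset (PreMap.size N)} → IsProperColouring M V → IsProperColouring N W →
  ∀ {r} → r ∈ V → ι ⟨$⟩ʳ r ∈ W → ι preserves V ⇒ W
Iso-colouring {M} {N} {ι} iso conn {V} {W} colV colW {r} r∈V ιr∈W =
    (λ x∈ → ∈-comprehension⁻ W? (colouring-unique M conn colV colP r∈V (∈-comprehension⁺ W? ιr∈W) x∈))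
  , (λ x∉ ιx∈ → x∉ (colouring-unique M conn colP colV (∈-comprehension⁺ W? ιr∈W) r∈V (∈-comprehension⁺ W? ιx∈)))
  where
  W? : Decidable (λ x → ι ⟨$⟩ʳ x ∈ W)
  W? x = ι ⟨$⟩ʳ x ∈? W
  module W = IsProperColouring colW
  colP : IsProperColouring M (comprehension W?)
  colP = record
    { vertexwise = λ h → mk⇔
        (λ σh∈ → ∈-comprehension⁺ W? (Equivalence.to (W.vertexwise _)
          (subst (_∈ W) (sym (Iso.conj-σ iso h)) (∈-comprehension⁻ W? σh∈))))
        (λ h∈ → ∈-comprehension⁺ W? (subst (_∈ W) (Iso.conj-σ iso h)
          (Equivalence.from (W.vertexwise _) (∈-comprehension⁻ W? h∈))))
    ; proper = λ h → mk⇔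
        (λ αh∈ h∈ → Equivalence.to (W.proper _)
          (subst (_∈ W) (sym (Iso.conj-α iso h)) (∈-comprehension⁻ W? αh∈)) (∈-comprehension⁻ W? h∈))
        (λ h∉ → ∈-comprehension⁺ W? (subst (_∈ W) (Iso.conj-α iso h)
          (Equivalence.from (W.proper _) λ ιh∈ → h∉ (∈-comprehension⁺ W? ιh∈)))) }

-- The isomorphism of trees is extended to i and o by fixing them; the isomorphism of mobiles fixes
-- the root i, and hence also its partner o.
module Injectivity (X : Unfolded m) (Y : Unfolded n) (ι : Permutation m n) (isoA : Iso (Unfolded.A X) (Unfolded.A Y) ι)
  (κ : Permutation (2+ m) (2+ n)) (isoB : Iso (Unfolded.B X) (Unfolded.B Y) κ) where
  private
    module X = Unfolded X
    module Y = Unfolded Y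
    module D = Determined X.motion′ Y.motion′ (lift² ι) (swap⁺-conj ι {X.α} {Y.α} (Iso.conj-α isoA)) refl

    fix : (Z : Unfolded l) → Unfolded.τ′ Z ⟨$⟩ʳ 1F ≡ 1F
    fix Z = subst (λ τ → τ ⟨$⟩ʳ 1F ≡ 1F) (Unfolded.τ≡τ′ Z) (Arborescence.τ-o (IsMotion.arborescence (Unfolded.motion′ Z)))

    cτ : Conj (lift² ι) (UnfoldedPermutations.τ (swap⁺ X.α) X.σ′ X.I′) (UnfoldedPermutations.τ (swap⁺ Y.α) Y.σ′ Y.I′)
    cτ = subst₂ (Conj (lift² ι)) (sym X.τ≡τ′) (sym Y.τ≡τ′)
      (rooted-conj ι {X.τᴬ} {X.τ′} {Y.τᴬ} {Y.τ′} X.extᴬ (fix X) Y.extᴬ (fix Y) (Iso.conj-σ isoA)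
        (trans (sym Y.rootᴬ≡) (trans (Iso.root isoA) (cong (Maybe.map (ι ⟨$⟩ʳ_)) X.rootᴬ≡))))

    κπ : Conj κ (UnfoldedPermutations.π (swap⁺ X.α) X.σ′ X.I′) (UnfoldedPermutations.π (swap⁺ Y.α) Y.σ′ Y.I′)
    κπ x = trans (sym (Y.ρ≡ _)) (trans (Iso.conj-σ isoB x) (cong (κ ⟨$⟩ʳ_) (X.ρ≡ x)))

    κα : Conj κ (swap⁺ X.α) (swap⁺ Y.α)
    κα = subst₂ (Conj κ) (sym (swap⁺≡ X.α)) (sym (swap⁺≡ Y.α)) (Iso.conj-α isoB)

    κ-0 : κ ⟨$⟩ʳ 0F ≡ 0F
    κ-0 = sym (just-injective (Iso.root isoB))

    κ-1 : κ ⟨$⟩ʳ 1F ≡ 1F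
    κ-1 = trans (cong (κ ⟨$⟩ʳ_) (sym (swap⁺-0 X.α))) (trans (sym (κα 0F)) (trans (cong (swap⁺ Y.α ⟨$⟩ʳ_) κ-0) (swap⁺-0 Y.α)))

    κI : κ preserves X.I′ ⇒ Y.I′
    κI = Iso-colouring isoB X.connected X.colouring Y.colouring X.0∈I′ (subst (_∈ Y.I′) (sym κ-0) Y.0∈I′)

    conj-σ′ : Conj (lift² ι) X.σ′ Y.σ′
    conj-σ′ = D.conj-σ cτ κ κα κ-1 κπ κI

  isoM : Iso X.M Y.M ι
  isoM = record
    { conj-σ = extends-conj⁻ ι {X.σ} {X.σ′} {Y.σ} {Y.σ′} X.ext Y.ext conj-σ′
    ; conj-α = Iso.conj-α isoA
    ; root = trans (sym Y.σ′-0) (trans (cong unlift (conj-σ′ 0F)) (trans (unlift-lift² ι _)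
        (cong (Maybe.map (ι ⟨$⟩ʳ_)) X.σ′-0))) }

  preserves-S : lift² ι preserves X.S′ ⇒ Y.S′
  preserves-S = D.preserves-S cτ κ κα κ-1 κπ κI

Ψ-injective : ∀ {n g} {C D : CoveredMap n g} → Ψ₁ C ≅ Ψ₁ D → Ψ₂ C ≅ Ψ₂ D → C ≅ᶜ D
Ψ-injective {C = C} {D} (ι , iA) (κ , iB) = ι , Iso⇒IsIso J.isoM , λ h → mk⇔
    (λ h∈ → case proj₁ J.preserves-S {suc (suc h)} (there (there h∈)) of λ { (there (there p)) → p })
    (λ ιh∈ → decidable-stable (h ∈? CoveredMap.submap C) λ h∉ →
      proj₂ J.preserves-S {suc (suc h)} (λ { (there (there p)) → h∉ p }) (there (there ιh∈)))
  where
  module J = Injectivity (unfoldedMap C) (unfoldedMap D) ι (IsIso⇒Iso iA) κ (IsIso⇒Iso iB)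

-- Matching two cyclic permutations

module Matching (π₁ : Permutation′ m) (s₁ : Fin m) (reach₁ : ∀ x → Reach π₁ s₁ x)
  (π₂ : Permutation′ n) (s₂ : Fin n) (reach₂ : ∀ x → Reach π₂ s₂ x) (m≡n : m ≡ n) where
  private
    module T₁ = Tour π₁ s₁ reach₁
    module T₂ = Tour π₂ s₂ reach₂

    last≡ : T₁.pos T₁.last ≡ T₂.pos T₂.last
    last≡ = ℕ.suc-injective (trans T₁.pos-last (trans m≡n (sym T₂.pos-last)))

    to : Fin m → Fin n
    to x = T₂.visit (T₁.pos x)

    from : Fin n → Fin m
    from y = T₁.visit (T₂.pos y)

    to-from : ∀ y → to (from y) ≡ y
    to-from y = trans (cong T₂.visit (T₁.pos-visit _ (subst (T₂.pos y ≤_) (sym last≡) (T₂.pos≤last y)))) (T₂.visit-pos y)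

    from-to : ∀ x → from (to x) ≡ x
    from-to x = trans (cong T₁.visit (T₂.pos-visit _ (subst (T₁.pos x ≤_) last≡ (T₁.pos≤last x)))) (T₁.visit-pos x)

  abstract
    matching : Permutation m n
    matching = permutation to from to-from from-to

    matching-start : matching ⟨$⟩ʳ s₁ ≡ s₂
    matching-start = trans (cong T₂.visit T₁.pos-start) T₂.visit-zero

    matching-conj : Conj matching π₁ π₂
    matching-conj x = case π₁ ⟨$⟩ʳ x ≟ s₁ of λ where
      (no ≢s)  → sym (trans (cong T₂.visit (T₁.pos-suc ≢s)) (T₂.visit-suc _))
      (yes ≡s) → trans (sym (T₂.visit-suc _)) (trans (cong (T₂.visit ∘ suc) (trans (cong T₁.pos (T₁.last-unique ≡s)) last≡))
        (trans T₂.visit-suc-last (sym (trans (cong (T₂.visit ∘ T₁.pos) ≡s) matching-start))))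

-- Recovering the motion from σ and the orientation

-- The walk leaves an edge by σ of its ingoing half-edge at the first visit, and by σ of its outgoing
-- half-edge at the second one.
module Walk (α σ : Permutation′ m) (I : Subset m) (orient : IsOrientation α I) (fpf : ∀ x → α ⟨$⟩ʳ x ≢ x) (o : Fin m)
  (σ-o : σ ⟨$⟩ʳ o ≡ o) (o∉I : o ∉ I) (rk : Fin m → ℕ) (K : ℕ) (rk≤ : ∀ x → rk x ≤ K)
  (rk-α : ∀ x → rk (α ⟨$⟩ʳ x) ≡ rk x) (up : ∀ {x} → x ∉ I → x ≢ o → rk x < rk (σ ⟨$⟩ʳ x)) where
  open IsOrientation orient

  -- The submap is not known yet, so the history alone decides the turn. The last index is the
  -- half-edge to which σ will be applied.
  data Turn (x : Fin m) (h : List (Fin m)) : Fin m → Set where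
    open-I  : x ∈ I → α ⟨$⟩ʳ x ∉ˡ h → Turn x h x
    open-O  : x ∉ I → α ⟨$⟩ʳ x ∉ˡ h → Turn x h (α ⟨$⟩ʳ x)
    close-I : x ∈ I → α ⟨$⟩ʳ x ∈ˡ h → Turn x h (α ⟨$⟩ʳ x)
    close-O : x ∉ I → α ⟨$⟩ʳ x ∈ˡ h → Turn x h x

  turn : ∀ x h → ∃[ y ] Turn x h y
  turn x h with x ∈? I | mem? _≟_ (α ⟨$⟩ʳ x) h
  ... | yes x∈ | yes c = _ , close-I x∈ c
  ... | yes x∈ | no ¬c = _ , open-I x∈ ¬c
  ... | no x∉  | yes c = _ , close-O x∉ c
  ... | no x∉  | no ¬c = _ , open-O x∉ ¬c

  mutual
    cur : ℕ → Fin m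
    cur zero    = o
    cur (suc k) = σ ⟨$⟩ʳ exit k

    hist : ℕ → List (Fin m)
    hist zero    = []
    hist (suc k) = cur k ∷ hist k

    exit : ℕ → Fin m
    exit k = proj₁ (turn (cur k) (hist k))

  exit-Turn : ∀ k → Turn (cur k) (hist k) (exit k)
  exit-Turn k = proj₂ (turn (cur k) (hist k))

  ∈hist⇒ : ∀ k {x} → x ∈ˡ hist k → ∃[ j ] j < k × cur j ≡ x
  ∈hist⇒ (suc k) (here refl) = k , ≤-refl , refl
  ∈hist⇒ (suc k) (there x∈) with j , j<k , eq ← ∈hist⇒ k x∈ = j , ℕ.m≤n⇒m≤1+n j<k , eq

  ⇒∈hist : ∀ k {j} → j < k → cur j ∈ˡ hist k
  ⇒∈hist (suc k) {j} (s≤s j≤k) with ℕ.m≤n⇒m<n∨m≡n j≤k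
  ... | inj₁ j<k  = there (⇒∈hist k j<k)
  ... | inj₂ refl = here refl

  i : Fin m
  i = α ⟨$⟩ʳ o

  Closes Opens : ℕ → Set
  Closes k = α ⟨$⟩ʳ cur k ∈ˡ hist k × exit k ∉ I
  Opens k  = α ⟨$⟩ʳ cur k ∉ˡ hist k × exit k ∈ I

  closes-or-opens : ∀ k → Closes k ⊎ Opens k
  closes-or-opens k with exit k | exit-Turn k
  ... | _ | open-I x∈ ¬c = inj₂ (¬c , x∈)
  ... | _ | open-O x∉ ¬c = inj₂ (¬c , ∉⇒∈ x∉)
  ... | _ | close-I x∈ c = inj₁ (c , ∈⇒∉ x∈)
  ... | _ | close-O x∉ c = inj₁ (c , x∉)

  exit-edge : ∀ k → exit k ≡ cur k ⊎ exit k ≡ α ⟨$⟩ʳ cur k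
  exit-edge k with exit k | exit-Turn k
  ... | _ | open-I _ _  = inj₁ refl
  ... | _ | open-O _ _  = inj₂ refl
  ... | _ | close-I _ _ = inj₂ refl
  ... | _ | close-O _ _ = inj₁ refl

  same-edge : ∀ {x y z} → z ≡ x ⊎ z ≡ α ⟨$⟩ʳ x → z ≡ y ⊎ z ≡ α ⟨$⟩ʳ y → x ≡ y ⊎ x ≡ α ⟨$⟩ʳ y
  same-edge (inj₁ refl) e           = e
  same-edge (inj₂ refl) (inj₁ refl) = inj₂ (sym (involutive _))
  same-edge (inj₂ refl) (inj₂ eq)   = inj₁ (perm-inj α eq)

  edge-trans : ∀ {x y z} → x ≡ y ⊎ x ≡ α ⟨$⟩ʳ y → y ≡ z ⊎ y ≡ α ⟨$⟩ʳ z → x ≡ z ⊎ x ≡ α ⟨$⟩ʳ z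
  edge-trans (inj₁ refl) e           = e
  edge-trans (inj₂ refl) (inj₁ refl) = inj₂ refl
  edge-trans (inj₂ refl) (inj₂ refl) = inj₁ (involutive _)

  -- σ is injective, so a repeated half-edge comes from a repeated exit, hence from one edge. An
  -- edge is left once by its ingoing half, when opened, and once by its outgoing half, when closed;
  -- repeating either exit would need an earlier repetition. Coming back to o would mean closing {i,
  -- o}, that is, having reached i.
  distinct : ∀ k → (∀ j → j < k → cur j ≢ i) → ∀ j → j < k → cur j ≢ cur k
  distinct (suc k) ≢i zero _ o≡ = case closes-or-opens k of λ where
      (inj₂ (_ , exit∈)) → o∉I (subst (_∈ I) exit≡o exit∈)
      (inj₁ (c , _)) → case same-edge (exit-edge k) (inj₁ exit≡o) of λ where
        (inj₂ cur≡i) → ≢i k ≤-refl cur≡i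
        (inj₁ cur≡o) → case ∈hist⇒ k c of λ where
          (j , j<k , _) → distinct k (λ j j<k → ≢i j (ℕ.m<n⇒m<1+n j<k)) 0 (ℕ.≤-<-trans z≤n j<k) (sym cur≡o)
    where
    exit≡o : exit k ≡ o
    exit≡o = perm-inj σ (trans (sym o≡) (sym σ-o))
  distinct (suc k) ≢i (suc j) (s≤s j<k) eq = case same-edge (exit-edge k) (subst (λ z → z ≡ cur j ⊎ z ≡ α ⟨$⟩ʳ cur j) exit≡ (exit-edge j)) of λ where
      (inj₁ k≡j)  → ih j j<k (sym k≡j)
      (inj₂ k≡αj) → case closes-or-opens j of λ where
        (inj₁ (c , _)) → case ∈hist⇒ j c of λ where
          (l , l<j , l≡) → ih l (ℕ.<-trans l<j j<k) (trans l≡ (sym k≡αj))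
        (inj₂ (_ , exit∈)) → case closes-or-opens k of λ where
          (inj₁ (_ , exit∉)) → exit∉ (subst (_∈ I) exit≡ exit∈)
          (inj₂ (¬c , _)) → ¬c (subst (_∈ˡ hist k) (trans (sym (involutive _)) (cong (α ⟨$⟩ʳ_) (sym k≡αj))) (⇒∈hist k j<k))
    where
    ih = distinct k (λ j j<k → ≢i j (ℕ.m<n⇒m<1+n j<k))
    exit≡ : exit j ≡ exit k
    exit≡ = perm-inj σ eq

  abstract
    -- A walk that avoided i would have m + 1 distinct positions.
    stops : ∃[ k ] cur k ≡ i × (∀ {j} → cur j ≡ i → k ≤ j)
    stops = case any? (λ (k : Fin (suc m)) → cur (toℕ k) ≟ i) of λ where
      (yes (k , eq)) → least (λ k → cur k ≟ i) (toℕ k) eq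
      (no never) → case pigeonhole (ℕ.n<1+n m) (λ (k : Fin (suc m)) → cur (toℕ k)) of λ where
        (j , k , j<k , eq) → ⊥-elim (distinct (toℕ k) (λ l l<k l≡ → never
          ( fromℕ< (ℕ.<-trans l<k (toℕ<n k))
          , trans (cong cur (toℕ-fromℕ< (ℕ.<-trans l<k (toℕ<n k)))) l≡)) (toℕ j) j<k eq)

  N : ℕ
  N = proj₁ stops

  cur-inj : ∀ {j k} → j ≤ N → k ≤ N → cur j ≡ cur k → j ≡ k
  cur-inj {j} {k} j≤ k≤ eq with <-cmp j k
  ... | tri< j<k _ _ = ⊥-elim (distinct k (λ l l<k l≡ → ℕ.<⇒≱ l<k (≤-trans k≤ (proj₂ (proj₂ stops) l≡))) j j<k eq)
  ... | tri≈ _ j≡k _ = j≡k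
  ... | tri> _ _ k<j = ⊥-elim (distinct j (λ l l<j l≡ → ℕ.<⇒≱ l<j (≤-trans j≤ (proj₂ (proj₂ stops) l≡))) k k<j (sym eq))

  Visited : Fin m → Set
  Visited x = ∃[ t ] t ≤ N × cur t ≡ x

  visited-edge : ∀ {t x} → t ≤ N → α ⟨$⟩ʳ cur t ∈ˡ hist t → x ≡ cur t ⊎ x ≡ α ⟨$⟩ʳ cur t → Visited x
  visited-edge {t} t≤ c (inj₁ refl) = t , t≤ , refl
  visited-edge {t} t≤ c (inj₂ refl) with j , j<t , eq ← ∈hist⇒ t c = j , ≤-trans (ℕ.<⇒≤ j<t) t≤ , eq

  out-half : ∀ x → ∃[ y ] y ∉ I × (x ≡ y ⊎ x ≡ α ⟨$⟩ʳ y) × rk y ≡ rk x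
  out-half x = case x ∈? I of λ where
    (no x∉)  → x , x∉ , inj₁ refl , refl
    (yes x∈) → α ⟨$⟩ʳ x , ∈⇒∉ x∈ , inj₂ (sym (involutive x)) , rk-α x

  open Ascent rk K rk≤ using (ascend)

  abstract
    visited : ∀ x → Visited x
    visited = ascend Visited λ x ih → let (y , y∉ , x∼y , rk≡) = out-half x in case y ≟ o of λ where
      (yes y≡o) → case x∼y of λ where
        (inj₁ x≡y)  → 0 , z≤n , sym (trans x≡y y≡o)
        (inj₂ x≡αy) → N , ≤-refl , trans (proj₁ (proj₂ stops)) (sym (trans x≡αy (cong (α ⟨$⟩ʳ_) y≡o)))
      (no y≢o) → case ih (σ ⟨$⟩ʳ y) (subst (_< rk (σ ⟨$⟩ʳ y)) rk≡ (up y∉ y≢o)) of λ where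
        (zero , _ , eq)   → ⊥-elim (y≢o (sym (perm-inj σ (trans σ-o eq))))
        -- `σ y` is entered through the exit y, which is outgoing; so its edge was being closed at
        -- time t, and both halves have been visited.
        (suc t , t< , eq) → case closes-or-opens t of λ where
          (inj₂ (_ , exit∈)) → ⊥-elim (y∉ (subst (_∈ I) (perm-inj σ eq) exit∈))
          (inj₁ (c , _)) → visited-edge (ℕ.<⇒≤ t<) c
            (edge-trans x∼y (subst (λ z → z ≡ cur t ⊎ z ≡ α ⟨$⟩ʳ cur t) (perm-inj σ eq) (exit-edge t)))

  time : Fin m → ℕ
  time x = proj₁ (visited x)

  time≤ : ∀ x → time x ≤ N
  time≤ x = proj₁ (proj₂ (visited x))

  cur-time : ∀ x → cur (time x) ≡ x
  cur-time x = proj₂ (proj₂ (visited x))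

  time-cur : ∀ {t} → t ≤ N → time (cur t) ≡ t
  time-cur t≤ = cur-inj (time≤ _) t≤ (cur-time _)

  time-inj : ∀ {x y} → time x ≡ time y → x ≡ y
  time-inj {x} {y} eq = trans (sym (cur-time x)) (trans (cong cur eq) (cur-time y))

  -- `Ingoing` with S and I exchanged: the relation between the two sets is symmetric, so S is
  -- recovered from I by the formula that gives I from S.
  Ingoing∈ : Fin m → Set
  Ingoing∈ x = (x ∈ I × time (α ⟨$⟩ʳ x) < time x) ⊎ (x ∉ I × time x < time (α ⟨$⟩ʳ x))

  private
    S? : Decidable Ingoing∈
    S? x = ((x ∈? I) ×-dec (time (α ⟨$⟩ʳ x) ℕ.<? time x)) ⊎-dec (¬? (x ∈? I) ×-dec (time x ℕ.<? time (α ⟨$⟩ʳ x)))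

  S : Subset m
  S = comprehension S?

  stable : Closed S α
  stable {x} x∈ = ∈-comprehension⁺ S? (case ∈-comprehension⁻ S? x∈ of λ where
    (inj₁ (x∈I , lt)) → inj₂ (∈⇒∉ x∈I , subst (λ y → time (α ⟨$⟩ʳ x) < time y) (sym (involutive x)) lt)
    (inj₂ (x∉I , lt)) → inj₁ (∉⇒∈ x∉I , subst (λ y → time y < time (α ⟨$⟩ʳ x)) (sym (involutive x)) lt))

  θ : Permutation′ m
  θ = σ · restrict S α

  closing : ∀ {t} → t ≤ N → α ⟨$⟩ʳ cur t ∈ˡ hist t → time (α ⟨$⟩ʳ cur t) < time (cur t)
  closing {t} t≤ c with j , j<t , eq ← ∈hist⇒ t c
    = subst₂ _<_ (trans (sym (time-cur (≤-trans (ℕ.<⇒≤ j<t) t≤))) (cong time eq)) (sym (time-cur t≤)) j<t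

  opening : ∀ {t} → t ≤ N → α ⟨$⟩ʳ cur t ∉ˡ hist t → time (cur t) < time (α ⟨$⟩ʳ cur t)
  opening {t} t≤ ¬c with <-cmp (time (cur t)) (time (α ⟨$⟩ʳ cur t))
  ... | tri< lt _ _ = lt
  ... | tri≈ _ eq _ = ⊥-elim (fpf (cur t) (sym (time-inj eq)))
  ... | tri> _ _ gt = ⊥-elim (¬c (subst (_∈ˡ hist t) (cur-time _) (⇒∈hist t (subst (time (α ⟨$⟩ʳ cur t) <_) (time-cur t≤) gt))))

  -- Membership in S says precisely that the walk passes to the other half of the edge: it opens
  -- from the outgoing half or closes from the ingoing one.
  restrict-cur : ∀ {t} → t ≤ N → restrict S α ⟨$⟩ʳ cur t ≡ exit t
  restrict-cur {t} t≤ with exit t | exit-Turn t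
  ... | _ | open-I x∈ ¬c = restrict-∉ S α λ ∈S → case ∈-comprehension⁻ S? ∈S of λ where
          (inj₁ (_ , lt)) → ℕ.<-asym lt (opening t≤ ¬c)
          (inj₂ (x∉ , _)) → x∉ x∈
  ... | _ | close-O x∉ c = restrict-∉ S α λ ∈S → case ∈-comprehension⁻ S? ∈S of λ where
          (inj₁ (x∈ , _)) → x∉ x∈
          (inj₂ (_ , lt)) → ℕ.<-asym lt (closing t≤ c)
  ... | _ | open-O x∉ ¬c = let ∈S = ∈-comprehension⁺ S? (inj₂ (x∉ , opening t≤ ¬c)) in restrict-stable S α ∈S (stable ∈S)
  ... | _ | close-I x∈ c = let ∈S = ∈-comprehension⁺ S? (inj₁ (x∈ , closing t≤ c)) in restrict-stable S α ∈S (stable ∈S)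

  θ-cur : ∀ {t} → t ≤ N → θ ⟨$⟩ʳ cur t ≡ cur (suc t)
  θ-cur t≤ = cong (σ ⟨$⟩ʳ_) (restrict-cur t≤)

  reach-cur : ∀ t → t ≤ N → Reach θ o (cur t)
  reach-cur zero    _  = ε
  reach-cur (suc t) t< = reach-cur t (ℕ.<⇒≤ t<) ◅◅ θ-cur (ℕ.<⇒≤ t<) ◅ ε

  abstract
    reach : ∀ x → Reach θ o x
    reach x = subst (Reach θ o) (cur-time x) (reach-cur (time x) (time≤ x))

  open Tour θ o reach using (pos; visit; visit-zero; visit-suc; visit-pos; pos-min)

  visit-cur : ∀ t → t ≤ N → visit t ≡ cur t
  visit-cur zero    _  = visit-zero
  visit-cur (suc t) t< = trans (visit-suc t) (trans (cong (θ ⟨$⟩ʳ_) (visit-cur t (ℕ.<⇒≤ t<))) (θ-cur (ℕ.<⇒≤ t<)))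

  pos≡time : ∀ x → pos x ≡ time x
  pos≡time x = cur-inj pos≤N (time≤ x) (trans (sym (visit-cur _ pos≤N)) (trans (visit-pos x) (sym (cur-time x))))
    where
    pos≤N : pos x ≤ N
    pos≤N = ≤-trans (pos-min (trans (visit-cur _ (time≤ x)) (cur-time x))) (time≤ x)

  isMotion : IsMotion α σ θ S I o
  isMotion = record
    { invol = involutive ; fpf = fpf ; stable = stable ; σ-o = σ-o
    ; o∈S = ∈-comprehension⁺ S? (inj₂ (o∉I , subst (_< time (α ⟨$⟩ʳ o)) (sym (time-cur z≤n))
        (ℕ.n≢0⇒n>0 λ eq → fpf o (trans (sym (cur-time _)) (cong cur eq)))))
    ; θ-∈ = λ x∈ → cong (σ ⟨$⟩ʳ_) (restrict-stable S α x∈ (stable x∈))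
    ; θ-∉ = λ x∉ → cong (σ ⟨$⟩ʳ_) (restrict-∉ S α x∉)
    ; reach = reach
    ; ⇒ = λ {x} x∈ → case time (α ⟨$⟩ʳ x) ℕ.<? time x of λ where
        (yes lt) → inj₁ (∈-comprehension⁺ S? (inj₁ (x∈ , lt)) , subst₂ _<_ (sym (pos≡time _)) (sym (pos≡time _)) lt)
        (no ≮)   → inj₂ ((λ x∈S → case ∈-comprehension⁻ S? x∈S of λ where
            (inj₁ (_ , lt)) → ≮ lt
            (inj₂ (x∉ , _)) → x∉ x∈)
          , subst₂ _<_ (sym (pos≡time _)) (sym (pos≡time _)) (ℕ.≤∧≢⇒< (ℕ.≮⇒≥ ≮) λ eq → fpf x (time-inj (sym eq))))
    ; ⇐ = λ {x} → λ where
        (inj₁ (x∈S , lt)) → case ∈-comprehension⁻ S? x∈S of λ where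
          (inj₁ (x∈ , _))  → x∈
          (inj₂ (_ , lt′)) → ⊥-elim (ℕ.<-asym lt′ (subst₂ _<_ (pos≡time _) (pos≡time _) lt))
        (inj₂ (x∉S , lt)) → decidable-stable (x ∈? I) λ x∉ →
          x∉S (∈-comprehension⁺ S? (inj₂ (x∉ , subst₂ _<_ (pos≡time _) (pos≡time _) lt))) }

-- Orienting a plane tree towards its root

module TreeTour (α τ : Permutation′ m) (o : Fin m) (invol : ∀ x → α ⟨$⟩ʳ (α ⟨$⟩ʳ x) ≡ x) (fpf : ∀ x → α ⟨$⟩ʳ x ≢ x)
  (τ-o : τ ⟨$⟩ʳ o ≡ o) (reach : ∀ x → Reach (τ · α) o x) (V : Subset m) (V⇒ : ∀ {x} → x ∈ V → x ≢ o)
  (count : #cycles ⊤ α ≤ #cycles V τ) where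
  open Tour (τ · α) o reach

  last≡αo : last ≡ α ⟨$⟩ʳ o
  last≡αo = sym (last-unique (trans (cong (τ ⟨$⟩ʳ_) (invol o)) τ-o))

  private
    I? : Decidable (λ x → pos (α ⟨$⟩ʳ x) < pos x)
    I? x = pos (α ⟨$⟩ʳ x) ℕ.<? pos x

  I : Subset m
  I = comprehension I?

  first : ∀ {x} → x ∉ I → pos x < pos (α ⟨$⟩ʳ x)
  first {x} x∉ with <-cmp (pos x) (pos (α ⟨$⟩ʳ x))
  ... | tri< lt _ _ = lt
  ... | tri≈ _ eq _ = ⊥-elim (fpf x (pos-inj (sym eq)))
  ... | tri> _ _ gt = ⊥-elim (x∉ (∈-comprehension⁺ I? gt))

  orientation : IsOrientation α I
  orientation = record
    { involutive = invol
    ; ∈⇒∉ = λ {x} x∈ αx∈ → ℕ.<-asym (∈-comprehension⁻ I? x∈)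
        (subst (λ y → pos y < pos (α ⟨$⟩ʳ x)) (invol x) (∈-comprehension⁻ I? αx∈))
    ; ∉⇒∈ = λ {x} x∉ → ∈-comprehension⁺ I? (subst (λ y → pos y < pos (α ⟨$⟩ʳ x)) (sym (invol x)) (first x∉)) }

  o∉I : o ∉ I
  o∉I o∈ = ℕ.n≮0 (subst (pos (α ⟨$⟩ʳ o) <_) pos-start (∈-comprehension⁻ I? o∈))

  open EdgeRank α invol pos pos< public

  -- The second visit of the edge of an outgoing x is at `α x`, which the contour leaves towards
  -- `τ x`.
  up : ∀ {x} → x ∉ I → x ≢ o → rk x < rk (τ ⟨$⟩ʳ x)
  up {x} x∉ x≢o = ℕ.≤-trans (s≤s (ℕ.⊔-lub (ℕ.<⇒≤ (first x∉)) ≤-refl))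
    (≤-trans (ℕ.≤-reflexive (trans (sym (pos-suc λ eq → x≢o (perm-inj α (trans (last-unique eq) last≡αo))))
      (cong (λ y → pos (τ ⟨$⟩ʳ y)) (invol x)))) (ℕ.m≤m⊔n _ _))

  -- The tree has as many vertices as ingoing half-edges, and each vertex has at least one of them.
  unique : ∀ {x y} → x ∈ I → y ∈ I → Reach τ x y → x ≡ y
  unique {x} {y} x∈ y∈ r = case x ≟ y of λ where
      (yes eq) → eq
      -- Otherwise every vertex could be charged to an ingoing half-edge other than x, using y for
      -- the vertex of x, and one too few would be available.
      (no x≢y) → ⊥-elim (ℕ.<-irrefl refl (ℕ.≤-<-trans count (ℕ.<-≤-trans (ℕ.≤-<-trans
        (#cycles≤length V τ others (λ v z → z ∈ I × Reach τ v z) (toOthers x≢y) (λ _ _ (_ , s) (_ , s′) → s ◅◅ reach-sym τ s′))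
        (filter-notAll ≢x? (leaders I Perm.id) (AnyL.map (λ eq z≢x → z≢x (sym eq)) (∈-leaders I Perm.id x∈ (id-leader x)))))
        (ℕ.≤-reflexive (#ingoing orientation)))))
    where
    ≢x? : Decidable (λ z → z ≢ x)
    ≢x? z = ¬? (z ≟ x)
    others = filter ≢x? (leaders I Perm.id)
    ∈others : ∀ {z} → z ∈ I → z ≢ x → z ∈ˡ others
    ∈others z∈ z≢x = ∈-filter⁺ ≢x? (∈-leaders I Perm.id z∈ (id-leader _)) z≢x
    open Ascent rk m rk≤ using (sink)
    toOthers : x ≢ y → ∀ {v} → v ∈ V → ∃[ z ] z ∈ˡ others × z ∈ I × Reach τ v z
    toOthers x≢y {v} v∈ = case sink I τ o up v of λ where
      (inj₂ v⇝o) → ⊥-elim (V⇒ v∈ (sym (fixed-alone τ τ-o (reach-sym τ v⇝o))))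
      (inj₁ (z , z∈ , v⇝z , _)) → case z ≟ x of λ where
        (no z≢x)   → z , ∈others z∈ z≢x , z∈ , v⇝z
        (yes refl) → y , ∈others y∈ (λ y≡x → x≢y (sym y≡x)) , y∈ , v⇝z ◅◅ r

-- Gluing a tree and a mobile along their edges

Reach-flip : (π : Permutation′ m) {x y : Fin m} → Reach π x y → Reach (flip π) y x
Reach-flip π ε          = ε
Reach-flip π (refl ◅ r) = Reach-flip π r ◅◅ inverseˡ π ◅ ε

restrict-cong : (S : Subset m) (π ρ : Permutation′ m) → (∀ x → π ⟨$⟩ʳ x ≡ ρ ⟨$⟩ʳ x) →
  ∀ x → restrict S π ⟨$⟩ʳ x ≡ restrict S ρ ⟨$⟩ʳ x
restrict-cong S π ρ eq x = sym (restrict-conj S π S ρ id id id (λ x → sym (eq x)) x)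

-- G alternates between the ingoing half-edges, in the order given by c, and the opposite half-edges.
module EdgeCycle {α : Permutation′ m} {I : Subset m} (orient : IsOrientation α I) (c : Permutation′ m)
  (c-∉ : ∀ {x} → x ∉ I → c ⟨$⟩ʳ x ≡ x) (closed : Closed I c) {i : Fin m} (i∈ : i ∈ I)
  (reach-c : ∀ {x} → x ∈ I → Reach c i x) where
  open IsOrientation orient

  G : Permutation′ m
  G = c · α

  G-∈ : ∀ {x} → x ∈ I → G ⟨$⟩ʳ x ≡ α ⟨$⟩ʳ x
  G-∈ x∈ = c-∉ (∈⇒∉ x∈)

  G-α : ∀ x → G ⟨$⟩ʳ (α ⟨$⟩ʳ x) ≡ c ⟨$⟩ʳ x
  G-α x = cong (c ⟨$⟩ʳ_) (involutive x)

  reach-∈ : ∀ {x y} → x ∈ I → Reach c x y → Reach G x y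
  reach-∈ x∈ ε          = ε
  reach-∈ x∈ (refl ◅ r) = G-∈ x∈ ◅ G-α _ ◅ reach-∈ (closed x∈) r

  reach-G : ∀ x → Reach G i x
  reach-G x = case x ∈? I of λ where
    (yes x∈) → reach-∈ i∈ (reach-c x∈)
    (no x∉)  → reach-∈ i∈ (reach-c (∉⇒∈ x∉)) ◅◅ trans (G-∈ (∉⇒∈ x∉)) (involutive x) ◅ ε

module Glue (α τ : Permutation′ m) (I : Subset m) (orient : IsOrientation α I) (o : Fin m) (τ-o : τ ⟨$⟩ʳ o ≡ o) (o∉I : o ∉ I)
  (unique : ∀ {x y} → x ∈ I → y ∈ I → Reach τ x y → x ≡ y) (conn : Connected (τ · α))
  (σᴮ αᴮ : Permutation′ n) (W : Subset n) (orientᴮ : IsOrientation αᴮ W) (W-σ : Closed W σᴮ)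
  (W-σ-∉ : ∀ {x} → x ∉ W → σᴮ ⟨$⟩ʳ x ∉ W) (r : Fin n) (r∈W : r ∈ W) (connᴮ : Connected (σᴮ · αᴮ)) (n≡m : n ≡ m) where
  private
    module O = IsOrientation orient
    module Oᴮ = IsOrientation orientᴮ
    i = α ⟨$⟩ʳ o
    i∈I = O.∉⇒∈ o∉I
    F = σᴮ · αᴮ
    D = restrict I (α · τ)

    F-∈ : ∀ {x} → x ∈ W → F ⟨$⟩ʳ x ∉ W
    F-∈ x∈ = W-σ-∉ (Oᴮ.∈⇒∉ x∈)
    F-∉ : ∀ {x} → x ∉ W → F ⟨$⟩ʳ x ∈ W
    F-∉ x∉ = W-σ (Oᴮ.∉⇒∈ x∉)

    cᴮ = restrict W (F · F)

    cᴮ-∈ : ∀ {x} → x ∈ W → cᴮ ⟨$⟩ʳ x ≡ F ⟨$⟩ʳ (F ⟨$⟩ʳ x)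
    cᴮ-∈ x∈ = restrict-stable W (F · F) x∈ (F-∉ (F-∈ x∈))

    cᴮ-reach : ∀ {x y} → x ∈ W → y ∈ W → Reach F x y → Reach cᴮ x y
    cᴮ-reach x∈ y∈ ε                    = ε
    cᴮ-reach x∈ y∈ (refl ◅ ε)           = ⊥-elim (F-∈ x∈ y∈)
    cᴮ-reach x∈ y∈ (refl ◅ (refl ◅ r)) = cᴮ-∈ x∈ ◅ cᴮ-reach (F-∉ (F-∈ x∈)) y∈ r

    D⁻-∉ : ∀ {x} → x ∉ I → D ⟨$⟩ˡ x ≡ x
    D⁻-∉ x∉ = perm-inj D (trans (inverseʳ D) (sym (restrict-∉ I (α · τ) x∉)))

    D⁻-∈ : Closed I (flip D)
    D⁻-∈ {x} x∈ = decidable-stable (_ ∈? I) λ ∉ →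
      ∉ (subst (_∈ I) (trans (sym (inverseʳ D)) (restrict-∉ I (α · τ) ∉)) x∈)

    module Gᴬ = EdgeCycle orient (flip D) D⁻-∉ (λ {x} → D⁻-∈ {x}) i∈I
      (λ x∈ → Reach-flip D (Reach-restrict I (α · τ) x∈ i∈I (Connected-swap τ α O.involutive conn _ _)))
    module Gᴮ = EdgeCycle orientᴮ cᴮ (restrict-∉ W (F · F)) (restrict-closed W (F · F)) r∈W
      (λ x∈ → cᴮ-reach r∈W x∈ (connᴮ r _))
    -- Each `G` encodes the edges, the two sides and the cyclic order together, so a single
    -- conjugation aligns all three.
    module Match = Matching Gᴮ.G r Gᴮ.reach-G Gᴬ.G i Gᴬ.reach-G n≡m

  ι : Permutation n m
  ι = Match.matching

  ι-r : ι ⟨$⟩ʳ r ≡ i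
  ι-r = Match.matching-start

  private
    colour : ∀ x → (x ∈ W × ι ⟨$⟩ʳ x ∈ I) ⊎ (x ∉ W × ι ⟨$⟩ʳ x ∉ I)
    colour x = reach-closed Gᴮ.G (λ x → (x ∈ W × ι ⟨$⟩ʳ x ∈ I) ⊎ (x ∉ W × ι ⟨$⟩ʳ x ∉ I)) step (Gᴮ.reach-G x)
      (inj₁ (r∈W , subst (_∈ I) (sym ι-r) i∈I))
      where
      step : ∀ {x} → (x ∈ W × ι ⟨$⟩ʳ x ∈ I) ⊎ (x ∉ W × ι ⟨$⟩ʳ x ∉ I) →
        (Gᴮ.G ⟨$⟩ʳ x ∈ W × ι ⟨$⟩ʳ (Gᴮ.G ⟨$⟩ʳ x) ∈ I) ⊎ (Gᴮ.G ⟨$⟩ʳ x ∉ W × ι ⟨$⟩ʳ (Gᴮ.G ⟨$⟩ʳ x) ∉ I)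
      step {x} (inj₁ (x∈ , ιx∈)) = inj₂
        ( subst (_∉ W) (sym (Gᴮ.G-∈ x∈)) (Oᴮ.∈⇒∉ x∈)
        , subst (_∉ I) (trans (sym (Gᴬ.G-∈ ιx∈)) (Match.matching-conj x)) (O.∈⇒∉ ιx∈))
      step {x} (inj₂ (x∉ , ιx∉)) = inj₁
        ( restrict-closed W (F · F) (Oᴮ.∉⇒∈ x∉)
        , subst (_∈ I) (Match.matching-conj x) (D⁻-∈ (O.∉⇒∈ ιx∉)))

  ι-W : ι preserves W ⇒ I
  ι-W = (λ {x} x∈ → case colour x of λ { (inj₁ (_ , p)) → p ; (inj₂ (x∉ , _)) → ⊥-elim (x∉ x∈) })
      , (λ {x} x∉ → case colour x of λ { (inj₁ (x∈ , _)) → ⊥-elim (x∉ x∈) ; (inj₂ (_ , p)) → p })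

  ι-α : Conj ι αᴮ α
  ι-α x = case x ∈? W of λ where
      (yes x∈) → on-W x∈
      (no x∉)  → perm-inj α (trans (O.involutive _) (sym (trans (on-W (Oᴮ.∉⇒∈ x∉)) (cong (ι ⟨$⟩ʳ_) (Oᴮ.involutive x)))))
    where
    on-W : ∀ {x} → x ∈ W → α ⟨$⟩ʳ (ι ⟨$⟩ʳ x) ≡ ι ⟨$⟩ʳ (αᴮ ⟨$⟩ʳ x)
    on-W x∈ = trans (sym (Gᴬ.G-∈ (proj₁ ι-W x∈))) (trans (Match.matching-conj _) (cong (ι ⟨$⟩ʳ_) (Gᴮ.G-∈ x∈)))

  ι-c : ∀ {x} → x ∈ W → D ⟨$⟩ʳ (ι ⟨$⟩ʳ (F ⟨$⟩ʳ (F ⟨$⟩ʳ x))) ≡ ι ⟨$⟩ʳ x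
  ι-c {x} x∈ = trans (cong (D ⟨$⟩ʳ_) (sym eq)) (inverseʳ D)
    where
    eq : D ⟨$⟩ˡ (ι ⟨$⟩ʳ x) ≡ ι ⟨$⟩ʳ (F ⟨$⟩ʳ (F ⟨$⟩ʳ x))
    eq = trans (sym (Gᴬ.G-α _)) (trans (cong (Gᴬ.G ⟨$⟩ʳ_) (ι-α x)) (trans (Match.matching-conj _)
      (cong (ι ⟨$⟩ʳ_) (trans (Gᴮ.G-α x) (cᴮ-∈ x∈)))))

  π∘ : Permutation′ m
  π∘ = restrict I (ι · (σᴮ · flip ι))

  π∘-ι : ∀ {x} → x ∈ W → π∘ ⟨$⟩ʳ (ι ⟨$⟩ʳ x) ≡ ι ⟨$⟩ʳ (σᴮ ⟨$⟩ʳ x)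
  π∘-ι {x} x∈ = trans (restrict-stable I (ι · (σᴮ · flip ι)) (proj₁ ι-W x∈) (subst (_∈ I) (sym eq) (proj₁ ι-W (W-σ x∈)))) eq
    where
    eq : ι ⟨$⟩ʳ (σᴮ ⟨$⟩ʳ (ι ⟨$⟩ˡ (ι ⟨$⟩ʳ x))) ≡ ι ⟨$⟩ʳ (σᴮ ⟨$⟩ʳ x)
    eq = cong (λ y → ι ⟨$⟩ʳ (σᴮ ⟨$⟩ʳ y)) (inverseˡ ι)

  abstract
    σ : Permutation′ m
    σ = τ · π∘

    σ-spec : ∀ x → σ ⟨$⟩ʳ x ≡ τ ⟨$⟩ʳ (π∘ ⟨$⟩ʳ x)
    σ-spec x = refl

  σ-∉ : ∀ {x} → x ∉ I → σ ⟨$⟩ʳ x ≡ τ ⟨$⟩ʳ x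
  σ-∉ x∉ = trans (σ-spec _) (cong (τ ⟨$⟩ʳ_) (restrict-∉ I (ι · (σᴮ · flip ι)) x∉))

  σ-o : σ ⟨$⟩ʳ o ≡ o
  σ-o = trans (σ-∉ o∉I) τ-o

  private module U = Unfolding α σ I orient

  -- From x, σ starts as τ does from `π∘ x`. As a vertex of the tree has a single ingoing half-edge,
  -- τ next meets I at `π∘ x` itself.
  unfold-π∘ : ∀ x → U.π∘ ⟨$⟩ʳ x ≡ π∘ ⟨$⟩ʳ x
  unfold-π∘ x = case x ∈? I of λ where
      (yes x∈) → Ret-deterministic (U.π∘-Ret x∈)
        (Ret-head (λ w∉ → sym (σ-∉ w∉)) (sym (σ-spec x)) (loop (restrict-closed I (ι · (σᴮ · flip ι)) x∈)))
      (no x∉)  → trans (U.π∘-fix x∉) (sym (restrict-∉ I (ι · (σᴮ · flip ι)) x∉))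
    where
    loop : ∀ {z} → z ∈ I → Ret (_∈ I) τ z z
    loop {z} z∈ = subst (Ret (_∈ I) τ z) (sym (unique z∈ (Ret-target ret) (Ret⇒Reach ret))) ret
      where ret = restrict-Ret I τ z∈

  unfold-τ : ∀ x → U.τ ⟨$⟩ʳ x ≡ τ ⟨$⟩ʳ x
  unfold-τ x = trans (U.τ-spec x) (trans (σ-spec _) (cong (τ ⟨$⟩ʳ_) (trans (sym (unfold-π∘ _)) (inverseʳ U.π∘))))

  -- White half-edges agree by the choice of `π∘`. For a black x, `D` inverts the square of both
  -- face permutations, so the squares agree at `w = αᴮ x`; cancelling their second step, `π∘` after
  -- α, leaves the black value.
  unfold-mobile : Conj ι σᴮ U.π
  unfold-mobile x = case x ∈? W of λ where
      (yes x∈) → white x∈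
      (no x∉)  → black x∉
    where
    white : ∀ {x} → x ∈ W → U.π ⟨$⟩ʳ (ι ⟨$⟩ʳ x) ≡ ι ⟨$⟩ʳ (σᴮ ⟨$⟩ʳ x)
    white x∈ = trans (U.π-∈ (proj₁ ι-W x∈)) (trans (unfold-π∘ _) (π∘-ι x∈))
    D≡ : ∀ z → U.D ⟨$⟩ʳ z ≡ D ⟨$⟩ʳ z
    D≡ z = trans (cong (_⟨$⟩ʳ z) U.D≡) (restrict-cong I (α · U.τ) (α · τ) (λ x → cong (α ⟨$⟩ʳ_) (unfold-τ x)) z)
    black : ∀ {x} → x ∉ W → U.π ⟨$⟩ʳ (ι ⟨$⟩ʳ x) ≡ ι ⟨$⟩ʳ (σᴮ ⟨$⟩ʳ x)
    black {x} x∉ = perm-inj α (perm-inj π∘ (trans πk (sym πσ)))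
      where
      w = αᴮ ⟨$⟩ʳ x
      w∈ : w ∈ W
      w∈ = Oᴮ.∉⇒∈ x∉
      k = U.π ⟨$⟩ʳ (ι ⟨$⟩ʳ x)
      k∉ : k ∉ I
      k∉ = U.π-closed-∉ (proj₂ ι-W x∉)
      FF : U.F ⟨$⟩ʳ (U.F ⟨$⟩ʳ (ι ⟨$⟩ʳ w)) ≡ ι ⟨$⟩ʳ (F ⟨$⟩ʳ (F ⟨$⟩ʳ w))
      FF = perm-inj D (trans (sym (D≡ _)) (trans (U.D-F-F (proj₁ ι-W w∈)) (sym (ι-c w∈))))
      Fw : U.F ⟨$⟩ʳ (ι ⟨$⟩ʳ w) ≡ k
      Fw = cong (U.π ⟨$⟩ʳ_) (trans (ι-α w) (cong (ι ⟨$⟩ʳ_) (Oᴮ.involutive x)))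
      πk : π∘ ⟨$⟩ʳ (α ⟨$⟩ʳ k) ≡ ι ⟨$⟩ʳ (F ⟨$⟩ʳ (F ⟨$⟩ʳ w))
      πk = trans (sym (unfold-π∘ _)) (trans (sym (U.π-∈ (O.∉⇒∈ k∉))) (trans (cong (U.F ⟨$⟩ʳ_) (sym Fw)) FF))
      πσ : π∘ ⟨$⟩ʳ (α ⟨$⟩ʳ (ι ⟨$⟩ʳ (σᴮ ⟨$⟩ʳ x))) ≡ ι ⟨$⟩ʳ (F ⟨$⟩ʳ (F ⟨$⟩ʳ w))
      πσ = trans (cong (π∘ ⟨$⟩ʳ_) (ι-α _)) (trans (π∘-ι (Oᴮ.∉⇒∈ (W-σ-∉ x∉)))
        (cong (λ y → ι ⟨$⟩ʳ (F ⟨$⟩ʳ (σᴮ ⟨$⟩ʳ y))) (sym (Oᴮ.involutive x))))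

-- The covered map with given images

-- θ, and with it every position, depends only on σ, α and S. Hence Δ applied to the rebuilt covered
-- map returns the orientation of the given tree.
motion-I-unique : {α σ₁ θ₁ σ₂ θ₂ : Permutation′ m} {S I₁ I₂ : Subset m} {o : Fin m} →
  IsMotion α σ₁ θ₁ S I₁ o → IsMotion α σ₂ θ₂ S I₂ o → (∀ x → σ₁ ⟨$⟩ʳ x ≡ σ₂ ⟨$⟩ʳ x) → ∀ {x} → x ∈ I₁ → x ∈ I₂
motion-I-unique {α = α} {σ₁} {θ₁} {σ₂} {θ₂} {S} {I₁} {I₂} M₁ M₂ σ≡ x∈ = M₂.⇐ (case M₁.⇒ x∈ of λ where
    (inj₁ (x∈S , lt)) → inj₁ (x∈S , subst₂ _<_ (pos≡ _) (pos≡ _) lt)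
    (inj₂ (x∉S , lt)) → inj₂ (x∉S , subst₂ _<_ (pos≡ _) (pos≡ _) lt))
  where
  module M₁ = IsMotion M₁
  module M₂ = IsMotion M₂
  θ≡ : ∀ x → θ₁ ⟨$⟩ʳ x ≡ θ₂ ⟨$⟩ʳ x
  θ≡ x = case x ∈? S of λ where
    (yes x∈) → trans (M₁.θ-∈ x∈) (trans (σ≡ _) (sym (M₂.θ-∈ x∈)))
    (no x∉)  → trans (M₁.θ-∉ x∉) (trans (σ≡ _) (sym (M₂.θ-∉ x∉)))
  visit≡ : ∀ k → M₁.visit k ≡ M₂.visit k
  visit≡ zero    = trans M₁.visit-zero (sym M₂.visit-zero)
  visit≡ (suc k) = trans (M₁.visit-suc k) (trans (θ≡ _) (trans (cong (θ₂ ⟨$⟩ʳ_) (visit≡ k)) (sym (M₂.visit-suc k))))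
  pos≡ : ∀ x → M₁.pos x ≡ M₂.pos x
  pos≡ x = ≤-antisym (M₁.pos-min (trans (visit≡ _) (M₂.visit-pos x))) (M₂.pos-min (trans (sym (visit≡ _)) (M₁.visit-pos x)))

lift²-id : (x : Fin (2+ m)) → lift² Perm.id ⟨$⟩ʳ x ≡ x
lift²-id 0F            = refl
lift²-id 1F            = refl
lift²-id (suc (suc h)) = refl

extension-unique : {π : Permutation′ m} {π′ ρ′ : Permutation′ (2+ m)} → Extends π π′ → π′ ⟨$⟩ʳ 1F ≡ 1F →
  Extends π ρ′ → ρ′ ⟨$⟩ʳ 1F ≡ 1F → unlift (ρ′ ⟨$⟩ʳ 0F) ≡ unlift (π′ ⟨$⟩ʳ 0F) → ∀ x → ρ′ ⟨$⟩ʳ x ≡ π′ ⟨$⟩ʳ x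
extension-unique {π = π} {π′} {ρ′} ext fix ext′ fix′ root≡ x = trans (cong (ρ′ ⟨$⟩ʳ_) (sym (lift²-id x)))
  (trans (rooted-conj Perm.id {π} {π′} {π} {ρ′} ext fix ext′ fix′ (λ _ → refl) (trans root≡ (sym (map-id _))) x) (lift²-id _))

module Covering {m} (α : Permutation′ m) (inv : ∀ h → α ⟨$⟩ʳ (α ⟨$⟩ʳ h) ≡ h) (fpf : ∀ h → α ⟨$⟩ʳ h ≢ h)
  (σ : Permutation′ m) (σ′ θ′ : Permutation′ (2+ m)) (extσ : Extends σ σ′) (S : Subset m) (I′ : Subset (2+ m))
  (motion′ : IsMotion (swap⁺ α) σ′ θ′ (inside ∷ inside ∷ S) I′ 1F) where
  open IsMotion motion′ using (σ-o; θ-∈; θ-∉; reach) renaming (stable to stable′)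

  private
    S′ : Subset (2+ m)
    S′ = inside ∷ inside ∷ S
    u′ : Permutation′ (2+ m)
    u′ = restrict S′ (swap⁺ α)

  -- i stands just before the root, so the root is its image. This image is never o, which is fixed,
  -- and it is i only if there is no other half-edge.
  M : PreMap
  M = record { σ = σ ; α = α ; root = unlift (σ′ ⟨$⟩ʳ 0F) }

  stable : Closed S α
  stable {x} x∈ = case subst (_∈ S′) (swap⁺-⁺ α x) (stable′ (there (there x∈))) of λ { (there (there p)) → p }

  private
    u-0 : u′ ⟨$⟩ʳ 0F ≡ 1F
    u-0 = trans (restrict-stable S′ (swap⁺ α) here (stable′ here)) (swap⁺-0 α)

    u-1 : u′ ⟨$⟩ʳ 1F ≡ 0F
    u-1 = trans (restrict-stable S′ (swap⁺ α) (there here) (stable′ (there here))) (swap⁺-1 α)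

    θ≡ : ∀ x → θ′ ⟨$⟩ʳ x ≡ σ′ ⟨$⟩ʳ (u′ ⟨$⟩ʳ x)
    θ≡ x = case x ∈? S′ of λ where
      (yes x∈) → trans (θ-∈ x∈) (cong (σ′ ⟨$⟩ʳ_) (sym (restrict-stable S′ (swap⁺ α) x∈ (stable′ x∈))))
      (no x∉)  → trans (θ-∉ x∉) (cong (σ′ ⟨$⟩ʳ_) (sym (restrict-∉ S′ (swap⁺ α) x∉)))

    reach″ : ∀ x → Reach (σ′ · u′) 1F x
    reach″ x = Reach-cong θ′ (σ′ · u′) θ≡ (reach x)

    ext : Extends (σ · restrict S α) (σ′ · u′)
    ext = extends-∘ {π = σ} {σ′} extσ σ-o {restrict S α} {u′} (restrict-swap⁺ α S stable) u-0 u-1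

    tour-0 : σ′ ⟨$⟩ʳ (u′ ⟨$⟩ʳ 0F) ≡ 1F
    tour-0 = trans (cong (σ′ ⟨$⟩ʳ_) u-0) σ-o

  conn : Connected (σ · restrict S α)
  conn = connected-⁺⁻ {ξ = σ · restrict S α} {σ′ · u′} ext tour-0 reach″

  isMap : IsMap M
  isMap = record
    { involutive = inv ; fixedPointFree = fpf ; transitive = λ _ _ → steps (conn _ _)
    ; rooted = λ eq → case root-of-connected (σ′ · u′) tour-0 reach″ of λ where
        (inj₁ m≡0)     → m≡0
        (inj₂ (r , e)) → case trans (sym eq) (cong unlift (trans (cong (σ′ ⟨$⟩ʳ_) (sym u-1)) e)) of λ () }
    where
    u-step : ∀ x → EqClosure (λ h h′ → σ ⟨$⟩ʳ h ≡ h′ ⊎ α ⟨$⟩ʳ h ≡ h′) x (restrict S α ⟨$⟩ʳ x)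
    u-step x = case x ∈? S of λ where
      (yes x∈) → fwd (inj₂ (sym (restrict-stable S α x∈ (stable x∈)))) ◅ ε
      (no x∉)  → subst (EqClosure _ x) (sym (restrict-∉ S α x∉)) ε
    steps : ∀ {x y} → Reach (σ · restrict S α) x y → EqClosure (λ h h′ → σ ⟨$⟩ʳ h ≡ h′ ⊎ α ⟨$⟩ʳ h ≡ h′) x y
    steps ε       = ε
    steps (e ◅ r) = u-step _ Star.◅◅ (fwd (inj₁ e) ◅ steps r)

  isCovered : IsCovered M S
  isCovered = connected⇒covered M S stable conn

  σ′-insert : ∀ x → insert (unlift (σ′ ⟨$⟩ʳ 0F)) 0F σ ⟨$⟩ʳ x ≡ σ′ ⟨$⟩ʳ x
  σ′-insert = extension-unique {π = σ} {σ′} {insert (unlift (σ′ ⟨$⟩ʳ 0F)) 0F σ}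
    extσ σ-o (insert-extends (unlift (σ′ ⟨$⟩ʳ 0F)) σ) (insert-1 (unlift (σ′ ⟨$⟩ʳ 0F)) σ) (insert-0 (unlift (σ′ ⟨$⟩ʳ 0F)) σ)

-- Permutations are equal only pointwise, so the glued data and the data recomputed from the
-- contracted map are related by isomorphisms: the identity on the tree side, the gluing bijection
-- on the mobile side.
module Compare (X : Unfolded m) (σ′ : Permutation′ (2+ m)) (I′ : Subset (2+ m))
  (σ≡ : ∀ x → Unfolded.σ′ X ⟨$⟩ʳ x ≡ σ′ ⟨$⟩ʳ x) (I⇒ : ∀ {x} → x ∈ I′ → x ∈ Unfolded.I′ X)
  (I⇐ : ∀ {x} → x ∈ Unfolded.I′ X → x ∈ I′) where
  private
    module X = Unfolded X
    module UC = UnfoldConj Perm.id (swap⁺ X.α) σ′ (swap⁺ X.α) X.σ′ I′ X.I′ (I⇒ , λ x∉ x∈ → x∉ (I⇐ x∈)) (λ _ → refl) σ≡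
    module U = UnfoldedPermutations (swap⁺ X.α) σ′ I′

  isoA : (τ : Permutation′ m) (τ′ : Permutation′ (2+ m)) (ρ : Maybe (Fin m)) → Extends τ τ′ →
    (∀ x → U.τ ⟨$⟩ʳ x ≡ τ′ ⟨$⟩ʳ x) → unlift (τ′ ⟨$⟩ʳ 0F) ≡ ρ →
    Iso X.A (record { σ = τ ; α = X.α ; root = ρ }) Perm.id
  isoA τ τ′ ρ ext Uτ root≡ = record
    { conj-σ = extends-conj⁻ Perm.id {X.τᴬ} {X.τ′} {τ} {τ′} X.extᴬ ext
        λ x → trans (cong (τ′ ⟨$⟩ʳ_) (lift²-id x)) (trans (sym (agree x)) (sym (lift²-id _)))
    ; conj-α = λ _ → refl
    ; root = trans (sym root≡) (trans (cong unlift (sym (agree 0F))) (trans (sym X.rootᴬ≡) (sym (map-id _)))) }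
    where
    agree : ∀ x → X.τ′ ⟨$⟩ʳ x ≡ τ′ ⟨$⟩ʳ x
    agree x = trans (cong (_⟨$⟩ʳ x) (sym X.τ≡τ′)) (trans (UC.conj-τ x) (Uτ x))

  isoB : (σᴮ αᴮ : Permutation′ n) (r : Fin n) (ι : Permutation n (2+ m)) → Conj ι σᴮ U.π → Conj ι αᴮ (swap⁺ X.α) →
    ι ⟨$⟩ʳ r ≡ 0F → Iso (record { σ = σᴮ ; α = αᴮ ; root = just r }) X.B ι
  isoB σᴮ αᴮ r ι c cα ι-r = record
    { conj-σ = λ x → trans (X.ρ≡ _) (trans (UC.conj-π _) (c x))
    ; conj-α = subst (Conj ι αᴮ) (swap⁺≡ X.α) cα
    ; root = cong just (sym ι-r) }

inside-tail : (T : Subset (2+ m)) → 0F ∈ T → 1F ∈ T → ∃[ S ] T ≡ inside ∷ inside ∷ S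
inside-tail (.inside ∷ .inside ∷ S) here (there here) = S , refl

record Glued (α : Permutation′ m) (τ′ : Permutation′ (2+ m)) (σᴮ αᴮ : Permutation′ n) (r : Fin n) : Set where
  field
    σ′ θ′         : Permutation′ (2+ m)
    S             : Subset m
    I′            : Subset (2+ m)
    motion′       : IsMotion (swap⁺ α) σ′ θ′ (inside ∷ inside ∷ S) I′ 1F
    ι             : Permutation n (2+ m)
    ι-α           : Conj ι αᴮ (swap⁺ α)
    ι-r           : ι ⟨$⟩ʳ r ≡ 0F
    unfold-tree   : ∀ x → UnfoldedPermutations.τ (swap⁺ α) σ′ I′ ⟨$⟩ʳ x ≡ τ′ ⟨$⟩ʳ x
    unfold-mobile : Conj ι σᴮ (UnfoldedPermutations.π (swap⁺ α) σ′ I′)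

module Preimage (τ α : Permutation′ m) (τ′ : Permutation′ (2+ m)) (ext : Extends τ τ′) (τ′-1 : τ′ ⟨$⟩ʳ 1F ≡ 1F)
  (τ′-root : m ≡ 0 ⊎ ∃[ r ] τ′ ⟨$⟩ʳ 0F ≡ r ⁺) (inv : ∀ h → α ⟨$⟩ʳ (α ⟨$⟩ʳ h) ≡ h) (fpf : ∀ h → α ⟨$⟩ʳ h ≢ h)
  (conn : Connected (τ · α)) (count : 1 ⊔ #cycles ⊤ τ ≡ suc (#cycles ⊤ α))
  (σᴮ αᴮ : Permutation′ n) (W : Subset n) (orientᴮ : IsOrientation αᴮ W) (W-σ : Closed W σᴮ)
  (W-σ-∉ : ∀ {x} → x ∉ W → σᴮ ⟨$⟩ʳ x ∉ W) (r : Fin n) (r∈W : r ∈ W) (connᴮ : Connected (σᴮ · αᴮ))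
  (countᴮ : #cycles ⊤ αᴮ ≡ suc (#cycles ⊤ α)) where
  private
    ext-tour : Extends (τ · α) (τ′ · swap⁺ α)
    ext-tour = extends-∘ {π = τ} {τ′} ext τ′-1 {α} {swap⁺ α} (swap⁺-⁺ α) (swap⁺-0 α) (swap⁺-1 α)

    #edges′ : #cycles ⊤ (swap⁺ α) ≡ suc (#cycles ⊤ α)
    #edges′ = trans (cong (#cycles ⊤) (swap⁺≡ α)) (#edges-swap α)

    abstract
      reach : ∀ x → Reach (τ′ · swap⁺ α) 1F x
      reach = connected-⁺ {ξ = τ · α} {τ′ · swap⁺ α} ext-tour (trans (cong (τ′ ⟨$⟩ʳ_) (swap⁺-0 α)) τ′-1)
        (case τ′-root of λ where
          (inj₁ z)        → inj₁ z
          (inj₂ (r , eq)) → inj₂ (r , trans (cong (τ′ ⟨$⟩ʳ_) (swap⁺-1 α)) eq)) conn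

    module TT = TreeTour (swap⁺ α) τ′ 1F (swap⁺-involutive α inv) (swap⁺-fixedPointFree α fpf) τ′-1 reach V ∈V⇒≢1
      (ℕ.≤-reflexive (trans #edges′ (trans (sym count) (sym (#cycles-V {π = τ} {τ′} ext τ′-1 τ′-root)))))

    size≡ : n ≡ 2+ m
    size≡ = trans (#size orientᴮ) (trans (cong₂ _+_ eq eq) (sym (#size TT.orientation)))
      where
      eq : #cycles ⊤ αᴮ ≡ #cycles ⊤ (swap⁺ α)
      eq = trans countᴮ (sym #edges′)

    module Gl = Glue (swap⁺ α) τ′ TT.I TT.orientation 1F τ′-1 TT.o∉I TT.unique
      (λ x y → reach-sym (τ′ · swap⁺ α) (reach x) ◅◅ reach y) σᴮ αᴮ W orientᴮ W-σ W-σ-∉ r r∈W connᴮ size≡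

    module Wk = Walk (swap⁺ α) Gl.σ TT.I TT.orientation (swap⁺-fixedPointFree α fpf) 1F Gl.σ-o TT.o∉I TT.rk (2+ m) TT.rk≤ TT.rk-α
      (λ {x} x∉ x≢o → subst (λ y → TT.rk x < TT.rk y) (sym (Gl.σ-∉ x∉)) (TT.up x∉ x≢o))

  abstract
    glued : Glued α τ′ σᴮ αᴮ r
    glued = record
      { σ′ = Gl.σ ; θ′ = Wk.θ ; S = proj₁ tail ; I′ = TT.I
      ; motion′ = subst (λ S′ → IsMotion (swap⁺ α) Gl.σ Wk.θ S′ TT.I 1F) (proj₂ tail) Wk.isMotion
      ; ι = Gl.ι ; ι-α = Gl.ι-α ; ι-r = trans Gl.ι-r (swap⁺-1 α)
      ; unfold-tree = Gl.unfold-τ ; unfold-mobile = Gl.unfold-mobile }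
      where
      0∈ : 0F ∈ Wk.S
      0∈ = subst (_∈ Wk.S) (swap⁺-1 α) (IsMotion.stable Wk.isMotion (IsMotion.o∈S Wk.isMotion))
      tail : ∃[ S ] Wk.S ≡ inside ∷ inside ∷ S
      tail = inside-tail Wk.S 0∈ (IsMotion.o∈S Wk.isMotion)

-- From a tree and a mobile to their covered map

#cycles-conj-≤ : (ι : Permutation m n) {π : Permutation′ m} {ρ : Permutation′ n} → Conj ι π ρ → #cycles ⊤ π ≤ #cycles ⊤ ρ
#cycles-conj-≤ ι {π} {ρ} c = #cycles-≤ ⊤ π ⊤ ρ (⊤-closed ρ) (λ x y → y ≡ ι ⟨$⟩ʳ x) (λ _ → _ , ∈⊤ , refl)
  λ { {x} {x′} _ _ refl refl r → subst₂ (Reach π) (inverseˡ ι) (inverseˡ ι) (Reach-conj (ι ⟨$⟩ˡ_) (Conj-sym ι {π} {ρ} c) r) }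

#vertices-Iso : ∀ {M N ι} → Iso M N ι → #vertices M ≡ #vertices N
#vertices-Iso {M} {N} {ι} iso = cong (1 ⊔_) (≤-antisym
  (#cycles-conj-≤ ι {PreMap.σ M} {PreMap.σ N} (Iso.conj-σ iso))
  (#cycles-conj-≤ (flip ι) {PreMap.σ N} {PreMap.σ M} (Iso.conj-σ (Iso-sym iso))))

edge⇒root : (M : PreMap) → IsMap M → ∀ {e} → #edges M ≡ suc e → ∃[ r ] PreMap.root M ≡ just r
edge⇒root M isMap e≡ = case rooted? (PreMap.root M) (IsMap.rooted isMap) of λ where
  (inj₂ p)      → p
  (inj₁ size≡0) → ⊥-elim (ℕ.n≮0 (≤-trans (ℕ.≤-reflexive (sym e≡)) (≤-trans
    (#cycles≤length {B = Fin 0} ⊤ (PreMap.α M) [] (λ _ _ → Fin 0) (λ {x} _ → case subst Fin size≡0 x of λ ()) λ _ _ ()) z≤n)))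

colouring⇒orientation : (M : PreMap) → IsMap M → {W : Subset (PreMap.size M)} → IsProperColouring M W →
  IsOrientation (PreMap.α M) W
colouring⇒orientation M isMap col = record
  { involutive = IsMap.involutive isMap
  ; ∈⇒∉ = λ x∈ αx∈ → Equivalence.to (IsProperColouring.proper col _) αx∈ x∈
  ; ∉⇒∈ = Equivalence.from (IsProperColouring.proper col _) }

∁-colouring : (M : PreMap) {W : Subset (PreMap.size M)} → IsProperColouring M W → IsProperColouring M (∁ W)
∁-colouring M col = record
  { vertexwise = λ h → mk⇔
      (λ σh∈ → x∉p⇒x∈∁p λ h∈ → x∈∁p⇒x∉p σh∈ (Equivalence.from (vertexwise h) h∈))
      (λ h∈ → x∉p⇒x∈∁p λ σh∈ → x∈∁p⇒x∉p h∈ (Equivalence.to (vertexwise h) σh∈))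
  ; proper = λ h → mk⇔
      (λ αh∈ h∈ → x∈∁p⇒x∉p αh∈ (Equivalence.from (proper h) (x∈∁p⇒x∉p h∈)))
      (λ h∉ → x∉p⇒x∈∁p λ αh∈ → Equivalence.to (proper h) αh∈ (x∉∁p⇒x∈p h∉)) }
  where open IsProperColouring col

rootWhite : (M : PreMap) → IsBipartite M → (r : Fin (PreMap.size M)) → ∃[ W ] IsProperColouring M W × r ∈ W
rootWhite M (W , col) r = case r ∈? W of λ where
  (yes r∈) → W , col , r∈
  (no r∉)  → ∁ W , ∁-colouring M col , x∉p⇒x∈∁p r∉

unfolded-genus : ∀ {g} (X : Unfolded m) (B : PreMap) {ι} → Iso B (Unfolded.B X) ι →
  #edges B ≡ suc (#edges (Unfolded.M X)) → #faces B ≡ 1 → HasGenus g B → HasGenus g (Unfolded.M X)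
unfolded-genus X B iso e f genus = trans
  (genus-transfer (Unfolded.M X) B (trans (#vertices-Iso iso) (Unfolded.#vertices-B X)) e f) genus

module CompareImage {n g} (C : CoveredMap n g) (σ′ θ′ : Permutation′ (2+ (PreMap.size (CoveredMap.map C))))
  (I′ : Subset (2+ (PreMap.size (CoveredMap.map C))))
  (motion′ : IsMotion (swap⁺ (PreMap.α (CoveredMap.map C))) σ′ θ′ (inside ∷ inside ∷ CoveredMap.submap C) I′ 1F)
  (σ≡ : ∀ x → insert (PreMap.root (CoveredMap.map C)) 0F (PreMap.σ (CoveredMap.map C)) ⟨$⟩ʳ x ≡ σ′ ⟨$⟩ʳ x) where
  open Compare (unfoldedMap C) σ′ I′ σ≡
    (λ {x} → motion-I-unique motion′ (Unfolded.motion′ (unfoldedMap C)) (λ x → sym (σ≡ x)) {x})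
    (λ {x} → motion-I-unique (Unfolded.motion′ (unfoldedMap C)) motion′ σ≡ {x}) public

  Ψ₁≡ : Unfolded.A (unfoldedMap C) ≡ Ψ₁ C
  Ψ₁≡ = refl

  Ψ₂≡ : Unfolded.B (unfoldedMap C) ≡ Ψ₂ C
  Ψ₂≡ = refl

module Preimages {n g} (A B : PreMap) (isTree : IsPlaneTree n A) (isMobile : IsBipartiteUnicellularMap (suc n) g B) where
  private
    module A = PreMap A
    module B = PreMap B
    module IA = IsPlaneTree isTree
    module IB = IsBipartiteUnicellularMap isMobile
    module MA = IsMap IA.isMap

    rootB : ∃[ r ] B.root ≡ just r
    rootB = edge⇒root B IB.isMap IB.edges

    r : Fin B.size
    r = proj₁ rootB

    white : ∃[ W ] IsProperColouring B W × r ∈ W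
    white = rootWhite B IB.bipartite r

    W : Subset B.size
    W = proj₁ white

    col : IsProperColouring B W
    col = proj₁ (proj₂ white)

    glued : Glued A.α (insert A.root 0F A.σ) B.σ B.α r
    glued = Preimage.glued A.σ A.α (insert A.root 0F A.σ) (insert-extends A.root A.σ) (insert-1 A.root A.σ)
      (case rooted? A.root MA.rooted of λ where
        (inj₁ z)        → inj₁ z
        (inj₂ (r , eq)) → inj₂ (r , insert-just A.σ eq))
      MA.involutive MA.fixedPointFree (oneFace⁻ A IA.oneFace)
      (trans (tree-genus⁻ A IA.genus IA.edges IA.oneFace) (cong suc (sym IA.edges)))
      B.σ B.α W (colouring⇒orientation B IB.isMap col) (white-closed B col)
      (λ x∉ σx∈ → x∉ (Equivalence.to (IsProperColouring.vertexwise col _) σx∈))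
      r (proj₂ (proj₂ white)) (oneFace⁻ B IB.oneFace) (trans IB.edges (cong suc (sym IA.edges)))

    module P = Glued glued

    module Cov = Covering A.α MA.involutive MA.fixedPointFree (contract P.σ′) P.σ′ P.θ′ (contract-extends P.σ′) P.S P.I′ P.motion′

    X : Unfolded A.size
    X = Image.unfolded Cov.M P.S Cov.isMap (λ {x} → IsCovered.stable Cov.isCovered x) (covered⇒connected Cov.M P.S Cov.isCovered)

    module Cmp = Compare X P.σ′ P.I′ Cov.σ′-insert
      (λ {x} → motion-I-unique P.motion′ (Unfolded.motion′ X) (λ x → sym (Cov.σ′-insert x)) {x})
      (λ {x} → motion-I-unique (Unfolded.motion′ X) P.motion′ Cov.σ′-insert {x})

    isoB : Iso B (Unfolded.B X) P.ι
    isoB = record { conj-σ = Iso.conj-σ iso ; conj-α = Iso.conj-α iso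
                  ; root = trans (Iso.root iso) (cong (Maybe.map (P.ι ⟨$⟩ʳ_)) (sym (proj₂ rootB))) }
      where iso = Cmp.isoB B.σ B.α r P.ι P.unfold-mobile P.ι-α P.ι-r

  preimage : CoveredMap n g
  preimage = record
    { map = Cov.M ; submap = P.S ; isMap = Cov.isMap ; isCovered = Cov.isCovered
    ; genus = subst (HasGenus g) M≡ (unfolded-genus {g = g} X B isoB (trans IB.edges (cong suc (sym edges))) IB.oneFace IB.genus)
    ; edges = edges }
    where
    edges : #edges Cov.M ≡ n
    edges = IA.edges
    M≡ : Unfolded.M X ≡ Cov.M
    M≡ = refl

  private
    module Im = CompareImage preimage P.σ′ P.θ′ P.I′ P.motion′ Cov.σ′-insert

  Ψ₁-preimage : Ψ₁ preimage ≅ A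
  Ψ₁-preimage = subst (_≅ A) Im.Ψ₁≡ (Perm.id , Iso⇒IsIso
    (Im.isoA A.σ (insert A.root 0F A.σ) A.root (insert-extends A.root A.σ) P.unfold-tree (insert-0 A.root A.σ)))

  Ψ₂-preimage : Ψ₂ preimage ≅ B
  Ψ₂-preimage = subst (_≅ B) Im.Ψ₂≡ (flip P.ι , Iso⇒IsIso (Iso-sym isoB′))
    where
    iso = Im.isoB B.σ B.α r P.ι P.unfold-mobile P.ι-α P.ι-r
    isoB′ : Iso B (Unfolded.B (unfoldedMap preimage)) P.ι
    isoB′ = record { conj-σ = Iso.conj-σ iso ; conj-α = Iso.conj-α iso
                   ; root = trans (Iso.root iso) (cong (Maybe.map (P.ι ⟨$⟩ʳ_)) (sym (proj₂ rootB))) }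

mainTheorem1 : ∀ (n g : ℕ) →
    (Σ[ tree ∈ (∀ (C : CoveredMap n g) → IsPlaneTree n (Ψ₁ C)) ]
    Σ[ bip ∈ (∀ (C : CoveredMap n g) → IsBipartiteUnicellularMap (suc n) g (Ψ₂ C)) ]
    IsBijection (_≅ᶜ_ {n} {g}) (_≅ᵖ_ {n} {suc n} {g})
    (λ C → (Ψ₁ C , tree C) , (Ψ₂ C , bip C)))
    × (∀ (C : CoveredMap n g) (W : Subset (PreMap.size (Ψ₂ C))) →
    IsProperColouring (Ψ₂ C) W →
    Any (_∈ W) (PreMap.root (Ψ₂ C)) →
    #whiteVertices (Ψ₂ C) W ≡ #vertices (CoveredMap.map C)
    × #blackVertices (Ψ₂ C) W ≡ #faces (CoveredMap.map C))
mainTheorem1 n g = (tree , bip , record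
  { isInjection = record
    { isCongruent = record
      { cong = λ {C} {D} C≅D → Ψ-cong {C = C} {D} C≅D
      ; isEquivalence₁ = ≅ᶜ-isEquivalence ; isEquivalence₂ = ≅ᵖ-isEquivalence }
    ; injective = λ {C} {D} (a , b) → Ψ-injective {C = C} {D} a b }
  -- Surjectivity up to isomorphism concerns every covered map isomorphic to the preimage, hence the
  -- appeal to `Ψ-cong` first.
  ; surjective = λ ((A , isTree) , (B , isMobile)) → preimage A B isTree isMobile , λ {C} C≅ →
      E.trans {Ψ₁ C} {Ψ₁ (preimage A B isTree isMobile)} {A}
        (proj₁ (Ψ-cong {C = C} {preimage A B isTree isMobile} C≅)) (Ψ₁-preimage A B isTree isMobile)
    , E.trans {Ψ₂ C} {Ψ₂ (preimage A B isTree isMobile)} {B}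
        (proj₂ (Ψ-cong {C = C} {preimage A B isTree isMobile} C≅)) (Ψ₂-preimage A B isTree isMobile) }) , vertexCounts
  where
  open Preimages
  module E = IsEquivalence ≅-isEquivalence
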